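{- Let $\chi$ be a primitive nonprincipal Dirichlet character with conductor $q$, and let $\Phi=\{j\mid 1\le j\le q-1,\ \gcd(j,q)=1\}$. Then for all integers $n\ge 1$, $$L_n^*(\chi)=\frac{(-1)^n}{q^n}\sum_{(k_j)_{j\in\Phi}}\ \prod_{j\in\Phi}\frac{\chi(j)^{k_j}}{k_j!}\sum_{k=1}^{k_j}B_{k_j,k}\left(\psi(\tfrac jq),\psi_1(\tfrac jq),\ldots,\psi_{k_j-k}(\tfrac jq)\right),$$ where the outer sum is over all families $(k_j)_{j\in\Phi}$ of nonnegative integers with $\sum_{j\in\Phi}k_j=n$, and where for $k_j=0$ the factor of the product belonging to $j$ is understood to be $1$.
   Context: $L_n^*(\chi):=\sum_{1\le k_1\le\dots\le k_n}\frac{\chi(k_1)}{k_1}\cdots\frac{\chi(k_n)}{k_n}$, understood as the limit as $N\to\infty$ of the sums over $1\le k_1\le\dots\le k_n\le N$. $\psi(y)=\Gamma'(y)/\Gamma(y)$ is the digamma function, $\psi_0=\psi$, and $\psi_j=\psi^{(j)}$ is its $j$th derivative for $j\ge1$. For $1\le k\le n$, the partial exponential Bell polynomial is $$B_{n,k}(x_1,\ldots,x_{n-k+1})=\sum\frac{n!}{j_1!\cdots j_{n-k+1}!}\left(\frac{x_1}{1!}\right)^{j_1}\cdots\left(\frac{x_{n-k+1}}{(n-k+1)!}\right)^{j_{n-k+1}},$$ summed over all nonnegative integers $j_1,\ldots,j_{n-k+1}$ with $j_1+j_2+\dots+j_{n-k+1}=k$ and $j_1+2j_2+\dots+(n-k+1)j_{n-k+1}=n$.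 -}

module Defs where

open import Algebra.Bundles using (CommutativeRing; RawRing; RawSemiring)
open import Algebra.Apartness.Bundles using (HeytingField; HeytingCommutativeRing)
import Algebra.Apartness.Properties.HeytingCommutativeRing as HCR
import Algebra.Definitions.RawSemiring
import Algebra.Properties.Ring
open import Data.Empty using (⊥-elim)
open import Data.Fin.Base using (Fin; toℕ)
open import Data.List.Base as List
  using (List; []; _∷_; upTo; allFin; filter; cartesianProductWith; length)
open import Data.Nat.Base as ℕ using (ℕ; zero; suc; NonZero; _∸_; _!)
open import Data.Nat.Divisibility using (_∣_)
open import Data.Nat.GCD using (gcd)
open import Data.Nat.Properties using (_≟_; _!≢0; m^n≢0)
open import Data.Product.Base using (∃-syntax; _×_; _,_; proj₁; proj₂)
open import Data.Sum.Base using (_⊎_; inj₁; inj₂)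
open import Data.Vec.Base as Vec using (Vec; []; _∷_; lookup; tabulate)
open import Level using (Level; _⊔_) renaming (suc to lsuc)
open import Relation.Binary.Core using (Rel)
open import Relation.Binary.PropositionalEquality using (_≡_; _≢_)
open import Relation.Binary.Structures using (IsStrictPartialOrder)
open import Relation.Nullary using (¬_)
open import Relation.Nullary.Decidable using (_×-dec_)

-- All vectors of length m with entries in {0, …, b}.
box : (m b : ℕ) → List (Vec ℕ m)
box zero    b = [] ∷ []
box (suc m) b = cartesianProductWith _∷_ (upTo (suc b)) (box m b)

families : (m n : ℕ) → List (Vec ℕ m)
families m n = filter (λ κ → Vec.sum κ ≟ n) (box m n)

-- j₁ + 2 j₂ + ⋯ + m jₘ
weight : ∀ {m} → Vec ℕ m → ℕ
weight js = Vec.sum (tabulate (λ i → suc (toℕ i) ℕ.* lookup js i))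

-- The index set of B_{n,k}; the length n ∸ k + 1 is written suc (n ∸ k),
-- and every entry is at most k because the entries add up to k.
bellIndices : (n k : ℕ) → List (Vec ℕ (suc (n ∸ k)))
bellIndices n k =
  filter (λ js → (Vec.sum js ≟ k) ×-dec (weight js ≟ n)) (box (suc (n ∸ k)) k)

-- i : Fin (q ∸ 1) stands for the residue j = i + 1, so that 1 ≤ j ≤ q - 1.
residue : ∀ {q} → Fin (q ∸ 1) → ℕ
residue i = suc (toℕ i)

Φ : (q : ℕ) → List (Fin (q ∸ 1))
Φ q = filter (λ i → gcd (residue {q} i) q ≟ 1) (allFin (q ∸ 1))

module BigOperators {a ℓ : Level} (S : RawSemiring a ℓ) where
  open RawSemiring S

  ∑ ∏ : ∀ {i} {I : Set i} → List I → (I → Carrier) → Carrier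
  ∑ xs f = List.foldr (λ x s → f x + s) 0# xs
  ∏ xs f = List.foldr (λ x s → f x * s) 1# xs

-- Real numbers, axiomatised constructively: an Archimedean, Cauchy complete
-- ordered field.  Apartness is x < y or y < x, and cotransitivity of _<_
-- follows from cotransitivity of _#_.  Classically ℝ is the only
-- model up to isomorphism.
record RealField (c ℓ₁ ℓ₂ : Level) : Set (lsuc (c ⊔ ℓ₁ ⊔ ℓ₂)) where
  infix 4 _<_
  field
    heytingField : HeytingField c ℓ₁ ℓ₂

  open HeytingField heytingField public

  field
    _<_                  : Rel Carrier ℓ₂
    isStrictPartialOrder : IsStrictPartialOrder _≈_ _<_
    <⇒#                  : ∀ {x y} → x < y → x # y
    #⇒<⊎>                : ∀ {x y} → x # y → (x < y) ⊎ (y < x)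
    +-monoˡ-<            : ∀ {x y} z → x < y → x + z < y + z
    *-pos                : ∀ {x y} → 0# < x → 0# < y → 0# < x * y

  rawRing : RawRing c ℓ₁
  rawRing = record
    { _≈_ = _≈_ ; _+_ = _+_ ; _*_ = _*_ ; -_ = -_ ; 0# = 0# ; 1# = 1# }

  open Algebra.Definitions.RawSemiring (RawRing.rawSemiring rawRing) public
    using (_^_) renaming (_×_ to _·_)

  fromℕ : ℕ → Carrier
  fromℕ n = n · 1#

  -- ∣ x ∣< ε is the relation |x| < ε.
  ∣_∣<_ : Carrier → Carrier → Set ℓ₂
  ∣ x ∣< ε = (- ε < x) × (x < ε)

  IsCauchy : (ℕ → Carrier) → Set (c ⊔ ℓ₂)
  IsCauchy s = ∀ ε → 0# < ε →
    ∃[ N ] (∀ m n → N ℕ.≤ m → N ℕ.≤ n → ∣ s m - s n ∣< ε)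

  infix 4 _⟶_
  _⟶_ : (ℕ → Carrier) → Carrier → Set (c ⊔ ℓ₂)
  s ⟶ l = ∀ ε → 0# < ε → ∃[ N ] (∀ n → N ℕ.≤ n → ∣ s n - l ∣< ε)

  field
    archimedean : ∀ x → ∃[ n ] x < fromℕ n
    complete    : ∀ s → IsCauchy s → ∃[ l ] s ⟶ l

module Analysis {c ℓ₁ ℓ₂ : Level} (R : RealField c ℓ₁ ℓ₂) where
  open RealField R
  open BigOperators (RawRing.rawSemiring rawRing)

  private
    module < = IsStrictPartialOrder isStrictPartialOrder
    module Rₚ = Algebra.Properties.Ring (CommutativeRing.ring (HeytingCommutativeRing.commutativeRing
      (HeytingField.heytingCommutativeRing heytingField)))
    module #ₚ = HCR (HeytingField.heytingCommutativeRing heytingField)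

  0<1 : 0# < 1#
  0<1 with #⇒<⊎> #ₚ.1#0
  ... | inj₂ 0<1 = 0<1
  ... | inj₁ 1<0 = ⊥-elim (<.irrefl refl (<.trans 1<0 0<1′))
    where
    0<-1 : 0# < - 1#
    0<-1 = <.<-respˡ-≈ (-‿inverseʳ 1#)
             (<.<-respʳ-≈ (+-identityˡ (- 1#)) (+-monoˡ-< (- 1#) 1<0))
    0<1′ : 0# < 1#
    0<1′ = <.<-respʳ-≈
             (trans (Rₚ.-1*x≈-x (- 1#)) (Rₚ.-‿involutive 1#)) (*-pos 0<-1 0<-1)

  x<1+x : ∀ x → x < 1# + x
  x<1+x x = <.<-respˡ-≈ (+-identityˡ x) (+-monoˡ-< x 0<1)

  0<fromℕ : ∀ n .{{_ : NonZero n}} → 0# < fromℕ n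
  0<fromℕ (suc zero)    = x<1+x 0#
  0<fromℕ (suc (suc n)) = <.trans (0<fromℕ (suc n)) (x<1+x _)

  0<+fromℕ : ∀ {x} → 0# < x → ∀ n → 0# < x + fromℕ n
  0<+fromℕ {x} 0<x zero    = <.<-respʳ-≈ (sym (+-identityʳ x)) 0<x
  0<+fromℕ {x} 0<x (suc n) = <.trans (0<+fromℕ 0<x n)
    (<.<-respʳ-≈ eq (x<1+x _))
    where
    eq : 1# + (x + fromℕ n) ≈ x + fromℕ (suc n)
    eq = trans (sym (+-assoc 1# x _))
           (trans (+-congʳ (+-comm 1# x)) (+-assoc x 1# _))

  recip : ∀ x → 0# < x → Carrier
  recip x 0<x = proj₁ (#⇒invertible (#-sym (<⇒# 0<x)))

  recip-inverseˡ : ∀ x (0<x : 0# < x) → recip x 0<x * x ≈ 1#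
  recip-inverseˡ x 0<x = trans (*-congˡ (sym (#ₚ.x-0≈x x)))
    (proj₁ (proj₂ (#⇒invertible (#-sym (<⇒# 0<x)))))

  0<recip : ∀ x (0<x : 0# < x) → 0# < recip x 0<x
  0<recip x 0<x with #⇒<⊎> (#ₚ.invertibleʳ⇒# (x , r-0*x≈1))
    where
    r-0*x≈1 : (recip x 0<x - 0#) * x ≈ 1#
    r-0*x≈1 = trans (*-congʳ (#ₚ.x-0≈x _)) (recip-inverseˡ x 0<x)
  ... | inj₂ 0<r = 0<r
  ... | inj₁ r<0 = ⊥-elim (<.irrefl refl (<.trans 0<1 1<0))
    where
    r : Carrier
    r = recip x 0<x
    0<-r : 0# < - r
    0<-r = <.<-respˡ-≈ (-‿inverseʳ r)
             (<.<-respʳ-≈ (+-identityˡ (- r)) (+-monoˡ-< (- r) r<0))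
    0<-1 : 0# < - 1#
    0<-1 = <.<-respʳ-≈
      (trans (sym (Rₚ.-‿distribˡ-* r x)) (-‿cong (recip-inverseˡ x 0<x)))
      (*-pos 0<-r 0<x)
    1<0 : 1# < 0#
    1<0 = <.<-respˡ-≈ (+-identityˡ 1#)
            (<.<-respʳ-≈ (-‿inverseˡ 1#) (+-monoˡ-< 1# 0<-1))

  1/ℕ : (n : ℕ) .{{_ : NonZero n}} → Carrier
  1/ℕ n = recip (fromℕ n) (0<fromℕ n)

  1/_! : ℕ → Carrier
  1/ n ! = 1/ℕ (n !) {{n !≢0}}

  _/ℕ_ : ℕ → (q : ℕ) .{{_ : NonZero q}} → Carrier
  j /ℕ q = fromℕ j * 1/ℕ q

  0</ℕ : ∀ j q .{{_ : NonZero j}} .{{_ : NonZero q}} → 0# < j /ℕ q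
  0</ℕ j q = *-pos (0<fromℕ j) (0<recip (fromℕ q) (0<fromℕ q))

  -- Real functions on the open half-line x > 0.  A total extension to R need
  -- not exist constructively.
  PosFun : Set (c ⊔ ℓ₂)
  PosFun = (x : Carrier) → 0# < x → Carrier

  IsDerivative : PosFun → PosFun → Set (c ⊔ ℓ₂)
  IsDerivative f f′ = ∀ x (0<x : 0# < x) ε → 0# < ε →
    ∃[ δ ] (0# < δ) × (∀ y (0<y : 0# < y) (y#x : y # x) → ∣ y - x ∣< δ →
      ∣ (f y 0<y - f x 0<x) * proj₁ (#⇒invertible y#x) - f′ x 0<x ∣< ε)

  IsExp : (Carrier → Carrier) → Set (c ⊔ ℓ₂)
  IsExp exp = ∀ x → (λ N → ∑ (upTo N) (λ k → x ^ k * 1/ k !)) ⟶ exp x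

  IsLog : (Carrier → Carrier) → PosFun → Set (c ⊔ ℓ₁ ⊔ ℓ₂)
  IsLog exp log = ∀ x (0<x : 0# < x) → exp (log x 0<x) ≈ x

  -- Euler's definition Γ(x) = lim n! nˣ / (x (x + 1) ⋯ (x + n)), at n = m + 1.
  IsGamma : (Carrier → Carrier) → PosFun → PosFun → Set (c ⊔ ℓ₂)
  IsGamma exp log Γ = ∀ x (0<x : 0# < x) →
    (λ m → let n = suc m in
      fromℕ (n !) * exp (x * log (fromℕ n) (0<fromℕ n))
        * ∏ (upTo (suc n)) (λ i → recip (x + fromℕ i) (0<+fromℕ 0<x i)))
    ⟶ Γ x 0<x

  -- ψ Γ = Γ′; this determines ψ = Γ′ / Γ because Γ has no zeros.
  IsDigamma : PosFun → PosFun → Set (c ⊔ ℓ₁ ⊔ ℓ₂)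
  IsDigamma Γ ψ = ∃[ Γ′ ] IsDerivative Γ Γ′ ×
    (∀ x (0<x : 0# < x) → ψ x 0<x * Γ x 0<x ≈ Γ′ x 0<x)

  IsPolygamma : PosFun → (ℕ → PosFun) → Set (c ⊔ ℓ₁ ⊔ ℓ₂)
  IsPolygamma Γ ψ = IsDigamma Γ (ψ 0) × (∀ j → IsDerivative (ψ j) (ψ (suc j)))

  -- B_{n,k}; the argument x i is the variable with index i + 1.
  bell : (n k : ℕ) → (Fin (suc (n ∸ k)) → Carrier) → Carrier
  bell n k x = ∑ (bellIndices n k) λ js →
    fromℕ (n !) * ∏ (allFin (suc (n ∸ k))) (λ i →
      1/ lookup js i ! * (x i * 1/ suc (toℕ i) !) ^ lookup js i)

  infix 5 _+i_
  record ℂ : Set c where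
    constructor _+i_
    field
      re im : Carrier
  open ℂ public

  infix  4 _≈ᶜ_
  infixl 6 _+ᶜ_ _-ᶜ_
  infixl 7 _*ᶜ_

  _≈ᶜ_ : Rel ℂ ℓ₁
  z ≈ᶜ w = (re z ≈ re w) × (im z ≈ im w)

  ofℝ : Carrier → ℂ
  ofℝ x = x +i 0#

  0ᶜ 1ᶜ : ℂ
  0ᶜ = ofℝ 0#
  1ᶜ = ofℝ 1#

  _+ᶜ_ _*ᶜ_ : ℂ → ℂ → ℂ
  z +ᶜ w = (re z + re w) +i (im z + im w)
  z *ᶜ w = (re z * re w - im z * im w) +i (re z * im w + im z * re w)

  -ᶜ_ : ℂ → ℂ
  -ᶜ_ z = (- re z) +i (- im z)

  _-ᶜ_ : ℂ → ℂ → ℂ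
  z -ᶜ w = z +ᶜ (-ᶜ w)

  ℂ-rawRing : RawRing c ℓ₁
  ℂ-rawRing = record
    { _≈_ = _≈ᶜ_ ; _+_ = _+ᶜ_ ; _*_ = _*ᶜ_ ; -_ = -ᶜ_ ; 0# = 0ᶜ ; 1# = 1ᶜ }

  open BigOperators (RawRing.rawSemiring ℂ-rawRing) public
    renaming (∑ to ∑ᶜ; ∏ to ∏ᶜ)
  open Algebra.Definitions.RawSemiring (RawRing.rawSemiring ℂ-rawRing) public
    using () renaming (_^_ to _^ᶜ_)

  normSq : ℂ → Carrier
  normSq z = re z * re z + im z * im z

  infix 4 _⟶ᶜ_
  _⟶ᶜ_ : (ℕ → ℂ) → ℂ → Set (c ⊔ ℓ₂)
  s ⟶ᶜ l = ∀ ε → 0# < ε →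
    ∃[ N ] (∀ n → N ℕ.≤ n → normSq (s n -ᶜ l) < ε * ε)

  record IsDirichletCharacter (q : ℕ) (χ : ℕ → ℂ) : Set (c ⊔ ℓ₁) where
    field
      periodic       : ∀ a → χ (a ℕ.+ q) ≈ᶜ χ a
      one            : χ 1 ≈ᶜ 1ᶜ
      multiplicative : ∀ a b → χ (a ℕ.* b) ≈ᶜ χ a *ᶜ χ b
      vanishes       : ∀ a → gcd a q ≢ 1 → χ a ≈ᶜ 0ᶜ

  InducedFrom : (d q : ℕ) → (ℕ → ℂ) → Set (c ⊔ ℓ₁)
  InducedFrom d q χ = (d ∣ q) × (∃[ χ′ ] IsDirichletCharacter d χ′ ×
    (∀ a → gcd a q ≡ 1 → χ a ≈ᶜ χ′ a))

  -- conductorIsModulus: χ is induced from no proper divisor of q, i.e. it is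
  -- primitive, with conductor q.
  record IsPrimitiveCharacter (q : ℕ) (χ : ℕ → ℂ) : Set (c ⊔ ℓ₁) where
    field
      isDirichletCharacter : IsDirichletCharacter q χ
      conductorIsModulus   : ∀ d → InducedFrom d q χ → d ≡ q

  IsPrincipal : ℕ → (ℕ → ℂ) → Set ℓ₁
  IsPrincipal q χ = ∀ a → gcd a q ≡ 1 → χ a ≈ᶜ 1ᶜ

  -- The sum over 1 ≤ k₁ ≤ ⋯ ≤ kₙ ≤ N, nested with the largest index kₙ = i + 1
  -- outermost.
  L*-partial : (ℕ → ℂ) → ℕ → ℕ → ℂ
  L*-partial χ zero    N = 1ᶜ
  L*-partial χ (suc n) N = ∑ᶜ (upTo N) λ i →
    let k = suc i in χ k *ᶜ ofℝ (1/ℕ k) *ᶜ L*-partial χ n k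

  module _ (q : ℕ) .{{_ : NonZero q}} (χ : ℕ → ℂ) (ψ : ℕ → PosFun) where

    factor : (j : ℕ) .{{_ : NonZero j}} → ℕ → ℂ
    factor j zero      = 1ᶜ
    factor j κ@(suc _) = χ j ^ᶜ κ *ᶜ ofℝ (1/ κ ! *
      ∑ (List.map suc (upTo κ)) (λ k →
        bell κ k (λ i → ψ (toℕ i) (j /ℕ q) (0</ℕ j q))))

    polygammaSum : ℕ → ℂ
    polygammaSum n =
      ofℝ ((- 1#) ^ n * 1/ℕ (q ℕ.^ n) {{m^n≢0 q n}}) *ᶜ
      ∑ᶜ (families (length (Φ q)) n) (λ κ →
        ∏ᶜ (allFin (length (Φ q))) (λ i →
          factor (residue {q} (List.lookup (Φ q) i)) (lookup κ i)))

-- Both sides are determined by a recursion of Newton's type, n Lₙ = ∑ᵢ Pᵢ Lₙ₋ᵢ (the coefficients of a series with a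
-- given logarithmic derivative).  The truncated sums satisfy it with the power sums Pᵢ(N) = ∑_{k ≤ N} (χ(k) / k)ⁱ;
-- the right-hand side is a product over j of the series exp (∑ₗ ψₗ(j/q) sˡ⁺¹ / (l + 1)!), s = - χ(j) t / q, and
-- satisfies it with Aᵢ = (-1/q)ⁱ / (i - 1)! ∑ⱼ χ(j)ⁱ ψᵢ₋₁(j/q).  So it suffices that Pᵢ(N) tends to Aᵢ.
--
-- Split into residue classes, Pᵢ becomes a combination of the sums ∑_{m < M} (m + j/q)⁻ⁱ; for i = 1 they are
-- compared with log M, which is harmless because ∑ⱼ χ(j) = 0.  Their limits come from convexity: Euler's
-- approximations of Γ and the power sums are convex, and if convex functions converge pointwise to a
-- differentiable function, their derivatives converge to its derivative.  This gives ψ from Γ (Euler's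
-- approximations are at least 1/2 on (0 , 1)), and then each polygamma function from the preceding one.

module Submission where

open import Defs
open import Algebra.Apartness.Bundles using (HeytingField; HeytingCommutativeRing)
open import Algebra.Bundles using (CommutativeRing; RawRing)
import Algebra.Properties.CommutativeMonoid.Sum
import Algebra.Properties.CommutativeSemiring.Exp
import Algebra.Properties.Ring
import Algebra.Properties.Semiring.Exp
import Algebra.Properties.Semiring.Mult
import Algebra.Properties.Semiring.Mult.TCOptimised
import Algebra.Solver.Ring
open import Algebra.Solver.Ring.AlmostCommutativeRing using (_-Raw-AlmostCommutative⟶_; fromCommutativeRing)
open import Data.Bool.Base using (if_then_else_)
open import Data.Fin.Base using (Fin; toℕ; fromℕ<) renaming (zero to fzero; suc to fsuc)
open import Data.Fin.Permutation using (Permutation′; permutation; _⟨$⟩ʳ_)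
import Data.Fin.Properties as Finₚ
open import Data.Integer.Base as ℤ using (ℤ; +_; -[1+_]; _⊖_)
import Data.Integer.Properties as ℤₚ
open import Data.List.Base as List using (List; []; _∷_; _++_; upTo; allFin; filter; cartesianProductWith; length)
import Data.List.Properties as Listₚ
open import Data.Maybe.Base using (Maybe; just; nothing)
open import Data.Nat.Base as ℕ using (ℕ; zero; suc; z≤n; s≤s; NonZero; _!)
open import Data.Nat.Coprimality using (gcd≡1⇒coprime; coprime-Bézout)
import Data.Nat.DivMod as DivMod
open import Data.Nat.Divisibility using (∣-refl)
open import Data.Nat.GCD using (gcd; module Bézout)
import Data.Nat.Properties as ℕₚ
open import Data.Nat.Tactic.RingSolver using (solve-∀)
open import Data.Product.Base using (_×_; _,_; proj₁; proj₂; ∃-syntax)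
open import Data.Sum.Base using (_⊎_; inj₁; inj₂; [_,_]′)
open import Data.Vec.Base as Vec using (Vec; []; _∷_; lookup)
open import Function.Base using (_∘_; id)
open import Level using (Level)
open import Relation.Binary.PropositionalEquality as ≡ using (_≡_; _≢_)
import Relation.Binary.Reasoning.Base.Triple as Triple
import Relation.Binary.Reasoning.Setoid as SetoidReasoning
open import Relation.Binary.Structures using (IsStrictPartialOrder; IsPreorder)
open import Relation.Nullary using (Dec; yes; no; does; ¬_)
open import Relation.Nullary.Decidable using (_×-dec_)
open import Relation.Unary using (Pred; Decidable)

-- The constructive setting decides the shape of the analysis. `Γ`, `log` and the polygamma
-- functions are known only through pointwise limits, `exp (log x) ≈ x` and derivatives, so no
-- uniform convergence is at hand for exchanging a derivative with a limit. A tangent line below a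
-- convex function gives the exchange from pointwise data. Only logarithms of integers occur:
-- log-convexity of Euler's products is the inequality `1 + x ≤ exp x`, multiplied over the factors.
--
-- The slopes obtained for `Γ` are `φ n` times Euler's product, and they tend to `ψ Γ`. To divide
-- before passing to the limit, Euler's products must stay away from zero; the bound 1/2 comes from
-- their value `(n + 1) / (n + 2)` at 1. All points `j / q` lie below 1, which is why `(0 , 1)` is
-- the domain of the argument.
--
-- Newton's recursion turns nested sums, which converge only conditionally, into polynomials in
-- single sums, so that the passage to the limit is continuity of sums and products. On the side of
-- the Bell polynomials it allows work coefficient by coefficient, where no question of convergence
-- arises.

-- Algebra over a commutative ring: solver, finite sums, Cauchy products.

module RingKit {c ℓ : Level} (K : CommutativeRing c ℓ) where
  open CommutativeRing K hiding (zero)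
  open Algebra.Properties.Ring ring
  private
    module U = Algebra.Properties.Semiring.Mult semiring
    module O = Algebra.Properties.Semiring.Mult.TCOptimised semiring

  open SetoidReasoning setoid

  -- Integer coefficients give the solver a decidable equality. The optimised multiple computes
  -- `1 × x` to `x`, so the constants of the solver become `0#` and `1#` by definition.
  ⟦_⟧ℤ : ℤ → Carrier
  ⟦ + n ⟧ℤ      = n O.× 1#
  ⟦ -[1+ n ] ⟧ℤ = - (suc n O.× 1#)

  ⟦⟧-⊖ : ∀ m n → ⟦ m ⊖ n ⟧ℤ ≈ m O.× 1# - n O.× 1#
  ⟦⟧-⊖ m zero = begin
    m O.× 1#        ≈⟨ +-identityʳ _ ⟨
    m O.× 1# + 0#   ≈⟨ +-congˡ -0#≈0# ⟨
    m O.× 1# - 0#   ∎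
  ⟦⟧-⊖ zero    (suc n) = sym (+-identityˡ _)
  ⟦⟧-⊖ (suc m) (suc n) = begin
    ⟦ suc m ⊖ suc n ⟧ℤ                      ≡⟨ ≡.cong ⟦_⟧ℤ (ℤₚ.[1+m]⊖[1+n]≡m⊖n m n) ⟩
    ⟦ m ⊖ n ⟧ℤ                              ≈⟨ ⟦⟧-⊖ m n ⟩
    x - y                                   ≈⟨ +-congʳ (+-identityˡ x) ⟨
    0# + x - y                              ≈⟨ +-congʳ (+-congʳ (-‿inverseˡ 1#)) ⟨
    (- 1# + 1#) + x - y                     ≈⟨ +-congʳ (+-assoc _ _ _) ⟩
    - 1# + (1# + x) - y                     ≈⟨ +-congʳ (+-comm _ _) ⟩
    (1# + x) - 1# - y                       ≈⟨ +-assoc _ _ _ ⟩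
    (1# + x) + (- 1# - y)                   ≈⟨ +-congˡ (⁻¹-∙-comm 1# y) ⟩
    (1# + x) - (1# + y)                     ≈⟨ +-cong (O.1+× m 1#) (-‿cong (O.1+× n 1#)) ⟨
    suc m O.× 1# - suc n O.× 1#             ∎
    where
    open import Algebra.Properties.AbelianGroup +-abelianGroup using (⁻¹-∙-comm)
    x = m O.× 1#
    y = n O.× 1#

  ⟦⟧-+ : ∀ i j → ⟦ i ℤ.+ j ⟧ℤ ≈ ⟦ i ⟧ℤ + ⟦ j ⟧ℤ
  ⟦⟧-+ (+ m)    (+ n)    = O.×-homo-+ 1# m n
  ⟦⟧-+ (+ m)    -[1+ n ] = ⟦⟧-⊖ m (suc n)
  ⟦⟧-+ -[1+ m ] (+ n)    = trans (⟦⟧-⊖ n (suc m)) (+-comm _ _)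
  ⟦⟧-+ -[1+ m ] -[1+ n ] = begin
    - (suc (suc (m ℕ.+ n)) O.× 1#)        ≡⟨ ≡.cong (λ k → - (k O.× 1#)) (≡.sym (ℕₚ.+-suc (suc m) n)) ⟩
    - ((suc m ℕ.+ suc n) O.× 1#)          ≈⟨ -‿cong (O.×-homo-+ 1# (suc m) (suc n)) ⟩
    - (suc m O.× 1# + suc n O.× 1#)       ≈⟨ ⁻¹-∙-comm _ _ ⟨
    - (suc m O.× 1#) - (suc n O.× 1#)     ∎
    where open import Algebra.Properties.AbelianGroup +-abelianGroup using (⁻¹-∙-comm)

  ⟦⟧-neg : ∀ i → ⟦ ℤ.- i ⟧ℤ ≈ - ⟦ i ⟧ℤ
  ⟦⟧-neg (+ zero)  = sym -0#≈0#
  ⟦⟧-neg (+ suc n) = refl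
  ⟦⟧-neg -[1+ n ]  = sym (-‿involutive _)

  ⟦⟧-*ℕ : ∀ m i → ⟦ + m ℤ.* i ⟧ℤ ≈ m O.× 1# * ⟦ i ⟧ℤ
  ⟦⟧-*ℕ m (+ n) = begin
    ⟦ + m ℤ.* + n ⟧ℤ        ≡⟨ ≡.cong ⟦_⟧ℤ (≡.sym (ℤₚ.pos-* m n)) ⟩
    (m ℕ.* n) O.× 1#        ≈⟨ O.×1-homo-* m n ⟩
    m O.× 1# * (n O.× 1#)   ∎
  ⟦⟧-*ℕ m -[1+ n ] = begin
    ⟦ + m ℤ.* -[1+ n ] ⟧ℤ                 ≡⟨ ≡.cong ⟦_⟧ℤ (≡.sym (ℤₚ.neg-distribʳ-* (+ m) (+ suc n))) ⟩
    ⟦ ℤ.- (+ m ℤ.* + suc n) ⟧ℤ            ≈⟨ ⟦⟧-neg (+ m ℤ.* + suc n) ⟩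
    - ⟦ + m ℤ.* + suc n ⟧ℤ                ≈⟨ -‿cong (⟦⟧-*ℕ m (+ suc n)) ⟩
    - (m O.× 1# * (suc n O.× 1#))         ≈⟨ -‿distribʳ-* _ _ ⟩
    m O.× 1# * - (suc n O.× 1#)           ∎

  ⟦⟧-* : ∀ i j → ⟦ i ℤ.* j ⟧ℤ ≈ ⟦ i ⟧ℤ * ⟦ j ⟧ℤ
  ⟦⟧-* (+ m) j = ⟦⟧-*ℕ m j
  ⟦⟧-* -[1+ m ] j = begin
    ⟦ -[1+ m ] ℤ.* j ⟧ℤ             ≡⟨ ≡.cong ⟦_⟧ℤ (≡.sym (ℤₚ.neg-distribˡ-* (+ suc m) j)) ⟩
    ⟦ ℤ.- (+ suc m ℤ.* j) ⟧ℤ        ≈⟨ ⟦⟧-neg (+ suc m ℤ.* j) ⟩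
    - ⟦ + suc m ℤ.* j ⟧ℤ            ≈⟨ -‿cong (⟦⟧-*ℕ (suc m) j) ⟩
    - (suc m O.× 1# * ⟦ j ⟧ℤ)       ≈⟨ -‿distribˡ-* _ _ ⟩
    - (suc m O.× 1#) * ⟦ j ⟧ℤ       ∎

  private
    morphism : ℤ.+-*-rawRing -Raw-AlmostCommutative⟶ fromCommutativeRing K
    morphism = record
      { ⟦_⟧ = ⟦_⟧ℤ ; +-homo = ⟦⟧-+ ; *-homo = ⟦⟧-* ; -‿homo = ⟦⟧-neg ; 0-homo = refl ; 1-homo = refl }

    ≟-weak : ∀ i j → Maybe (⟦ i ⟧ℤ ≈ ⟦ j ⟧ℤ)
    ≟-weak i j with i ℤₚ.≟ j
    ... | yes i≡j = just (reflexive (≡.cong ⟦_⟧ℤ i≡j))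
    ... | no  _   = nothing

  open Algebra.Solver.Ring ℤ.+-*-rawRing (fromCommutativeRing K) morphism ≟-weak public
    using (solve; _:=_; _:+_; _:*_; _:-_; :-_; con; Polynomial)

  :1 :0 : ∀ {n} → Polynomial n
  :1 = con (+ 1)
  :0 = con (+ 0)

  private module B = BigOperators (RawRing.rawSemiring rawRing)

  -- Opaque copies: the unfolded sums and products would obstruct unification.
  opaque
    ∑ ∏ : ∀ {i} {I : Set i} → List I → (I → Carrier) → Carrier
    ∑ = B.∑
    ∏ = B.∏

    ∑-def : ∀ {i} {I : Set i} (xs : List I) f → ∑ xs f ≡ B.∑ xs f
    ∑-def xs f = ≡.refl

    ∏-def : ∀ {i} {I : Set i} (xs : List I) f → ∏ xs f ≡ B.∏ xs f
    ∏-def xs f = ≡.refl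

    ∑-[] : ∀ {i} {I : Set i} (f : I → Carrier) → ∑ [] f ≈ 0#
    ∑-[] f = refl

    ∑-singleton : ∀ {i} {I : Set i} (x : I) (f : I → Carrier) → ∑ (x ∷ []) f ≈ f x
    ∑-singleton x f = +-identityʳ _

    ∏-[] : ∀ {i} {I : Set i} (f : I → Carrier) → ∏ [] f ≈ 1#
    ∏-[] f = refl

  open Algebra.Properties.Semiring.Exp semiring public using (_^_; ^-congˡ)
  open Algebra.Properties.CommutativeSemiring.Exp commutativeSemiring public using (^-distrib-*)

  -- The plain multiple is chosen because over the reals it is `fromℕ` by definition, and
  -- `embed (suc n)` unfolds to `1# + embed n`.
  embed : ℕ → Carrier
  embed n = n U.× 1#

  embed-+ : ∀ m n → embed (m ℕ.+ n) ≈ embed m + embed n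
  embed-+ = U.×-homo-+ 1#

  embed-* : ∀ m n → embed (m ℕ.* n) ≈ embed m * embed n
  embed-* = U.×1-homo-*

  1^n≈1 : ∀ n → 1# ^ n ≈ 1#
  1^n≈1 zero    = refl
  1^n≈1 (suc n) = trans (*-identityˡ _) (1^n≈1 n)

  -- Turns a filter into a factor: the sum then runs over a whole box and can be iterated entry by
  -- entry.
  iverson : ∀ {p} {P : Set p} → Dec P → Carrier
  iverson P? = if does P? then 1# else 0#

  module _ {i} {I : Set i} where

    opaque
      unfolding ∑ ∏

      ∑-cong : ∀ (xs : List I) {f g : I → Carrier} → (∀ x → f x ≈ g x) → ∑ xs f ≈ ∑ xs g
      ∑-cong []       f≈g = refl
      ∑-cong (x ∷ xs) f≈g = +-cong (f≈g x) (∑-cong xs f≈g)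

      ∑-zero : ∀ (xs : List I) {f : I → Carrier} → (∀ x → f x ≈ 0#) → ∑ xs f ≈ 0#
      ∑-zero []       f≈0 = refl
      ∑-zero (x ∷ xs) f≈0 = trans (+-cong (f≈0 x) (∑-zero xs f≈0)) (+-identityˡ 0#)

      ∑-distrib-+ : ∀ (xs : List I) (f g : I → Carrier) → ∑ xs (λ x → f x + g x) ≈ ∑ xs f + ∑ xs g
      ∑-distrib-+ []       f g = sym (+-identityˡ 0#)
      ∑-distrib-+ (x ∷ xs) f g = trans (+-congˡ (∑-distrib-+ xs f g))
        (solve 4 (λ a b c d → (a :+ b) :+ (c :+ d) := (a :+ c) :+ (b :+ d)) refl _ _ _ _)

      *-distribˡ-∑ : ∀ (xs : List I) a (f : I → Carrier) → a * ∑ xs f ≈ ∑ xs (λ x → a * f x)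
      *-distribˡ-∑ []       a f = zeroʳ a
      *-distribˡ-∑ (x ∷ xs) a f = trans (distribˡ a _ _) (+-congˡ (*-distribˡ-∑ xs a f))

      *-distribʳ-∑ : ∀ (xs : List I) a (f : I → Carrier) → ∑ xs f * a ≈ ∑ xs (λ x → f x * a)
      *-distribʳ-∑ []       a f = zeroˡ a
      *-distribʳ-∑ (x ∷ xs) a f = trans (distribʳ a _ _) (+-congˡ (*-distribʳ-∑ xs a f))

      ∑-++ : ∀ (xs ys : List I) (f : I → Carrier) → ∑ (xs ++ ys) f ≈ ∑ xs f + ∑ ys f
      ∑-++ []       ys f = sym (+-identityˡ _)
      ∑-++ (x ∷ xs) ys f = trans (+-congˡ (∑-++ xs ys f)) (sym (+-assoc _ _ _))

      ∏-++ : ∀ (xs ys : List I) (f : I → Carrier) → ∏ (xs ++ ys) f ≈ ∏ xs f * ∏ ys f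
      ∏-++ []       ys f = sym (*-identityˡ _)
      ∏-++ (x ∷ xs) ys f = trans (*-congˡ (∏-++ xs ys f)) (sym (*-assoc _ _ _))

      ∑-filter : ∀ {p} {P : Pred I p} (P? : Decidable P) xs (f : I → Carrier) →
        ∑ (filter P? xs) f ≈ ∑ xs (λ x → iverson (P? x) * f x)
      ∑-filter P? []       f = refl
      ∑-filter P? (x ∷ xs) f with P? x
      ... | yes _ = +-cong (sym (*-identityˡ _)) (∑-filter P? xs f)
      ... | no  _ = trans (∑-filter P? xs f) (sym (trans (+-congʳ (zeroˡ _)) (+-identityˡ _)))

  iverson-yes : ∀ {p} {P : Set p} (P? : Dec P) → P → iverson P? ≈ 1#
  iverson-yes (yes _) _ = refl
  iverson-yes (no ¬p) p with () ← ¬p p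

  iverson-no : ∀ {p} {P : Set p} (P? : Dec P) → ¬ P → iverson P? ≈ 0#
  iverson-no (no _)  _  = refl
  iverson-no (yes p) ¬p with () ← ¬p p

  module _ {i j} {I : Set i} {J : Set j} where

    opaque
      unfolding ∑ ∏

      ∑-map : ∀ (h : I → J) xs (f : J → Carrier) → ∑ (List.map h xs) f ≈ ∑ xs (f ∘ h)
      ∑-map h []       f = refl
      ∑-map h (x ∷ xs) f = +-congˡ (∑-map h xs f)

      ∏-map : ∀ (h : I → J) xs (f : J → Carrier) → ∏ (List.map h xs) f ≈ ∏ xs (f ∘ h)
      ∏-map h []       f = refl
      ∏-map h (x ∷ xs) f = *-congˡ (∏-map h xs f)

      ∑-comm : ∀ xs ys (f : I → J → Carrier) →
        ∑ xs (λ x → ∑ ys (f x)) ≈ ∑ ys (λ y → ∑ xs (λ x → f x y))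
      ∑-comm []       ys f = sym (∑-zero ys (λ _ → refl))
      ∑-comm (x ∷ xs) ys f = trans (+-congˡ (∑-comm xs ys f)) (sym (∑-distrib-+ ys _ _))

  opaque
    unfolding ∑ ∏

    ∑-cartesianProductWith : ∀ {i j k} {I : Set i} {J : Set j} {L : Set k} (h : I → J → L) xs ys (f : L → Carrier) →
      ∑ (cartesianProductWith h xs ys) f ≈ ∑ xs (λ x → ∑ ys (λ y → f (h x y)))
    ∑-cartesianProductWith h []       ys f = refl
    ∑-cartesianProductWith h (x ∷ xs) ys f = trans (∑-++ (List.map (h x) ys) _ f)
      (+-cong (∑-map (h x) ys f) (∑-cartesianProductWith h xs ys f))

    ∑-upTo-head : ∀ n f → ∑ (upTo (suc n)) f ≈ f 0 + ∑ (upTo n) (f ∘ suc)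
    ∑-upTo-head n f = +-congˡ (trans
      (reflexive (≡.cong (λ xs → ∑ xs f) (≡.sym (Listₚ.map-upTo suc n)))) (∑-map suc (upTo n) f))

    ∑-upTo-last : ∀ n f → ∑ (upTo (suc n)) f ≈ ∑ (upTo n) f + f n
    ∑-upTo-last n f = trans (reflexive (≡.cong (λ xs → ∑ xs f) (≡.sym (Listₚ.upTo-∷ʳ n))))
      (trans (∑-++ (upTo n) (n ∷ []) f) (+-congˡ (+-identityʳ _)))

    ∏-upTo-last : ∀ n f → ∏ (upTo (suc n)) f ≈ ∏ (upTo n) f * f n
    ∏-upTo-last n f = trans (reflexive (≡.cong (λ xs → ∏ xs f) (≡.sym (Listₚ.upTo-∷ʳ n))))
      (trans (∏-++ (upTo n) (n ∷ []) f) (*-congˡ (*-identityʳ _)))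

  ∑-upTo-+ : ∀ m n f → ∑ (upTo (m ℕ.+ n)) f ≈ ∑ (upTo m) f + ∑ (upTo n) (λ i → f (m ℕ.+ i))
  ∑-upTo-+ zero    n f = sym (trans (+-congʳ (∑-[] f)) (+-identityˡ _))
  ∑-upTo-+ (suc m) n f = begin
    ∑ (upTo (suc m ℕ.+ n)) f                                            ≈⟨ ∑-upTo-head (m ℕ.+ n) f ⟩
    f 0 + ∑ (upTo (m ℕ.+ n)) (f ∘ suc)                                  ≈⟨ +-congˡ (∑-upTo-+ m n (f ∘ suc)) ⟩
    f 0 + (∑ (upTo m) (f ∘ suc) + ∑ (upTo n) (λ i → f (suc m ℕ.+ i)))   ≈⟨ +-assoc _ _ _ ⟨
    f 0 + ∑ (upTo m) (f ∘ suc) + ∑ (upTo n) (λ i → f (suc m ℕ.+ i))     ≈⟨ +-congʳ (∑-upTo-head m f) ⟨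
    ∑ (upTo (suc m)) f + ∑ (upTo n) (λ i → f (suc m ℕ.+ i))             ∎

  ∑-upTo-cong : ∀ n {f g : ℕ → Carrier} → (∀ i → i ℕ.< n → f i ≈ g i) → ∑ (upTo n) f ≈ ∑ (upTo n) g
  ∑-upTo-cong zero    f≈g = trans (∑-[] _) (sym (∑-[] _))
  ∑-upTo-cong (suc n) {f} {g} f≈g = begin
    ∑ (upTo (suc n)) f    ≈⟨ ∑-upTo-last n f ⟩
    ∑ (upTo n) f + f n    ≈⟨ +-cong (∑-upTo-cong n (λ i i<n → f≈g i (ℕₚ.m<n⇒m<1+n i<n))) (f≈g n ℕₚ.≤-refl) ⟩
    ∑ (upTo n) g + g n    ≈⟨ ∑-upTo-last n g ⟨
    ∑ (upTo (suc n)) g    ∎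

  ∑-upTo-* : ∀ q n f → ∑ (upTo (n ℕ.* q)) f ≈ ∑ (upTo n) (λ m → ∑ (upTo q) (λ r → f (m ℕ.* q ℕ.+ r)))
  ∑-upTo-* q zero    f = trans (∑-[] _) (sym (∑-[] _))
  ∑-upTo-* q (suc n) f = begin
    ∑ (upTo (q ℕ.+ n ℕ.* q)) f  ≡⟨ ≡.cong (λ k → ∑ (upTo k) f) (ℕₚ.+-comm q (n ℕ.* q)) ⟩
    ∑ (upTo (n ℕ.* q ℕ.+ q)) f  ≈⟨ ∑-upTo-+ (n ℕ.* q) q f ⟩
    ∑ (upTo (n ℕ.* q)) f + ∑ (upTo q) (λ r → f (n ℕ.* q ℕ.+ r))  ≈⟨ +-congʳ (∑-upTo-* q n f) ⟩
    _ ≈⟨ ∑-upTo-last n _ ⟨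
    ∑ (upTo (suc n)) (λ m → ∑ (upTo q) (λ r → f (m ℕ.* q ℕ.+ r))) ∎

  opaque
    unfolding ∑ ∏

    ∑-allFin-head : ∀ n (f : Fin (suc n) → Carrier) → ∑ (allFin (suc n)) f ≈ f fzero + ∑ (allFin n) (f ∘ fsuc)
    ∑-allFin-head n f = +-congˡ (trans
      (reflexive (≡.cong (λ xs → ∑ xs f) (≡.sym (Listₚ.map-tabulate id fsuc)))) (∑-map fsuc (allFin n) f))

    ∏-allFin-head : ∀ n (f : Fin (suc n) → Carrier) → ∏ (allFin (suc n)) f ≈ f fzero * ∏ (allFin n) (f ∘ fsuc)
    ∏-allFin-head n f = *-congˡ (trans
      (reflexive (≡.cong (λ xs → ∏ xs f) (≡.sym (Listₚ.map-tabulate id fsuc)))) (∏-map fsuc (allFin n) f))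

  ∑-allFin-toℕ : ∀ n (f : ℕ → Carrier) → ∑ (allFin n) (f ∘ toℕ) ≈ ∑ (upTo n) f
  ∑-allFin-toℕ zero    f = trans (∑-[] _) (sym (∑-[] _))
  ∑-allFin-toℕ (suc n) f = trans (∑-allFin-head n (f ∘ toℕ))
    (trans (+-congˡ (∑-allFin-toℕ n (f ∘ suc))) (sym (∑-upTo-head n f)))

  opaque
    unfolding ∑

    ∑-lookup : ∀ {i} {I : Set i} (xs : List I) (f : I → Carrier) →
      ∑ (allFin (List.length xs)) (λ k → f (List.lookup xs k)) ≈ ∑ xs f
    ∑-lookup []       f = refl
    ∑-lookup (x ∷ xs) f = trans (∑-allFin-head (List.length xs) _) (+-congˡ (∑-lookup xs f))

  -- The coefficient of `tⁿ` in a product of two power series. Recursion on the shifted first series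
  -- keeps truncated subtraction out of the proofs; `conv-∑` gives the usual form.
  conv : (ℕ → Carrier) → (ℕ → Carrier) → ℕ → Carrier
  conv a b zero    = a 0 * b 0
  conv a b (suc n) = a 0 * b (suc n) + conv (a ∘ suc) b n

  conv-cong : ∀ {a a′ b b′} n → (∀ k → k ℕ.≤ n → a k ≈ a′ k) → (∀ k → k ℕ.≤ n → b k ≈ b′ k) → conv a b n ≈ conv a′ b′ n
  conv-cong zero    a≈ b≈ = *-cong (a≈ 0 z≤n) (b≈ 0 z≤n)
  conv-cong (suc n) a≈ b≈ = +-cong (*-cong (a≈ 0 z≤n) (b≈ (suc n) ℕₚ.≤-refl))
    (conv-cong n (λ k k≤n → a≈ (suc k) (s≤s k≤n)) (λ k k≤n → b≈ k (ℕₚ.m≤n⇒m≤1+n k≤n)))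

  conv-+ˡ : ∀ a a′ b n → conv (λ k → a k + a′ k) b n ≈ conv a b n + conv a′ b n
  conv-+ˡ a a′ b zero    = distribʳ _ _ _
  conv-+ˡ a a′ b (suc n) = trans (+-congˡ (conv-+ˡ (a ∘ suc) (a′ ∘ suc) b n))
    (solve 5 (λ x y z u v → (x :+ y) :* z :+ (u :+ v) := (x :* z :+ u) :+ (y :* z :+ v)) refl _ _ _ _ _)

  conv-*ˡ : ∀ x a b n → conv (λ k → x * a k) b n ≈ x * conv a b n
  conv-*ˡ x a b zero    = *-assoc _ _ _
  conv-*ˡ x a b (suc n) = trans (+-congˡ (conv-*ˡ x (a ∘ suc) b n))
    (solve 4 (λ x y z u → x :* y :* z :+ x :* u := x :* (y :* z :+ u)) refl _ _ _ _)

  conv-*ʳ : ∀ x a b n → conv a (λ k → x * b k) n ≈ x * conv a b n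
  conv-*ʳ x a b zero    = solve 3 (λ x y z → y :* (x :* z) := x :* (y :* z)) refl _ _ _
  conv-*ʳ x a b (suc n) = trans (+-congˡ (conv-*ʳ x (a ∘ suc) b n))
    (solve 4 (λ x y z u → y :* (x :* z) :+ x :* u := x :* (y :* z :+ u)) refl _ _ _ _)

  conv-zeroˡ : ∀ a b n → (∀ k → a k ≈ 0#) → conv a b n ≈ 0#
  conv-zeroˡ a b zero    a≈0 = trans (*-congʳ (a≈0 0)) (zeroˡ _)
  conv-zeroˡ a b (suc n) a≈0 = trans (+-cong (trans (*-congʳ (a≈0 0)) (zeroˡ _)) (conv-zeroˡ (a ∘ suc) b n (λ k → a≈0 (suc k)))) (+-identityˡ 0#)

  -- The substitution of `z t` for `t` in a product of series. The first series begins in degree 1,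
  -- as logarithmic derivatives do, hence `suc`.
  conv-geometric : ∀ z b d n → conv (λ l → z ^ suc l * b l) (λ m → z ^ m * d m) n ≈ z ^ suc n * conv b d n
  conv-geometric z b d zero    = solve 3 (λ z b d → (z :* :1 :* b) :* (:1 :* d) := z :* :1 :* (b :* d)) refl z (b 0) (d 0)
  conv-geometric z b d (suc n) = trans
    (+-congˡ (trans (conv-cong n (λ _ _ → *-assoc _ _ _) (λ _ _ → refl)) (trans (conv-*ˡ z _ _ n) (*-congˡ (conv-geometric z (b ∘ suc) d n)))))
    (solve 5 (λ z p b d c → z :* :1 :* b :* (p :* d) :+ z :* (p :* c) := z :* p :* (b :* d :+ c)) refl z (z ^ suc n) (b 0) (d (suc n)) _)

  embed-^ : ∀ m n → embed (m ℕ.^ n) ≈ embed m ^ n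
  embed-^ m zero    = +-identityʳ 1#
  embed-^ m (suc n) = trans (embed-* m (m ℕ.^ n)) (*-congˡ (embed-^ m n))

  conv-∑ : ∀ a b n → conv a b n ≈ ∑ (upTo (suc n)) (λ l → a l * b (n ℕ.∸ l))
  conv-∑ a b zero    = sym (trans (∑-upTo-last 0 _) (trans (+-congʳ (∑-[] _)) (+-identityˡ _)))
  conv-∑ a b (suc n) = trans (+-congˡ (conv-∑ (a ∘ suc) b n)) (sym (∑-upTo-head (suc n) _))

  -- The product rule for the derivation that multiplies the n-th coefficient by n.
  conv-leibniz : ∀ a b n → embed (suc n) * conv a b (suc n) ≈
    conv (λ k → embed (suc k) * a (suc k)) b n + conv a (λ k → embed (suc k) * b (suc k)) n
  conv-leibniz a b zero = solve 5
    (λ e a0 a1 b0 b1 → e :* (a0 :* b1 :+ a1 :* b0) := (e :* a1) :* b0 :+ a0 :* (e :* b1)) refl _ _ _ _ _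
  conv-leibniz a b (suc n) = begin
    (1# + e) * (a 0 * b (suc (suc n)) + conv a⁺ b (suc n))
      ≈⟨ solve 4 (λ e a0 b2 c → (:1 :+ e) :* (a0 :* b2 :+ c) := a0 :* ((:1 :+ e) :* b2) :+ (c :+ e :* c)) refl _ _ _ _ ⟩
    a 0 * b² + (conv a⁺ b (suc n) + e * conv a⁺ b (suc n))
      ≈⟨ +-congˡ (+-congˡ (conv-leibniz a⁺ b n)) ⟩
    a 0 * b² + (a 1 * b (suc n) + C₁ + (C₂ + C₃))
      ≈⟨ solve 5 (λ x y z u v → x :+ (y :+ z :+ (u :+ v)) := (y :+ (z :+ u)) :+ (x :+ v)) refl _ _ _ _ _ ⟩
    a 1 * b (suc n) + (C₁ + C₂) + (a 0 * b² + C₃)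
      ≈⟨ +-congʳ (+-cong (solve 2 (λ x y → x :* y := (:1 :+ :0) :* x :* y) refl _ _) (sym eq)) ⟩
    embed 1 * a 1 * b (suc n) + conv (λ k → embed (suc (suc k)) * a (suc (suc k))) b n + (a 0 * b² + C₃) ∎
    where
    e  = embed (suc n)
    a⁺ = a ∘ suc
    b² = (1# + e) * b (suc (suc n))
    C₁ = conv (a⁺ ∘ suc) b n
    C₂ = conv (λ k → embed (suc k) * a⁺ (suc k)) b n
    C₃ = conv a⁺ (λ k → embed (suc k) * b (suc k)) n
    eq : conv (λ k → embed (suc (suc k)) * a (suc (suc k))) b n ≈ C₁ + C₂
    eq = trans (conv-cong n (λ k _ → trans (distribʳ _ _ _) (+-congʳ (*-identityˡ _))) (λ _ _ → refl)) (conv-+ˡ _ _ b n)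

  -- In generating functions: `(1 - x t) L′ = L`, multiplied by `p`.
  conv-shiftʳ : ∀ x p L L′ → L′ 0 ≈ L 0 → (∀ k → L′ (suc k) ≈ L (suc k) + x * L′ k) →
    ∀ n → conv p L′ (suc n) ≈ conv p L (suc n) + x * conv p L′ n
  conv-shiftʳ x p L L′ h0 hs zero = trans (+-cong (*-congˡ (hs 0)) (*-congˡ h0))
    (solve 6 (λ x p0 p1 l0 l1 l0′ → p0 :* (l1 :+ x :* l0′) :+ p1 :* l0 := p0 :* l1 :+ p1 :* l0 :+ x :* (p0 :* l0′)) refl _ _ _ _ _ _)
  conv-shiftʳ x p L L′ h0 hs (suc n) = trans (+-cong (*-congˡ (hs (suc n))) (conv-shiftʳ x (p ∘ suc) L L′ h0 hs n))
    (solve 6 (λ x p0 l l′ c c′ → p0 :* (l :+ x :* l′) :+ (c :+ x :* c′) := p0 :* l :+ c :+ x :* (p0 :* l′ :+ c′)) refl _ _ _ _ _ _)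

  -- L and L′ are the complete homogeneous symmetric functions before and after the variable x is added.
  newton-step : ∀ x p L L′ → L′ 0 ≈ L 0 → (∀ k → L′ (suc k) ≈ L (suc k) + x * L′ k) →
    (∀ n → embed (suc n) * L (suc n) ≈ conv p L n) →
    ∀ n → embed (suc n) * L′ (suc n) ≈ conv (λ k → p k + x ^ suc k) L′ n
  newton-step x p L L′ h0 hs ih zero = begin
    embed 1 * L′ 1                       ≈⟨ *-congˡ (hs 0) ⟩
    embed 1 * (L 1 + x * L′ 0)           ≈⟨ distribˡ _ _ _ ⟩
    embed 1 * L 1 + embed 1 * (x * L′ 0) ≈⟨ +-congʳ (ih 0) ⟩
    p 0 * L 0 + embed 1 * (x * L′ 0)     ≈⟨ +-congʳ (*-congˡ (sym h0)) ⟩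
    p 0 * L′ 0 + embed 1 * (x * L′ 0)    ≈⟨ solve 3 (λ p l x → p :* l :+ (:1 :+ :0) :* (x :* l) := (p :+ x :* :1) :* l) refl _ _ _ ⟩
    (p 0 + x ^ 1) * L′ 0                 ∎
  newton-step x p L L′ h0 hs ih (suc n) = begin
    (1# + e) * L′ (suc (suc n))
      ≈⟨ *-congˡ (hs (suc n)) ⟩
    (1# + e) * (L (suc (suc n)) + x * L′ (suc n))
      ≈⟨ solve 4 (λ e l x l′ → (:1 :+ e) :* (l :+ x :* l′) := (:1 :+ e) :* l :+ x :* l′ :+ x :* (e :* l′)) refl _ _ _ _ ⟩
    (1# + e) * L (suc (suc n)) + x * L′ (suc n) + x * (e * L′ (suc n))
      ≈⟨ +-cong (+-congʳ (ih (suc n))) (*-congˡ (newton-step x p L L′ h0 hs ih n)) ⟩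
    conv p L (suc n) + x * L′ (suc n) + x * conv p′ L′ n
      ≈⟨ +-congˡ (*-congˡ (conv-+ˡ p (λ k → x ^ suc k) L′ n)) ⟩
    conv p L (suc n) + x * L′ (suc n) + x * (conv p L′ n + conv (λ k → x ^ suc k) L′ n)
      ≈⟨ solve 5 (λ c x l d f → c :+ x :* l :+ x :* (d :+ f) := (c :+ x :* d) :+ (x :* :1 :* l :+ x :* f)) refl _ _ _ _ _ ⟩
    (conv p L (suc n) + x * conv p L′ n) + (x ^ 1 * L′ (suc n) + x * conv (λ k → x ^ suc k) L′ n)
      ≈⟨ +-cong (sym (conv-shiftʳ x p L L′ h0 hs n)) (+-congˡ (sym (conv-*ˡ x _ L′ n))) ⟩
    conv p L′ (suc n) + conv (λ k → x ^ suc k) L′ (suc n)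
      ≈⟨ conv-+ˡ p (λ k → x ^ suc k) L′ (suc n) ⟨
    conv p′ L′ (suc n) ∎
    where
    e  = embed (suc n)
    p′ = λ k → p k + x ^ suc k

-- Sums over boxes of exponent vectors, and logarithmic derivatives of products.

module BoxSums {c ℓ : Level} (K : CommutativeRing c ℓ) where
  open CommutativeRing K hiding (zero)
  open RingKit K
  open SetoidReasoning setoid

  -- For the weights `suc ∘ toℕ` this is `weight` by definition; for constant weight 1 it is the
  -- plain sum. One machinery thus serves the Bell index sets and the families.
  wt : ∀ {m} → (Fin m → ℕ) → Vec ℕ m → ℕ
  wt w v = Vec.sum (Vec.tabulate (λ i → w i ℕ.* lookup v i))

  opaque
    -- The product of the series `∑ⱼ F i j t^(w i j)`, each cut off at `j = b`, expanded and tested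
    -- against a function `Q` of two gradings: number of parts and weight. Because `Q` is arbitrary,
    -- an induction on `m` can absorb the first entry into it.
    boxSum : (m b : ℕ) → (ℕ → ℕ → Carrier) → (Fin m → ℕ → Carrier) → (Fin m → ℕ) → Carrier
    boxSum m b Q F w = ∑ (box m b) λ v → Q (Vec.sum v) (wt w v) * ∏ (allFin m) (λ i → F i (lookup v i))

    boxSum-def : ∀ m b Q F w → boxSum m b Q F w ≈ ∑ (box m b) (λ v → Q (Vec.sum v) (wt w v) * ∏ (allFin m) (λ i → F i (lookup v i)))
    boxSum-def m b Q F w = refl

    boxSum-[] : ∀ b Q F w → boxSum 0 b Q F w ≈ Q 0 0
    boxSum-[] b Q F w = trans (∑-singleton _ _) (trans (*-congˡ (∏-[] _)) (*-identityʳ _))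

    boxSum-suc : ∀ m b Q F w → boxSum (suc m) b Q F w ≈
      ∑ (upTo (suc b)) (λ j → F fzero j * boxSum m b (λ s x → Q (j ℕ.+ s) (w fzero ℕ.* j ℕ.+ x)) (F ∘ fsuc) (w ∘ fsuc))
    boxSum-suc m b Q F w = begin
      boxSum (suc m) b Q F w
        ≈⟨ ∑-cartesianProductWith _∷_ (upTo (suc b)) (box m b) _ ⟩
      ∑ (upTo (suc b)) (λ j → ∑ (box m b) λ v →
        Q (j ℕ.+ Vec.sum v) (w fzero ℕ.* j ℕ.+ wt (w ∘ fsuc) v) * ∏ (allFin (suc m)) (λ i → F i (lookup (j ∷ v) i)))
        ≈⟨ ∑-cong (upTo (suc b)) (λ j → trans (∑-cong (box m b) (λ v → trans (*-congˡ (∏-allFin-head m _))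
             (solve 3 (λ x y z → x :* (y :* z) := y :* (x :* z)) refl _ _ _))) (sym (*-distribˡ-∑ (box m b) _ _))) ⟩
      _ ∎

    boxSum-cong : ∀ {m b F w Q Q′} → (∀ s x → Q s x ≈ Q′ s x) → boxSum m b Q F w ≈ boxSum m b Q′ F w
    boxSum-cong {m} {b} Q≈Q′ = ∑-cong (box m b) (λ v → *-congʳ (Q≈Q′ _ _))

    boxSum-cong-∈ : ∀ {m b F w Q Q′} → (∀ v → Q (Vec.sum v) (wt w v) ≈ Q′ (Vec.sum v) (wt w v)) →
      boxSum m b Q F w ≈ boxSum m b Q′ F w
    boxSum-cong-∈ {m} {b} Q≈Q′ = ∑-cong (box m b) (λ v → *-congʳ (Q≈Q′ v))

    boxSum-zero : ∀ {m b F w Q} → (∀ s x → Q s x ≈ 0#) → boxSum m b Q F w ≈ 0#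
    boxSum-zero {m} {b} Q≈0 = ∑-zero (box m b) (λ v → trans (*-congʳ (Q≈0 _ _)) (zeroˡ _))

    boxSum-+ : ∀ {m b F w} Q Q′ → boxSum m b (λ s x → Q s x + Q′ s x) F w ≈ boxSum m b Q F w + boxSum m b Q′ F w
    boxSum-+ {m} {b} Q Q′ = trans (∑-cong (box m b) (λ v → distribʳ _ _ _)) (∑-distrib-+ (box m b) _ _)

    boxSum-* : ∀ {m b F w} → ∀ a Q → boxSum m b (λ s x → a * Q s x) F w ≈ a * boxSum m b Q F w
    boxSum-* {m} {b} a Q = trans (∑-cong (box m b) (λ v → *-assoc _ _ _)) (sym (*-distribˡ-∑ (box m b) _ _))

    boxSum-∑ : ∀ {m b F w} → ∀ {i} {I : Set i} (xs : List I) (Q : I → ℕ → ℕ → Carrier) →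
      boxSum m b (λ s x → ∑ xs (λ k → Q k s x)) F w ≈ ∑ xs (λ k → boxSum m b (Q k) F w)
    boxSum-∑ {m} {b} xs Q = trans (∑-cong (box m b) (λ v → *-distribʳ-∑ xs _ _)) (∑-comm (box m b) xs _)

  -- A single entry `suc b` already makes the sum exceed `b`, where `Q` vanishes.
  boxSum-bound-suc : ∀ m b Q F w → (∀ s x → b ℕ.< s → Q s x ≈ 0#) →
    boxSum m (suc b) Q F w ≈ boxSum m b Q F w
  boxSum-bound-suc zero    b Q F w Q≈0 = trans (boxSum-[] _ Q F w) (sym (boxSum-[] b Q F w))
  boxSum-bound-suc (suc m) b Q F w Q≈0 = begin
    boxSum (suc m) (suc b) Q F w
      ≈⟨ boxSum-suc m (suc b) Q F w ⟩
    ∑ (upTo (suc (suc b))) (λ j → F fzero j * boxSum m (suc b) (Q′ j) (F ∘ fsuc) (w ∘ fsuc))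
      ≈⟨ ∑-upTo-last (suc b) _ ⟩
    ∑ (upTo (suc b)) (λ j → F fzero j * boxSum m (suc b) (Q′ j) (F ∘ fsuc) (w ∘ fsuc))
      + F fzero (suc b) * boxSum m (suc b) (Q′ (suc b)) (F ∘ fsuc) (w ∘ fsuc)
      ≈⟨ +-cong
           (∑-cong (upTo (suc b)) (λ j → *-congˡ (boxSum-bound-suc m b (Q′ j) (F ∘ fsuc) (w ∘ fsuc)
              (λ s x b<s → Q≈0 _ _ (ℕₚ.≤-trans b<s (ℕₚ.m≤n+m s j))))))
           (trans (*-congˡ (boxSum-zero (λ s x → Q≈0 _ _ (ℕₚ.m≤m+n (suc b) s)))) (zeroʳ _)) ⟩
    ∑ (upTo (suc b)) (λ j → F fzero j * boxSum m b (Q′ j) (F ∘ fsuc) (w ∘ fsuc)) + 0#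
      ≈⟨ +-identityʳ _ ⟩
    ∑ (upTo (suc b)) (λ j → F fzero j * boxSum m b (Q′ j) (F ∘ fsuc) (w ∘ fsuc))
      ≈⟨ boxSum-suc m b Q F w ⟨
    boxSum (suc m) b Q F w ∎
    where
    Q′ : ℕ → ℕ → ℕ → Carrier
    Q′ j s x = Q (j ℕ.+ s) (w fzero ℕ.* j ℕ.+ x)

  boxSum-bound : ∀ d m b Q F w → (∀ s x → b ℕ.< s → Q s x ≈ 0#) →
    boxSum m (d ℕ.+ b) Q F w ≈ boxSum m b Q F w
  boxSum-bound zero    m b Q F w Q≈0 = refl
  boxSum-bound (suc d) m b Q F w Q≈0 = trans
    (boxSum-bound-suc m (d ℕ.+ b) Q F w (λ s x lt → Q≈0 s x (ℕₚ.≤-trans (s≤s (ℕₚ.m≤n+m b d)) lt)))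
    (boxSum-bound d m b Q F w Q≈0)

  -- If the last variable, of weight `o + m`, occurs together with `s` further entries of weight at
  -- least `o`, the total is at least `m + o (s + 1)`, where `Q` vanishes; if it does not occur, its
  -- factor is 1. The offset `o` grows by one whenever a variable is peeled off from the front.
  boxSum-vars-suc : ∀ o m b Q (e : ℕ → ℕ → Carrier) (w : ℕ → ℕ) → (∀ p → e p 0 ≈ 1#) →
    (∀ i → w i ≡ o ℕ.+ i) → (∀ s x → m ℕ.+ o ℕ.* suc s ℕ.≤ x → Q (suc s) x ≈ 0#) →
    boxSum (suc m) b Q (e ∘ toℕ) (w ∘ toℕ) ≈ boxSum m b Q (e ∘ toℕ) (w ∘ toℕ)
  boxSum-vars-suc o zero b Q e w e0 w≡ Q≈0 = begin
    boxSum 1 b Q (e ∘ toℕ) (w ∘ toℕ)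
      ≈⟨ boxSum-suc 0 b Q _ _ ⟩
    ∑ (upTo (suc b)) (λ j → e 0 j * boxSum 0 b (λ s x → Q (j ℕ.+ s) (w 0 ℕ.* j ℕ.+ x)) ((e ∘ toℕ) ∘ fsuc) ((w ∘ toℕ) ∘ fsuc))
      ≈⟨ ∑-cong (upTo (suc b)) (λ j → *-congˡ (boxSum-[] b _ _ _)) ⟩
    ∑ (upTo (suc b)) (λ j → e 0 j * Q (j ℕ.+ 0) (w 0 ℕ.* j ℕ.+ 0))
      ≈⟨ ∑-upTo-head b _ ⟩
    e 0 0 * Q 0 (w 0 ℕ.* 0 ℕ.+ 0) + ∑ (upTo b) (λ j → e 0 (suc j) * Q (suc j ℕ.+ 0) (w 0 ℕ.* suc j ℕ.+ 0))
      ≈⟨ +-cong (*-cong (e0 0) (reflexive (≡.cong (Q 0) (≡.trans (ℕₚ.+-identityʳ _) (ℕₚ.*-zeroʳ (w 0))))))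
           (∑-zero (upTo b) (λ j → trans (*-congˡ (Q≈0 _ _ (le j))) (zeroʳ _))) ⟩
    1# * Q 0 0 + 0#
      ≈⟨ trans (+-identityʳ _) (*-identityˡ _) ⟩
    Q 0 0
      ≈⟨ boxSum-[] b Q _ _ ⟨
    boxSum 0 b Q (e ∘ toℕ) (w ∘ toℕ) ∎
    where
    le : ∀ j → o ℕ.* suc (j ℕ.+ 0) ℕ.≤ w 0 ℕ.* suc j ℕ.+ 0
    le j = ℕₚ.≤-reflexive (≡.trans (≡.cong₂ (λ a b → a ℕ.* suc b) (≡.sym (≡.trans (w≡ 0) (ℕₚ.+-identityʳ o))) (ℕₚ.+-identityʳ j)) (≡.sym (ℕₚ.+-identityʳ _)))
  boxSum-vars-suc o (suc m) b Q e w e0 w≡ Q≈0 = begin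
    boxSum (suc (suc m)) b Q (e ∘ toℕ) (w ∘ toℕ)
      ≈⟨ boxSum-suc (suc m) b Q _ _ ⟩
    ∑ (upTo (suc b)) (λ j → e 0 j * boxSum (suc m) b (Q′ j) (e ∘ suc ∘ toℕ) (w ∘ suc ∘ toℕ))
      ≈⟨ ∑-cong (upTo (suc b)) (λ j → *-congˡ (boxSum-vars-suc (suc o) m b (Q′ j) (e ∘ suc) (w ∘ suc) (λ p → e0 (suc p))
           (λ i → ≡.trans (w≡ (suc i)) (ℕₚ.+-suc o i)) (vanish j))) ⟩
    ∑ (upTo (suc b)) (λ j → e 0 j * boxSum m b (Q′ j) (e ∘ suc ∘ toℕ) (w ∘ suc ∘ toℕ))
      ≈⟨ boxSum-suc m b Q _ _ ⟨
    boxSum (suc m) b Q (e ∘ toℕ) (w ∘ toℕ) ∎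
    where
    Q′ : ℕ → ℕ → ℕ → Carrier
    Q′ j s x = Q (j ℕ.+ s) (w 0 ℕ.* j ℕ.+ x)
    -- Each of the `s + 1` entries outside the first variable weighs at least one more than `o`: one
    -- of these units turns `m` into `suc m`, and `s` of them are left over.
    arith : ∀ m o j s → (suc m ℕ.+ o ℕ.* suc (j ℕ.+ s)) ℕ.+ s ≡ o ℕ.* j ℕ.+ (m ℕ.+ suc o ℕ.* suc s)
    arith = solve-∀
    vanish : ∀ j s x → m ℕ.+ suc o ℕ.* suc s ℕ.≤ x → Q (j ℕ.+ suc s) (w 0 ℕ.* j ℕ.+ x) ≈ 0#
    vanish j s x le rewrite ℕₚ.+-suc j s | ≡.trans (w≡ 0) (ℕₚ.+-identityʳ o) = Q≈0 (j ℕ.+ s) _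
      (ℕₚ.≤-trans (ℕₚ.m≤m+n _ s) (ℕₚ.≤-trans (ℕₚ.≤-reflexive (arith m o j s)) (ℕₚ.+-monoʳ-≤ (o ℕ.* j) le)))

  -- `B_{n,k}` has only `n - k + 1` variables, while the exponential series is expanded in `n` of
  -- them. This makes the two expansions comparable.
  boxSum-vars : ∀ d m b Q (e : ℕ → ℕ → Carrier) → (∀ p → e p 0 ≈ 1#) →
    (∀ s x → m ℕ.+ suc s ℕ.≤ x → Q (suc s) x ≈ 0#) →
    boxSum (d ℕ.+ m) b Q (e ∘ toℕ) (suc ∘ toℕ) ≈ boxSum m b Q (e ∘ toℕ) (suc ∘ toℕ)
  boxSum-vars zero    m b Q e e0 Q≈0 = refl
  boxSum-vars (suc d) m b Q e e0 Q≈0 = trans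
    (boxSum-vars-suc 1 (d ℕ.+ m) b Q e suc e0 (λ _ → ≡.refl) (λ s x le → Q≈0 s x
      (ℕₚ.≤-trans (ℕₚ.+-mono-≤ (ℕₚ.m≤n+m m d) (ℕₚ.≤-reflexive (≡.sym (ℕₚ.*-identityˡ (suc s))))) le)))
    (boxSum-vars d m b Q e e0 Q≈0)

  -- A list of pairs (l , a) stands for the series ∑ a tˡ, which is required to be the logarithmic
  -- derivative t F′/F of the series F(t) = ∑ⱼ Fⱼ t^(w j), tested against sequences vanishing beyond b.
  HasLogDerivative : ℕ → (ℕ → Carrier) → ℕ → List (ℕ × Carrier) → Set (c Level.⊔ ℓ)
  HasLogDerivative b F w A = ∀ (H : ℕ → Carrier) → (∀ x → b ℕ.< x → H x ≈ 0#) →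
    ∑ (upTo (suc b)) (λ j → F j * (embed (w ℕ.* j) * H (w ℕ.* j))) ≈
    ∑ A (λ la → proj₂ la * ∑ (upTo (suc b)) (λ j → F j * H (w ℕ.* j ℕ.+ proj₁ la)))

  -- The logarithmic derivative of a product is the sum of those of its factors. The factor
  -- `embed x` stands for the operator `t d/dt`; it splits into the share of the first series,
  -- handled by `hyp`, and that of the others, handled by induction with `Q` translated.
  boxSum-logDerivative : ∀ m b (F : Fin m → ℕ → Carrier) (w : Fin m → ℕ) (A : Fin m → List (ℕ × Carrier)) →
    (∀ i → HasLogDerivative b (F i) (w i) (A i)) → ∀ (Q : ℕ → Carrier) → (∀ x → b ℕ.< x → Q x ≈ 0#) →
    boxSum m b (λ _ x → embed x * Q x) F w ≈
    ∑ (allFin m) (λ i → ∑ (A i) (λ la → proj₂ la * boxSum m b (λ _ x → Q (x ℕ.+ proj₁ la)) F w))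
  boxSum-logDerivative zero    b F w A hyp Q Q≈0 =
    trans (boxSum-[] b _ F w) (trans (zeroˡ _) (sym (∑-[] _)))
  boxSum-logDerivative (suc m) b F w A hyp Q Q≈0 = begin
    boxSum (suc m) b (λ _ x → embed x * Q x) F w
      ≈⟨ boxSum-suc m b _ F w ⟩
    ∑ U (λ j → F fzero j * boxSum m b (λ _ x → embed (w₀ ℕ.* j ℕ.+ x) * Q (w₀ ℕ.* j ℕ.+ x)) F′ w′)
      ≈⟨ ∑-cong U (λ j → *-congˡ (split j)) ⟩
    ∑ U (λ j → F fzero j * (embed (w₀ ℕ.* j) * H (w₀ ℕ.* j) + R j))
      ≈⟨ trans (∑-cong U (λ j → distribˡ _ _ _)) (∑-distrib-+ U _ _) ⟩
    ∑ U (λ j → F fzero j * (embed (w₀ ℕ.* j) * H (w₀ ℕ.* j))) + ∑ U (λ j → F fzero j * R j)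
      ≈⟨ +-cong (hyp fzero H (λ x b<x → boxSum-zero (λ _ y → Q≈0 _ (ℕₚ.≤-trans b<x (ℕₚ.m≤m+n x y))))) second ⟩
    ∑ (A fzero) (λ la → proj₂ la * ∑ U (λ j → F fzero j * H (w₀ ℕ.* j ℕ.+ proj₁ la)))
      + ∑ (allFin m) (λ i → ∑ (A (fsuc i)) (λ la → proj₂ la * G (proj₁ la)))
      ≈⟨ +-congʳ (∑-cong (A fzero) (λ la → *-congˡ (first (proj₁ la)))) ⟩
    ∑ (A fzero) (λ la → proj₂ la * G (proj₁ la))
      + ∑ (allFin m) (λ i → ∑ (A (fsuc i)) (λ la → proj₂ la * G (proj₁ la)))
      ≈⟨ ∑-allFin-head m _ ⟨
    ∑ (allFin (suc m)) (λ i → ∑ (A i) (λ la → proj₂ la * G (proj₁ la))) ∎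
    where
    U  = upTo (suc b)
    F′ = F ∘ fsuc
    w′ = w ∘ fsuc
    w₀ = w fzero
    G : ℕ → Carrier
    G l = boxSum (suc m) b (λ _ x → Q (x ℕ.+ l)) F w
    -- The remaining factors together, serving as a test sequence for the first one.
    H : ℕ → Carrier
    H y = boxSum m b (λ _ x → Q (y ℕ.+ x)) F′ w′
    R : ℕ → Carrier
    R j = ∑ (allFin m) (λ i → ∑ (A (fsuc i)) (λ la → proj₂ la * boxSum m b (λ _ x → Q (w₀ ℕ.* j ℕ.+ (x ℕ.+ proj₁ la))) F′ w′))

    split : ∀ j → boxSum m b (λ _ x → embed (w₀ ℕ.* j ℕ.+ x) * Q (w₀ ℕ.* j ℕ.+ x)) F′ w′ ≈ embed (w₀ ℕ.* j) * H (w₀ ℕ.* j) + R j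
    split j = begin
      boxSum m b (λ _ x → embed (w₀ ℕ.* j ℕ.+ x) * Q (w₀ ℕ.* j ℕ.+ x)) F′ w′
        ≈⟨ boxSum-cong (λ _ x → trans (*-congʳ (embed-+ (w₀ ℕ.* j) x)) (distribʳ _ _ _)) ⟩
      boxSum m b (λ _ x → embed (w₀ ℕ.* j) * Q (w₀ ℕ.* j ℕ.+ x) + embed x * Q (w₀ ℕ.* j ℕ.+ x)) F′ w′
        ≈⟨ boxSum-+ _ _ ⟩
      boxSum m b (λ _ x → embed (w₀ ℕ.* j) * Q (w₀ ℕ.* j ℕ.+ x)) F′ w′ + boxSum m b (λ _ x → embed x * Q (w₀ ℕ.* j ℕ.+ x)) F′ w′
        ≈⟨ +-cong (boxSum-* _ _) (boxSum-logDerivative m b F′ w′ (λ i → A (fsuc i)) (λ i → hyp (fsuc i)) (λ x → Q (w₀ ℕ.* j ℕ.+ x))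
             (λ x b<x → Q≈0 _ (ℕₚ.≤-trans b<x (ℕₚ.m≤n+m x _)))) ⟩
      embed (w₀ ℕ.* j) * H (w₀ ℕ.* j) + R j ∎

    first : ∀ l → ∑ U (λ j → F fzero j * H (w₀ ℕ.* j ℕ.+ l)) ≈ G l
    first l = sym (trans (boxSum-suc m b _ F w) (∑-cong U (λ j → *-congˡ (boxSum-cong (λ _ x →
      reflexive (≡.cong Q (swap (w₀ ℕ.* j) x l)))))))
      where
      swap : ∀ a x l → a ℕ.+ x ℕ.+ l ≡ a ℕ.+ l ℕ.+ x
      swap = solve-∀

    second : ∑ U (λ j → F fzero j * R j) ≈ ∑ (allFin m) (λ i → ∑ (A (fsuc i)) (λ la → proj₂ la * G (proj₁ la)))
    second = begin
      ∑ U (λ j → F fzero j * R j)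
        ≈⟨ ∑-cong U (λ j → trans (*-distribˡ-∑ (allFin m) _ _) (∑-cong (allFin m) (λ i → *-distribˡ-∑ (A (fsuc i)) _ _))) ⟩
      ∑ U (λ j → ∑ (allFin m) (λ i → ∑ (A (fsuc i)) (λ la → F fzero j * (proj₂ la * B j (proj₁ la)))))
        ≈⟨ trans (∑-comm U (allFin m) _) (∑-cong (allFin m) (λ i → ∑-comm U (A (fsuc i)) _)) ⟩
      ∑ (allFin m) (λ i → ∑ (A (fsuc i)) (λ la → ∑ U (λ j → F fzero j * (proj₂ la * B j (proj₁ la)))))
        ≈⟨ ∑-cong (allFin m) (λ i → ∑-cong (A (fsuc i)) (λ la → collect (proj₂ la) (proj₁ la))) ⟩
      ∑ (allFin m) (λ i → ∑ (A (fsuc i)) (λ la → proj₂ la * G (proj₁ la))) ∎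
      where
      B : ℕ → ℕ → Carrier
      B j l = boxSum m b (λ _ x → Q (w₀ ℕ.* j ℕ.+ (x ℕ.+ l))) F′ w′
      collect : ∀ a l → ∑ U (λ j → F fzero j * (a * B j l)) ≈ a * G l
      collect a l = begin
        ∑ U (λ j → F fzero j * (a * B j l))
          ≈⟨ ∑-cong U (λ j → solve 3 (λ x y z → x :* (y :* z) := y :* (x :* z)) refl _ _ _) ⟩
        ∑ U (λ j → a * (F fzero j * B j l))
          ≈⟨ *-distribˡ-∑ U a _ ⟨
        a * ∑ U (λ j → F fzero j * B j l)
          ≈⟨ *-congˡ (∑-cong U (λ j → *-congˡ (boxSum-cong (λ _ x → reflexive (≡.cong Q (≡.sym (ℕₚ.+-assoc (w₀ ℕ.* j) x l))))))) ⟩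
        a * ∑ U (λ j → F fzero j * boxSum m b (λ _ x → Q (w₀ ℕ.* j ℕ.+ x ℕ.+ l)) F′ w′)
          ≈⟨ *-congˡ (boxSum-suc m b _ F w) ⟨
        a * G l ∎

-- Exponential series with Bell polynomials as coefficients, and products of series.

module BoxSeries {c ℓ : Level} (K : CommutativeRing c ℓ) where
  open CommutativeRing K hiding (zero)
  open RingKit K
  open BoxSums K
  open SetoidReasoning setoid

  wt-const1 : ∀ {m} (v : Vec ℕ m) → wt (λ _ → 1) v ≡ Vec.sum v
  wt-const1 []      = ≡.refl
  wt-const1 (j ∷ v) = ≡.cong₂ ℕ._+_ (ℕₚ.+-identityʳ j) (wt-const1 v)

  sum≤wt : ∀ {m} (w : Fin m → ℕ) (v : Vec ℕ m) → Vec.sum v ℕ.≤ wt (suc ∘ w) v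
  sum≤wt w []      = z≤n
  sum≤wt w (j ∷ v) = ℕₚ.+-mono-≤ (ℕₚ.m≤m+n j _) (sum≤wt (w ∘ fsuc) v)

  sum≡0⇒wt≡0 : ∀ {m} (w : Fin m → ℕ) (v : Vec ℕ m) → Vec.sum v ≡ 0 → wt w v ≡ 0
  sum≡0⇒wt≡0 w []      _  = ≡.refl
  sum≡0⇒wt≡0 w (j ∷ v) eq rewrite ℕₚ.m+n≡0⇒m≡0 j eq =
    ≡.cong₂ ℕ._+_ (ℕₚ.*-zeroʳ (w fzero)) (sum≡0⇒wt≡0 (w ∘ fsuc) v (ℕₚ.m+n≡0⇒n≡0 j eq))

  opaque
    [_≐_] : ℕ → ℕ → Carrier
    [ x ≐ n ] = iverson (x ℕₚ.≟ n)

    ≐-def : ∀ x n → iverson (x ℕₚ.≟ n) ≈ [ x ≐ n ]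
    ≐-def x n = refl

    ≐-refl : ∀ n → [ n ≐ n ] ≈ 1#
    ≐-refl n = iverson-yes (n ℕₚ.≟ n) ≡.refl

    ≐-≢ : ∀ {x n} → ¬ x ≡ n → [ x ≐ n ] ≈ 0#
    ≐-≢ {x} {n} = iverson-no (x ℕₚ.≟ n)

  ≐-subst : ∀ x n (f : ℕ → Carrier) → f x * [ x ≐ n ] ≈ f n * [ x ≐ n ]
  ≐-subst x n f with x ℕₚ.≟ n
  ... | yes ≡.refl = refl
  ... | no  x≢n    = trans (trans (*-congˡ (≐-≢ x≢n)) (zeroʳ _)) (sym (trans (*-congˡ (≐-≢ x≢n)) (zeroʳ _)))

  ≐-shift : ∀ x l n → l ℕ.≤ n → [ x ℕ.+ suc l ≐ suc n ] ≈ [ x ≐ n ℕ.∸ l ]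
  ≐-shift x l n l≤n with x ℕₚ.≟ n ℕ.∸ l
  ... | yes ≡.refl = begin
    [ n ℕ.∸ l ℕ.+ suc l ≐ suc n ]  ≡⟨ ≡.cong [_≐ suc n ] (≡.trans (ℕₚ.+-suc _ l) (≡.cong suc (ℕₚ.m∸n+n≡m l≤n))) ⟩
    [ suc n ≐ suc n ]              ≈⟨ ≐-refl (suc n) ⟩
    1#                             ≈⟨ ≐-refl (n ℕ.∸ l) ⟨
    [ n ℕ.∸ l ≐ n ℕ.∸ l ]          ∎
  ... | no  x≢     = trans (≐-≢ (λ eq → x≢ (≡.trans (≡.sym (ℕₚ.m+n∸n≡m x l))
                       (≡.cong (ℕ._∸ l) (ℕₚ.suc-injective (≡.trans (≡.sym (ℕₚ.+-suc x l)) eq)))))) (sym (≐-≢ x≢))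

  ∑-≐ : ∀ n s → s ℕ.< n → ∑ (upTo n) (λ k → [ s ≐ k ]) ≈ 1#
  ∑-≐ (suc n) s s<n with s ℕₚ.≟ n
  ... | yes ≡.refl = begin
    ∑ (upTo (suc n)) (λ k → [ n ≐ k ])        ≈⟨ ∑-upTo-last n _ ⟩
    ∑ (upTo n) (λ k → [ n ≐ k ]) + [ n ≐ n ]  ≈⟨ +-cong (trans (∑-upTo-cong n (λ k k<n → ≐-≢ (λ eq → ℕₚ.<-irrefl (≡.sym eq) k<n)))
                                                    (∑-zero (upTo n) (λ _ → refl))) (≐-refl n) ⟩
    0# + 1#                                   ≈⟨ +-identityˡ 1# ⟩
    1#                                        ∎
  ... | no s≢n = begin
    ∑ (upTo (suc n)) (λ k → [ s ≐ k ])        ≈⟨ ∑-upTo-last n _ ⟩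
    ∑ (upTo n) (λ k → [ s ≐ k ]) + [ s ≐ n ]  ≈⟨ +-cong (∑-≐ n s (ℕₚ.≤∧≢⇒< (ℕₚ.≤-pred s<n) s≢n)) (≐-≢ s≢n) ⟩
    1# + 0#                                   ≈⟨ +-identityʳ 1# ⟩
    1#                                        ∎

  ∑-filter-box : ∀ {m b} {p} {P : Vec ℕ m → Set p} (P? : ∀ v → Dec (P v)) (Q : ℕ → ℕ → Carrier) (w : Fin m → ℕ)
    (F : Fin m → ℕ → Carrier) → (∀ v → iverson (P? v) ≈ Q (Vec.sum v) (wt w v)) →
    ∑ (filter P? (box m b)) (λ v → ∏ (allFin m) (λ i → F i (lookup v i))) ≈ boxSum m b Q F w
  ∑-filter-box {m} {b} P? Q w F hyp = begin
    ∑ (filter P? (box m b)) (λ v → ∏ (allFin m) (λ i → F i (lookup v i)))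
      ≈⟨ ∑-filter P? (box m b) _ ⟩
    ∑ (box m b) (λ v → iverson (P? v) * ∏ (allFin m) (λ i → F i (lookup v i)))
      ≈⟨ ∑-cong (box m b) (λ v → *-congʳ (hyp v)) ⟩
    ∑ (box m b) (λ v → Q (Vec.sum v) (wt w v) * ∏ (allFin m) (λ i → F i (lookup v i)))
      ≈⟨ boxSum-def m b Q F w ⟨
    boxSum m b Q F w ∎

  -- `e p` lists the coefficients of `exp (u p s)`, characterised without division by their
  -- recursion. With `s = t^(p + 1)`, the product over `p` is `exp (∑ₚ u p t^(p + 1))`, whose
  -- coefficients are the `Y n`; only the first `n` variables, with exponents up to `n`, can reach
  -- weight `n`.
  module Exponential (u : ℕ → Carrier) (e : ℕ → ℕ → Carrier) (e0 : ∀ p → e p 0 ≈ 1#)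
    (e-suc : ∀ p j → embed (suc j) * e p (suc j) ≈ u p * e p j) where

    weighted : ℕ → ℕ → (ℕ → ℕ → Carrier) → Carrier
    weighted m b Q = boxSum m b Q (e ∘ toℕ) (suc ∘ toℕ)

    Y : ℕ → Carrier
    Y n = weighted n n (λ _ x → [ x ≐ n ])

    Y-0 : Y 0 ≈ 1#
    Y-0 = trans (boxSum-[] 0 _ _ _) (≐-refl 0)

    weighted-stable : ∀ d n → weighted (d ℕ.+ n) (d ℕ.+ n) (λ _ x → [ x ≐ n ]) ≈ Y n
    weighted-stable d n = begin
      weighted (d ℕ.+ n) (d ℕ.+ n) (λ _ x → [ x ≐ n ])  ≈⟨ truncate (d ℕ.+ n) (d ℕ.+ n) ⟩
      weighted (d ℕ.+ n) (d ℕ.+ n) R                    ≈⟨ boxSum-bound d (d ℕ.+ n) n R _ _ (λ s x n<s →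
                                                             trans (*-congʳ (iverson-no (s ℕₚ.≤? n) (ℕₚ.<⇒≱ n<s))) (zeroˡ _)) ⟩
      weighted (d ℕ.+ n) n R                            ≈⟨ boxSum-vars d n n R e e0 (λ s x le →
                                                             trans (*-congˡ (≐-≢ {x} {n} (λ { ≡.refl → ℕₚ.m+1+n≰m n le }))) (zeroʳ _)) ⟩
      weighted n n R                                    ≈⟨ truncate n n ⟨
      Y n                                               ∎
      where
      -- The bound `s ≤ n` holds at every vector of weight `n`, but the truncation lemmas quantify
      -- over number and weight separately, so it is written into the test function.
      R : ℕ → ℕ → Carrier
      R s x = iverson (s ℕₚ.≤? n) * [ x ≐ n ]
      pointwise : ∀ s x → s ℕ.≤ x → [ x ≐ n ] ≈ R s x
      pointwise s x s≤x with x ℕₚ.≟ n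
      ... | yes ≡.refl = sym (trans (*-congʳ (iverson-yes (s ℕₚ.≤? n) s≤x)) (*-identityˡ _))
      ... | no  x≢n    = trans (≐-≢ x≢n) (sym (trans (*-congˡ (≐-≢ x≢n)) (zeroʳ _)))
      truncate : ∀ m b → weighted m b (λ _ x → [ x ≐ n ]) ≈ weighted m b R
      truncate m b = boxSum-cong-∈ (λ v → pointwise _ _ (sum≤wt toℕ v))

    factor-logDerivative : ∀ b p → HasLogDerivative b (e p) (suc p) ((suc p , embed (suc p) * u p) ∷ [])
    factor-logDerivative b p H H≈0 = begin
      ∑ (upTo (suc b)) (λ j → e p j * (embed (suc p ℕ.* j) * H (suc p ℕ.* j)))
        ≈⟨ ∑-upTo-head b _ ⟩
      e p 0 * (embed (suc p ℕ.* 0) * H (suc p ℕ.* 0)) + ∑ (upTo b) (λ j → e p (suc j) * (embed (suc p ℕ.* suc j) * H (suc p ℕ.* suc j)))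
        ≈⟨ +-cong (trans (*-congˡ (trans (*-congʳ (reflexive (≡.cong embed (ℕₚ.*-zeroʳ (suc p))))) (zeroˡ _))) (zeroʳ _))
             (∑-cong (upTo b) step) ⟩
      0# + ∑ (upTo b) (λ j → a * (e p j * H (suc p ℕ.* j ℕ.+ suc p)))
        ≈⟨ trans (+-identityˡ _) (sym (*-distribˡ-∑ (upTo b) a _)) ⟩
      a * ∑ (upTo b) (λ j → e p j * H (suc p ℕ.* j ℕ.+ suc p))
        -- After the shift of `j` the sum stops before `b`. The missing summand is restored at no
        -- cost, since `H` is evaluated beyond `b` there.
        ≈⟨ *-congˡ (trans (sym (+-identityʳ _)) (+-congˡ (sym (trans (*-congˡ (H≈0 _ beyond)) (zeroʳ _))))) ⟩
      a * (∑ (upTo b) (λ j → e p j * H (suc p ℕ.* j ℕ.+ suc p)) + e p b * H (suc p ℕ.* b ℕ.+ suc p))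
        ≈⟨ *-congˡ (∑-upTo-last b _) ⟨
      a * ∑ (upTo (suc b)) (λ j → e p j * H (suc p ℕ.* j ℕ.+ suc p))
        ≈⟨ ∑-singleton _ _ ⟨
      ∑ ((suc p , a) ∷ []) (λ la → proj₂ la * ∑ (upTo (suc b)) (λ j → e p j * H (suc p ℕ.* j ℕ.+ proj₁ la))) ∎
      where
      a = embed (suc p) * u p
      beyond : b ℕ.< suc p ℕ.* b ℕ.+ suc p
      beyond = ℕₚ.≤-trans (s≤s (ℕₚ.m≤m+n b (p ℕ.* b))) (ℕₚ.≤-trans (ℕₚ.≤-reflexive (≡.sym (ℕₚ.+-comm _ 1))) (ℕₚ.+-monoʳ-≤ _ (s≤s z≤n)))
      step : ∀ j → e p (suc j) * (embed (suc p ℕ.* suc j) * H (suc p ℕ.* suc j)) ≈ a * (e p j * H (suc p ℕ.* j ℕ.+ suc p))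
      step j = begin
        e p (suc j) * (embed (suc p ℕ.* suc j) * H (suc p ℕ.* suc j))
          ≈⟨ *-congˡ (*-cong (embed-* (suc p) (suc j)) (reflexive (≡.cong H (≡.trans (ℕₚ.*-suc (suc p) j) (ℕₚ.+-comm (suc p) _))))) ⟩
        e p (suc j) * (embed (suc p) * embed (suc j) * h)
          ≈⟨ solve 4 (λ x y z w → x :* (y :* z :* w) := y :* (z :* x) :* w) refl _ _ _ _ ⟩
        embed (suc p) * (embed (suc j) * e p (suc j)) * h
          ≈⟨ *-congʳ (*-congˡ (e-suc p j)) ⟩
        embed (suc p) * (u p * e p j) * h
          ≈⟨ solve 4 (λ x y z w → x :* (y :* z) :* w := x :* y :* (z :* w)) refl _ _ _ _ ⟩
        a * (e p j * h) ∎
        where h = H (suc p ℕ.* j ℕ.+ suc p)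

    -- Coefficients of `t Y′ = Y ∑ₗ (l + 1) u l t^(l + 1)`. On the support of `[ x ≐ N ]` the
    -- constant `N` may be replaced by the weight `x`, which is the form that logarithmic
    -- derivatives act on.
    Y-suc : ∀ n → embed (suc n) * Y (suc n) ≈ conv (λ l → embed (suc l) * u l) Y n
    Y-suc n = begin
      embed N * Y N
        ≈⟨ boxSum-* (embed N) (λ _ x → [ x ≐ N ]) ⟨
      weighted N N (λ _ x → embed N * [ x ≐ N ])
        ≈⟨ boxSum-cong (λ _ x → sym (≐-subst x N embed)) ⟩
      weighted N N (λ _ x → embed x * [ x ≐ N ])
        ≈⟨ boxSum-logDerivative N N _ _ (λ i → (suc (toℕ i) , a (toℕ i)) ∷ []) (λ i → factor-logDerivative N (toℕ i))
             (λ x → [ x ≐ N ]) (λ x N<x → ≐-≢ (λ { ≡.refl → ℕₚ.<-irrefl ≡.refl N<x })) ⟩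
      ∑ (allFin N) (λ i → ∑ ((suc (toℕ i) , a (toℕ i)) ∷ []) (λ la → proj₂ la * weighted N N (λ _ x → [ x ℕ.+ proj₁ la ≐ N ])))
        ≈⟨ ∑-cong (allFin N) (λ i → ∑-singleton _ _) ⟩
      ∑ (allFin N) (λ i → a (toℕ i) * weighted N N (λ _ x → [ x ℕ.+ suc (toℕ i) ≐ N ]))
        ≈⟨ ∑-allFin-toℕ N (λ l → a l * weighted N N (λ _ x → [ x ℕ.+ suc l ≐ N ])) ⟩
      ∑ (upTo N) (λ l → a l * weighted N N (λ _ x → [ x ℕ.+ suc l ≐ N ]))
        ≈⟨ ∑-upTo-cong N (λ l l<N → *-congˡ (shift l (ℕₚ.≤-pred l<N))) ⟩
      ∑ (upTo N) (λ l → a l * Y (n ℕ.∸ l))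
        ≈⟨ conv-∑ a Y n ⟨
      conv a Y n ∎
      where
      N = suc n
      a : ℕ → Carrier
      a l = embed (suc l) * u l
      shift : ∀ l → l ℕ.≤ n → weighted N N (λ _ x → [ x ℕ.+ suc l ≐ N ]) ≈ Y (n ℕ.∸ l)
      shift l l≤n = begin
        weighted N N (λ _ x → [ x ℕ.+ suc l ≐ N ])  ≈⟨ boxSum-cong (λ _ x → ≐-shift x l n l≤n) ⟩
        weighted N N (λ _ x → [ x ≐ n ℕ.∸ l ])      ≡⟨ ≡.cong (λ k → weighted k k (λ _ x → [ x ≐ n ℕ.∸ l ])) (≡.sym (≡.cong suc (ℕₚ.m+[n∸m]≡n l≤n))) ⟩
        weighted (suc l ℕ.+ (n ℕ.∸ l)) (suc l ℕ.+ (n ℕ.∸ l)) (λ _ x → [ x ≐ n ℕ.∸ l ]) ≈⟨ weighted-stable (suc l) (n ℕ.∸ l) ⟩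
        Y (n ℕ.∸ l)                                 ∎

    -- For `e p j = (x p / (p + 1)!)^j / j!` this is `B_{n,k} / n!`.
    bellTerm : ℕ → ℕ → Carrier
    bellTerm n k = ∑ (bellIndices n k) (λ js → ∏ (allFin (suc (n ℕ.∸ k))) (λ i → e (toℕ i) (lookup js i)))

    -- The index set of `B_{n,k+1}` allows entries up to `k + 1` in `n - k` variables; both limits
    -- may be raised to `n`, because an entry in a later variable, with `k` further ones, would
    -- already weigh more than `n`.
    bellTerm-weighted : ∀ n k → k ℕ.< n → bellTerm n (suc k) ≈ weighted n n (λ s x → [ s ≐ suc k ] * [ x ≐ n ])
    bellTerm-weighted n k k<n = begin
      bellTerm n (suc k)
        ≈⟨ ∑-filter-box _ Q (suc ∘ toℕ) (e ∘ toℕ) (λ v → trans (×-dec-≈ (Vec.sum v ℕₚ.≟ suc k) (weight v ℕₚ.≟ n)) (*-cong (≐-def _ _) (≐-def _ _))) ⟩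
      weighted M (suc k) Q
        ≈⟨ boxSum-bound (n ℕ.∸ suc k) M (suc k) Q _ _ (λ s x k<s → trans (*-congʳ (≐-≢ (λ { ≡.refl → ℕₚ.<-irrefl ≡.refl k<s }))) (zeroˡ _)) ⟨
      weighted M (n ℕ.∸ suc k ℕ.+ suc k) Q
        ≡⟨ ≡.cong (λ b → weighted M b Q) (ℕₚ.m∸n+n≡m k<n) ⟩
      weighted M n Q
        ≈⟨ boxSum-vars k M n Q e e0 vanish ⟨
      weighted (k ℕ.+ M) n Q
        ≡⟨ ≡.cong (λ m → weighted m n Q) (≡.trans (ℕₚ.+-suc k _) (ℕₚ.m+[n∸m]≡n k<n)) ⟩
      weighted n n Q ∎
      where
      M = suc (n ℕ.∸ suc k)
      Q : ℕ → ℕ → Carrier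
      Q s x = [ s ≐ suc k ] * [ x ≐ n ]
      ×-dec-≈ : ∀ {A B : Set} (A? : Dec A) (B? : Dec B) → iverson (A? ×-dec B?) ≈ iverson A? * iverson B?
      ×-dec-≈ (yes _) (yes _) = sym (*-identityʳ _)
      ×-dec-≈ (yes _) (no _)  = sym (zeroʳ _)
      ×-dec-≈ (no _)  _       = sym (zeroˡ _)
      vanish : ∀ s x → M ℕ.+ suc s ℕ.≤ x → Q (suc s) x ≈ 0#
      vanish s x le with s ℕₚ.≟ k
      ... | no  s≢k    = trans (*-congʳ (≐-≢ (λ eq → s≢k (ℕₚ.suc-injective eq)))) (zeroˡ _)
      ... | yes ≡.refl = trans (*-congˡ (≐-≢ (λ { ≡.refl → ℕₚ.<-irrefl ≡.refl
                           (ℕₚ.≤-trans (s≤s (ℕₚ.≤-reflexive (≡.sym (ℕₚ.m∸n+n≡m k<n)))) le) }))) (zeroʳ _)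

    -- The vectors of weight `n + 1` are sorted by their number of parts. That number is at most the
    -- weight, and it is positive because a vector with sum 0 has weight 0.
    ∑-bellTerm : ∀ n → ∑ (List.map suc (upTo (suc n))) (bellTerm (suc n)) ≈ Y (suc n)
    ∑-bellTerm n = begin
      ∑ (List.map suc (upTo N)) (bellTerm N)
        ≈⟨ ∑-map suc (upTo N) _ ⟩
      ∑ (upTo N) (λ k → bellTerm N (suc k))
        ≈⟨ ∑-upTo-cong N (bellTerm-weighted N) ⟩
      ∑ (upTo N) (λ k → weighted N N (λ s x → [ s ≐ suc k ] * [ x ≐ N ]))
        ≈⟨ boxSum-∑ (upTo N) (λ k s x → [ s ≐ suc k ] * [ x ≐ N ]) ⟨
      weighted N N (λ s x → ∑ (upTo N) (λ k → [ s ≐ suc k ] * [ x ≐ N ]))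
        ≈⟨ boxSum-cong-∈ (λ v → trans (sym (*-distribʳ-∑ (upTo N) _ _))
             (pointwise (Vec.sum v) (wt (suc ∘ toℕ) v) (sum≤wt toℕ v) (sum≡0⇒wt≡0 (suc ∘ toℕ) v))) ⟩
      Y N ∎
      where
      N = suc n
      pointwise : ∀ s x → s ℕ.≤ x → (s ≡ 0 → x ≡ 0) → ∑ (upTo N) (λ k → [ s ≐ suc k ]) * [ x ≐ N ] ≈ [ x ≐ N ]
      pointwise s x s≤x 0→0 with x ℕₚ.≟ N
      pointwise s       x s≤x 0→0 | no  x≢N    = trans (*-congˡ (≐-≢ x≢N)) (trans (zeroʳ _) (sym (≐-≢ x≢N)))
      pointwise zero    x s≤x 0→0 | yes ≡.refl with () ← 0→0 ≡.refl
      pointwise (suc s) x s≤x 0→0 | yes ≡.refl =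
        trans (*-congʳ (trans (∑-cong (upTo N) (suc-≐ s)) (∑-≐ N s s≤x))) (*-identityˡ _)
        where
        suc-≐ : ∀ s k → [ suc s ≐ suc k ] ≈ [ s ≐ k ]
        suc-≐ s k with s ℕₚ.≟ k
        ... | yes ≡.refl = trans (≐-refl (suc s)) (sym (≐-refl s))
        ... | no  s≢k    = trans (≐-≢ (λ eq → s≢k (ℕₚ.suc-injective eq))) (sym (≐-≢ s≢k))

  -- All weights are 1 here. A factor is known only through its recursion, that is, through its
  -- logarithmic derivative `∑ₗ a i l t^(l + 1)`.
  module Product {m : ℕ} (F a : Fin m → ℕ → Carrier) (F0 : ∀ i → F i 0 ≈ 1#)
    (F-suc : ∀ i k → embed (suc k) * F i (suc k) ≈ conv (a i) (F i) k) where

    G : ℕ → Carrier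
    G n = ∑ (families m n) (λ κ → ∏ (allFin m) (λ i → F i (lookup κ i)))

    unweighted : ℕ → (ℕ → ℕ → Carrier) → Carrier
    unweighted b Q = boxSum m b Q F (λ _ → 1)

    G-unweighted : ∀ n → G n ≈ unweighted n (λ s _ → [ s ≐ n ])
    G-unweighted n = ∑-filter-box _ _ _ F (λ v → ≐-def _ _)

    unweighted-swap : ∀ b n → unweighted b (λ s _ → [ s ≐ n ]) ≈ unweighted b (λ _ x → [ x ≐ n ])
    unweighted-swap b n = boxSum-cong-∈ (λ v → reflexive (≡.cong [_≐ n ] (≡.sym (wt-const1 v))))

    G-stable : ∀ d n → unweighted (d ℕ.+ n) (λ _ x → [ x ≐ n ]) ≈ G n
    G-stable d n = begin
      unweighted (d ℕ.+ n) (λ _ x → [ x ≐ n ])  ≈⟨ unweighted-swap (d ℕ.+ n) n ⟨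
      unweighted (d ℕ.+ n) (λ s _ → [ s ≐ n ])  ≈⟨ boxSum-bound d m n _ F _ (λ s x n<s → ≐-≢ (λ { ≡.refl → ℕₚ.<-irrefl ≡.refl n<s })) ⟩
      unweighted n (λ s _ → [ s ≐ n ])          ≈⟨ G-unweighted n ⟨
      G n                                       ∎

    boxSum-0 : ∀ m′ (F′ : Fin m′ → ℕ → Carrier) w Q → (∀ i → F′ i 0 ≈ 1#) → boxSum m′ 0 Q F′ w ≈ Q 0 0
    boxSum-0 zero     F′ w Q F′0 = boxSum-[] 0 Q F′ w
    boxSum-0 (suc m′) F′ w Q F′0 = begin
      boxSum (suc m′) 0 Q F′ w
        ≈⟨ boxSum-suc m′ 0 Q F′ w ⟩
      ∑ (upTo 1) (λ j → F′ fzero j * boxSum m′ 0 (λ s x → Q (j ℕ.+ s) (w fzero ℕ.* j ℕ.+ x)) (F′ ∘ fsuc) (w ∘ fsuc))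
        ≈⟨ trans (∑-upTo-last 0 _) (trans (+-congʳ (∑-[] _)) (+-identityˡ _)) ⟩
      F′ fzero 0 * boxSum m′ 0 (λ s x → Q s (w fzero ℕ.* 0 ℕ.+ x)) (F′ ∘ fsuc) (w ∘ fsuc)
        ≈⟨ trans (*-cong (F′0 fzero) (boxSum-0 m′ (F′ ∘ fsuc) (w ∘ fsuc) _ (λ i → F′0 (fsuc i)))) (*-identityˡ _) ⟩
      Q 0 (w fzero ℕ.* 0 ℕ.+ 0)
        ≡⟨ ≡.cong (Q 0) (≡.trans (ℕₚ.+-identityʳ _) (ℕₚ.*-zeroʳ (w fzero))) ⟩
      Q 0 0 ∎

    G-0 : G 0 ≈ 1#
    G-0 = trans (G-unweighted 0) (trans (boxSum-0 m F _ _ F0) (≐-refl 0))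

    -- Both sides add up `p l * f j * H (j + l)`, once over the triangle `j + l < b` and once over
    -- the square; outside the triangle `H` vanishes.
    ∑-conv : ∀ b (p f H : ℕ → Carrier) → (∀ x → b ℕ.≤ x → H x ≈ 0#) →
      ∑ (upTo b) (λ j → conv p f j * H j) ≈ ∑ (upTo b) (λ l → p l * ∑ (upTo b) (λ j → f j * H (j ℕ.+ l)))
    ∑-conv zero    p f H H≈0 = trans (∑-[] _) (sym (∑-[] _))
    ∑-conv (suc b) p f H H≈0 = begin
      ∑ (upTo (suc b)) (λ j → conv p f j * H j)
        ≈⟨ ∑-upTo-head b _ ⟩
      p 0 * f 0 * H 0 + ∑ (upTo b) (λ j → (p 0 * f (suc j) + conv (p ∘ suc) f j) * H (suc j))
        ≈⟨ +-cong (*-assoc _ _ _) (trans (∑-cong (upTo b) (λ j → trans (distribʳ _ _ _) (+-congʳ (*-assoc _ _ _)))) (∑-distrib-+ (upTo b) _ _)) ⟩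
      p 0 * (f 0 * H 0) + (∑ (upTo b) (λ j → p 0 * (f (suc j) * H (suc j))) + ∑ (upTo b) (λ j → conv (p ∘ suc) f j * H (suc j)))
        ≈⟨ trans (+-congˡ (+-congʳ (sym (*-distribˡ-∑ (upTo b) (p 0) _)))) (sym (+-assoc _ _ _)) ⟩
      p 0 * (f 0 * H 0) + p 0 * ∑ (upTo b) (λ j → f (suc j) * H (suc j)) + ∑ (upTo b) (λ j → conv (p ∘ suc) f j * H (suc j))
        ≈⟨ +-cong (trans (sym (distribˡ _ _ _)) (*-congˡ (sym (∑-upTo-head b (λ j → f j * H j)))))
             (∑-conv b (p ∘ suc) f (H ∘ suc) (λ x b≤x → H≈0 (suc x) (s≤s b≤x))) ⟩
      p 0 * ∑ (upTo (suc b)) (λ j → f j * H j) + ∑ (upTo b) (λ l → p (suc l) * ∑ (upTo b) (λ j → f j * H (suc (j ℕ.+ l))))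
        ≈⟨ +-cong (*-congˡ (∑-cong (upTo (suc b)) (λ j → *-congˡ (reflexive (≡.cong H (≡.sym (ℕₚ.+-identityʳ j)))))))
             (∑-cong (upTo b) (λ l → *-congˡ (extend l))) ⟩
      p 0 * ∑ (upTo (suc b)) (λ j → f j * H (j ℕ.+ 0)) + ∑ (upTo b) (λ l → p (suc l) * ∑ (upTo (suc b)) (λ j → f j * H (j ℕ.+ suc l)))
        ≈⟨ ∑-upTo-head b _ ⟨
      ∑ (upTo (suc b)) (λ l → p l * ∑ (upTo (suc b)) (λ j → f j * H (j ℕ.+ l))) ∎
      where
      extend : ∀ l → ∑ (upTo b) (λ j → f j * H (suc (j ℕ.+ l))) ≈ ∑ (upTo (suc b)) (λ j → f j * H (j ℕ.+ suc l))
      extend l = begin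
        ∑ (upTo b) (λ j → f j * H (suc (j ℕ.+ l)))                        ≈⟨ ∑-cong (upTo b) (λ j → *-congˡ (reflexive (≡.cong H (≡.sym (ℕₚ.+-suc j l))))) ⟩
        ∑ (upTo b) (λ j → f j * H (j ℕ.+ suc l))                          ≈⟨ +-identityʳ _ ⟨
        ∑ (upTo b) (λ j → f j * H (j ℕ.+ suc l)) + 0#                     ≈⟨ +-congˡ (trans (*-congˡ (H≈0 _ beyond)) (zeroʳ _)) ⟨
        ∑ (upTo b) (λ j → f j * H (j ℕ.+ suc l)) + f b * H (b ℕ.+ suc l)  ≈⟨ ∑-upTo-last b _ ⟨
        ∑ (upTo (suc b)) (λ j → f j * H (j ℕ.+ suc l))                    ∎
        where
        beyond : suc b ℕ.≤ b ℕ.+ suc l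
        beyond = ℕₚ.≤-trans (s≤s (ℕₚ.m≤m+n b l)) (ℕₚ.≤-reflexive (≡.sym (ℕₚ.+-suc b l)))

    factor-logDerivative : ∀ b i → HasLogDerivative b (F i) 1 (List.map (λ l → suc l , a i l) (upTo b))
    factor-logDerivative b i H H≈0 = begin
      ∑ (upTo (suc b)) (λ j → F i j * (embed (1 ℕ.* j) * H (1 ℕ.* j)))
        ≈⟨ ∑-cong (upTo (suc b)) (λ j → reflexive (≡.cong (λ k → F i j * (embed k * H k)) (ℕₚ.*-identityˡ j))) ⟩
      ∑ (upTo (suc b)) (λ j → F i j * (embed j * H j))
        ≈⟨ ∑-upTo-head b _ ⟩
      F i 0 * (0# * H 0) + ∑ (upTo b) (λ j → F i (suc j) * (embed (suc j) * H (suc j)))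
        ≈⟨ trans (+-congʳ (trans (*-congˡ (zeroˡ _)) (zeroʳ _))) (+-identityˡ _) ⟩
      ∑ (upTo b) (λ j → F i (suc j) * (embed (suc j) * H (suc j)))
        ≈⟨ ∑-cong (upTo b) (λ j → trans (solve 3 (λ x y z → x :* (y :* z) := y :* x :* z) refl _ _ _) (*-congʳ (F-suc i j))) ⟩
      ∑ (upTo b) (λ j → conv (a i) (F i) j * H (suc j))
        ≈⟨ ∑-conv b (a i) (F i) (H ∘ suc) (λ x b≤x → H≈0 (suc x) (s≤s b≤x)) ⟩
      ∑ (upTo b) (λ l → a i l * ∑ (upTo b) (λ j → F i j * H (suc (j ℕ.+ l))))
        ≈⟨ ∑-cong (upTo b) (λ l → *-congˡ (extend l)) ⟩
      ∑ (upTo b) (λ l → a i l * ∑ (upTo (suc b)) (λ j → F i j * H (1 ℕ.* j ℕ.+ suc l)))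
        ≈⟨ ∑-map (λ l → suc l , a i l) (upTo b) _ ⟨
      ∑ (List.map (λ l → suc l , a i l) (upTo b)) (λ la → proj₂ la * ∑ (upTo (suc b)) (λ j → F i j * H (1 ℕ.* j ℕ.+ proj₁ la))) ∎
      where
      arg : ∀ j l → suc (j ℕ.+ l) ≡ 1 ℕ.* j ℕ.+ suc l
      arg j l = ≡.trans (≡.sym (ℕₚ.+-suc j l)) (≡.cong (ℕ._+ suc l) (≡.sym (ℕₚ.*-identityˡ j)))
      extend : ∀ l → ∑ (upTo b) (λ j → F i j * H (suc (j ℕ.+ l))) ≈ ∑ (upTo (suc b)) (λ j → F i j * H (1 ℕ.* j ℕ.+ suc l))
      extend l = begin
        ∑ (upTo b) (λ j → F i j * H (suc (j ℕ.+ l)))                              ≈⟨ +-identityʳ _ ⟨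
        ∑ (upTo b) (λ j → F i j * H (suc (j ℕ.+ l))) + 0#                         ≈⟨ +-congˡ (trans (*-congˡ (H≈0 _ (s≤s (ℕₚ.m≤m+n b l)))) (zeroʳ _)) ⟨
        ∑ (upTo b) (λ j → F i j * H (suc (j ℕ.+ l))) + F i b * H (suc (b ℕ.+ l))  ≈⟨ ∑-upTo-last b _ ⟨
        ∑ (upTo (suc b)) (λ j → F i j * H (suc (j ℕ.+ l)))                        ≈⟨ ∑-cong (upTo (suc b)) (λ j → *-congˡ (reflexive (≡.cong H (arg j l)))) ⟩
        ∑ (upTo (suc b)) (λ j → F i j * H (1 ℕ.* j ℕ.+ suc l))                    ∎

    G-suc : ∀ n → embed (suc n) * G (suc n) ≈ conv (λ l → ∑ (allFin m) (λ i → a i l)) G n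
    G-suc n = begin
      embed N * G N
        ≈⟨ *-congˡ (G-stable 0 N) ⟨
      embed N * unweighted N (λ _ x → [ x ≐ N ])
        ≈⟨ boxSum-* (embed N) (λ _ x → [ x ≐ N ]) ⟨
      unweighted N (λ _ x → embed N * [ x ≐ N ])
        ≈⟨ boxSum-cong (λ _ x → sym (≐-subst x N embed)) ⟩
      unweighted N (λ _ x → embed x * [ x ≐ N ])
        ≈⟨ boxSum-logDerivative m N F (λ _ → 1) (λ i → List.map (λ l → suc l , a i l) (upTo N)) (factor-logDerivative N)
             (λ x → [ x ≐ N ]) (λ x N<x → ≐-≢ (λ { ≡.refl → ℕₚ.<-irrefl ≡.refl N<x })) ⟩
      ∑ (allFin m) (λ i → ∑ (List.map (λ l → suc l , a i l) (upTo N)) (λ la → proj₂ la * unweighted N (λ _ x → [ x ℕ.+ proj₁ la ≐ N ])))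
        ≈⟨ ∑-cong (allFin m) (λ i → ∑-map (λ l → suc l , a i l) (upTo N) _) ⟩
      ∑ (allFin m) (λ i → ∑ (upTo N) (λ l → a i l * unweighted N (λ _ x → [ x ℕ.+ suc l ≐ N ])))
        ≈⟨ ∑-comm (allFin m) (upTo N) _ ⟩
      ∑ (upTo N) (λ l → ∑ (allFin m) (λ i → a i l * unweighted N (λ _ x → [ x ℕ.+ suc l ≐ N ])))
        ≈⟨ ∑-upTo-cong N (λ l l<N → trans (sym (*-distribʳ-∑ (allFin m) _ _)) (*-congˡ (shift l (ℕₚ.≤-pred l<N)))) ⟩
      ∑ (upTo N) (λ l → ∑ (allFin m) (λ i → a i l) * G (n ℕ.∸ l))
        ≈⟨ conv-∑ _ G n ⟨
      conv (λ l → ∑ (allFin m) (λ i → a i l)) G n ∎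
      where
      N = suc n
      shift : ∀ l → l ℕ.≤ n → unweighted N (λ _ x → [ x ℕ.+ suc l ≐ N ]) ≈ G (n ℕ.∸ l)
      shift l l≤n = begin
        unweighted N (λ _ x → [ x ℕ.+ suc l ≐ N ])  ≈⟨ boxSum-cong (λ _ x → ≐-shift x l n l≤n) ⟩
        unweighted N (λ _ x → [ x ≐ n ℕ.∸ l ])      ≡⟨ ≡.cong (λ k → unweighted k (λ _ x → [ x ≐ n ℕ.∸ l ])) (≡.sym (≡.cong suc (ℕₚ.m+[n∸m]≡n l≤n))) ⟩
        unweighted (suc l ℕ.+ (n ℕ.∸ l)) (λ _ x → [ x ≐ n ℕ.∸ l ]) ≈⟨ G-stable (suc l) (n ℕ.∸ l) ⟩
        G (n ℕ.∸ l)                                 ∎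

-- Order, bounds and limits of real numbers.

module RealKit {c ℓ₁ ℓ₂ : Level} (R : RealField c ℓ₁ ℓ₂) where
  open RealField R hiding (_^_; zero)
  open Analysis R using (0<1; recip; recip-inverseˡ; 0<recip; 0<fromℕ; 1/ℕ)

  ℝ : CommutativeRing c ℓ₁
  ℝ = HeytingCommutativeRing.commutativeRing (HeytingField.heytingCommutativeRing heytingField)

  open RingKit ℝ
  private module < = IsStrictPartialOrder isStrictPartialOrder

  infix 4 _≤_
  -- Being a negation, this order passes to limits and admits case distinctions in its proofs,
  -- although the order is not decidable.
  _≤_ : Carrier → Carrier → Set ℓ₂
  x ≤ y = ¬ y < x

  <-irrefl : ∀ {x} → ¬ x < x
  <-irrefl = <.irrefl refl

  <-trans : ∀ {x y z} → x < y → y < z → x < z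
  <-trans = <.trans

  <-asym : ∀ {x y} → x < y → ¬ y < x
  <-asym x<y y<x = <-irrefl (<-trans x<y y<x)

  <-respˡ : ∀ {x y z} → x ≈ y → x < z → y < z
  <-respˡ = <.<-respˡ-≈

  <-respʳ : ∀ {x y z} → x ≈ y → z < x → z < y
  <-respʳ = <.<-respʳ-≈

  <-cotrans : ∀ {x y} → x < y → ∀ z → x < z ⊎ z < y
  <-cotrans x<y z with #-cotrans (<⇒# x<y) z
  ... | inj₁ x#z = [ inj₁ , (λ z<x → inj₂ (<-trans z<x x<y)) ]′ (#⇒<⊎> x#z)
  ... | inj₂ z#y = [ inj₂ , (λ y<z → inj₁ (<-trans x<y y<z)) ]′ (#⇒<⊎> z#y)

  <⇒≤ : ∀ {x y} → x < y → x ≤ y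
  <⇒≤ = <-asym

  ≤-reflexive : ∀ {x y} → x ≈ y → x ≤ y
  ≤-reflexive x≈y y<x = <.irrefl (sym x≈y) y<x

  ≤-refl : ∀ {x} → x ≤ x
  ≤-refl = <-irrefl

  <-≤-trans : ∀ {x y z} → x < y → y ≤ z → x < z
  <-≤-trans {z = z} x<y y≤z with <-cotrans x<y z
  ... | inj₁ x<z = x<z
  ... | inj₂ z<y with () ← y≤z z<y

  ≤-<-trans : ∀ {x y z} → x ≤ y → y < z → x < z
  ≤-<-trans {x} x≤y y<z with <-cotrans y<z x
  ... | inj₂ x<z = x<z
  ... | inj₁ y<x with () ← x≤y y<x

  ≤-trans : ∀ {x y z} → x ≤ y → y ≤ z → x ≤ z
  ≤-trans x≤y y≤z z<x = x≤y (≤-<-trans y≤z z<x)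

  ≤-antisym : ∀ {x y} → x ≤ y → y ≤ x → x ≈ y
  ≤-antisym {x} {y} x≤y y≤x = proj₁ (tight x y) (λ x#y → [ y≤x , x≤y ]′ (#⇒<⊎> x#y))

  -- Trichotomy for negated goals: once both strict cases are refuted, antisymmetry leaves equality.
  -- To prove `u ≤ v`, take `v < u` for `A`.
  ≤-trichotomy : ∀ {a} {A : Set a} x y → (x < y → ¬ A) → (x ≈ y → ¬ A) → (y < x → ¬ A) → ¬ A
  ≤-trichotomy x y lt eq gt a = eq (≤-antisym (λ y<x → gt y<x a) (λ x<y → lt x<y a)) a

  ≤-isPreorder : IsPreorder _≈_ _≤_
  ≤-isPreorder = record { isEquivalence = isEquivalence ; reflexive = ≤-reflexive ; trans = ≤-trans }

  module ≤-Reasoning = Triple {_≈_ = _≈_} {_≤_ = _≤_} {_<_ = _<_} ≤-isPreorder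
    <-asym <-trans ((λ y≈z x<y → <-respʳ y≈z x<y) , (λ x≈y x<z → <-respˡ x≈y x<z)) <⇒≤ <-≤-trans ≤-<-trans

  -- The pattern of most inequalities below: the solver verifies the difference `d` as an identity,
  -- and the sign of `d` is evident from its form.
  x<y+z : ∀ {x y d} → y ≈ x + d → 0# < d → x < y
  x<y+z {x} {y} {d} y≈x+d 0<d = <-respˡ (+-identityˡ x) (<-respʳ (trans (+-comm d x) (sym y≈x+d)) (+-monoˡ-< x 0<d))

  x<y⇒0<y-x : ∀ {x y} → x < y → 0# < y - x
  x<y⇒0<y-x {x} x<y = <-respˡ (-‿inverseʳ x) (+-monoˡ-< (- x) x<y)

  x≤y⇒0≤y-x : ∀ {x y} → x ≤ y → 0# ≤ y - x
  x≤y⇒0≤y-x x≤y lt = x≤y (x<y+z (solve 2 (λ x y → x := y :+ (:0 :- (y :- x))) refl _ _) (x<y⇒0<y-x lt))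

  x≤y+z : ∀ {x y d} → y ≈ x + d → 0# ≤ d → x ≤ y
  x≤y+z {x} {y} {d} y≈x+d 0≤d y<x = 0≤d (x<y+z {d = x - y} (trans (solve 2 (λ d x → :0 := d :+ (x :- (x :+ d))) refl d x)
    (+-congˡ (+-congˡ (-‿cong (sym y≈x+d))))) (x<y⇒0<y-x y<x))

  +-mono-< : ∀ {x y u v} → x < y → u < v → x + u < y + v
  +-mono-< {x} {y} {u} {v} x<y u<v = <-trans (+-monoˡ-< u x<y) (<-respˡ (+-comm u y) (<-respʳ (+-comm v y) (+-monoˡ-< y u<v)))

  +-monoˡ-≤ : ∀ {x y} z → x ≤ y → x + z ≤ y + z
  +-monoˡ-≤ z x≤y = x≤y+z (solve 3 (λ x y z → y :+ z := x :+ z :+ (y :- x)) refl _ _ z) (x≤y⇒0≤y-x x≤y)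

  +-monoʳ-≤ : ∀ {x y} z → x ≤ y → z + x ≤ z + y
  +-monoʳ-≤ z x≤y = x≤y+z (solve 3 (λ x y z → z :+ y := z :+ x :+ (y :- x)) refl _ _ z) (x≤y⇒0≤y-x x≤y)

  +-mono-≤ : ∀ {x y u v} → x ≤ y → u ≤ v → x + u ≤ y + v
  +-mono-≤ {y = y} {u = u} x≤y u≤v = ≤-trans (+-monoˡ-≤ u x≤y) (+-monoʳ-≤ y u≤v)

  neg-mono-≤ : ∀ {x y} → x ≤ y → - y ≤ - x
  neg-mono-≤ x≤y = x≤y+z (solve 2 (λ x y → :- x := :- y :+ (y :- x)) refl _ _) (x≤y⇒0≤y-x x≤y)

  neg-mono-< : ∀ {x y} → x < y → - y < - x
  neg-mono-< x<y = x<y+z (solve 2 (λ x y → :- x := :- y :+ (y :- x)) refl _ _) (x<y⇒0<y-x x<y)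

  0<+ : ∀ {x y} → 0# < x → 0# < y → 0# < x + y
  0<+ 0<x 0<y = <-respˡ (+-identityˡ 0#) (+-mono-< 0<x 0<y)

  0≤+ : ∀ {x y} → 0# ≤ x → 0# ≤ y → 0# ≤ x + y
  0≤+ 0≤x 0≤y = ≤-trans (≤-reflexive (sym (+-identityˡ 0#))) (+-mono-≤ 0≤x 0≤y)

  0≤* : ∀ {x y} → 0# ≤ x → 0# ≤ y → 0# ≤ x * y
  0≤* {x} {y} 0≤x 0≤y = ≤-trichotomy 0# x
    (λ 0<x → ≤-trichotomy 0# y
      (λ 0<y → <⇒≤ (*-pos 0<x 0<y))
      (λ 0≈y → ≤-reflexive (sym (trans (*-congˡ (sym 0≈y)) (zeroʳ x))))
      (λ y<0 _ → 0≤y y<0))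
    (λ 0≈x → ≤-reflexive (sym (trans (*-congʳ (sym 0≈x)) (zeroˡ y))))
    (λ x<0 _ → 0≤x x<0)

  0≤x² : ∀ x → 0# ≤ x * x
  0≤x² x = ≤-trichotomy 0# x
    (λ 0<x → <⇒≤ (*-pos 0<x 0<x))
    (λ 0≈x → ≤-reflexive (sym (trans (*-congʳ (sym 0≈x)) (zeroˡ x))))
    (λ x<0 → <⇒≤ (<-respʳ (solve 1 (λ x → (:0 :- x) :* (:0 :- x) := x :* x) refl x) (*-pos (x<y⇒0<y-x x<0) (x<y⇒0<y-x x<0))))

  *-monoʳ-≤ : ∀ {x y z} → 0# ≤ z → x ≤ y → z * x ≤ z * y
  *-monoʳ-≤ 0≤z x≤y = x≤y+z (solve 3 (λ x y z → z :* y := z :* x :+ z :* (y :- x)) refl _ _ _) (0≤* 0≤z (x≤y⇒0≤y-x x≤y))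

  *-monoˡ-≤ : ∀ {x y z} → 0# ≤ z → x ≤ y → x * z ≤ y * z
  *-monoˡ-≤ 0≤z x≤y = x≤y+z (solve 3 (λ x y z → y :* z := x :* z :+ z :* (y :- x)) refl _ _ _) (0≤* 0≤z (x≤y⇒0≤y-x x≤y))

  *-mono-≤ : ∀ {x y u v} → 0# ≤ u → 0# ≤ y → x ≤ y → u ≤ v → x * u ≤ y * v
  *-mono-≤ 0≤u 0≤y x≤y u≤v = ≤-trans (*-monoˡ-≤ 0≤u x≤y) (*-monoʳ-≤ 0≤y u≤v)

  *-monoʳ-< : ∀ {x y z} → 0# < z → x < y → z * x < z * y
  *-monoʳ-< 0<z x<y = x<y+z (solve 3 (λ x y z → z :* y := z :* x :+ z :* (y :- x)) refl _ _ _) (*-pos 0<z (x<y⇒0<y-x x<y))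

  *-monoˡ-< : ∀ {x y z} → 0# < z → x < y → x * z < y * z
  *-monoˡ-< 0<z x<y = x<y+z (solve 3 (λ x y z → y :* z := x :* z :+ z :* (y :- x)) refl _ _ _) (*-pos 0<z (x<y⇒0<y-x x<y))

  *-cancelˡ-≤ : ∀ {x y z} → 0# < z → z * x ≤ z * y → x ≤ y
  *-cancelˡ-≤ 0<z zx≤zy y<x = zx≤zy (*-monoʳ-< 0<z y<x)

  *-cancelˡ-< : ∀ {x y z} → 0# < z → z * x < z * y → x < y
  *-cancelˡ-< {x} {y} {z} 0<z zx<zy = <-respˡ (cancel x) (<-respʳ (cancel y) (*-monoʳ-< (0<recip z 0<z) zx<zy))
    where
    cancel : ∀ w → recip z 0<z * (z * w) ≈ w
    cancel w = trans (sym (*-assoc _ _ _)) (trans (*-congʳ (recip-inverseˡ z 0<z)) (*-identityˡ w))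

  0≤1 : 0# ≤ 1#
  0≤1 = <⇒≤ 0<1

  0≤fromℕ : ∀ n → 0# ≤ fromℕ n
  0≤fromℕ zero    = ≤-refl
  0≤fromℕ (suc n) = <⇒≤ (0<fromℕ (suc n))

  0≤^ : ∀ {x} n → 0# ≤ x → 0# ≤ x ^ n
  0≤^ zero    0≤x = 0≤1
  0≤^ (suc n) 0≤x = 0≤* 0≤x (0≤^ n 0≤x)

  0<1/ℕ : ∀ n .{{_ : NonZero n}} → 0# < 1/ℕ n
  0<1/ℕ n = 0<recip (fromℕ n) (0<fromℕ n)

  recip-inverseʳ : ∀ x (0<x : 0# < x) → x * recip x 0<x ≈ 1#
  recip-inverseʳ x 0<x = trans (*-comm _ _) (recip-inverseˡ x 0<x)

  recip-unique : ∀ {x y} (0<x : 0# < x) → x * y ≈ 1# → y ≈ recip x 0<x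
  recip-unique {x} {y} 0<x xy≈1 = trans (sym (*-identityˡ y)) (trans (*-congʳ (sym (recip-inverseˡ x 0<x)))
    (trans (*-assoc _ _ _) (trans (*-congˡ xy≈1) (*-identityʳ _))))

  recip-cong : ∀ {x y} (0<x : 0# < x) (0<y : 0# < y) → x ≈ y → recip x 0<x ≈ recip y 0<y
  recip-cong {x} 0<x 0<y x≈y = recip-unique 0<y (trans (*-congʳ (sym x≈y)) (recip-inverseʳ x 0<x))

  fromℕ-mono-≤ : ∀ {m n} → m ℕ.≤ n → fromℕ m ≤ fromℕ n
  fromℕ-mono-≤ {m} {n} m≤n = x≤y+z (trans (reflexive (≡.cong fromℕ (≡.sym (ℕₚ.m+[n∸m]≡n m≤n)))) (embed-+ m (n ℕ.∸ m))) (0≤fromℕ (n ℕ.∸ m))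

  half : ∀ ε → 0# < ε → ∃[ δ ] (0# < δ) × (δ + δ ≈ ε)
  half ε 0<ε = ε * h , *-pos 0<ε (0<recip 2# 0<2) , (begin
    ε * h + ε * h  ≈⟨ solve 2 (λ e h → e :* h :+ e :* h := e :* (h :* (:1 :+ :1))) refl ε h ⟩
    ε * (h * 2#)   ≈⟨ *-congˡ (recip-inverseˡ 2# 0<2) ⟩
    ε * 1#         ≈⟨ *-identityʳ ε ⟩
    ε              ∎)
    where
    open import Relation.Binary.Reasoning.Setoid setoid
    2# = 1# + 1#
    0<2 : 0# < 2#
    0<2 = 0<+ 0<1 0<1
    h = recip 2# 0<2

  abs-resp : ∀ {x y ε} → x ≈ y → ∣ x ∣< ε → ∣ y ∣< ε
  abs-resp x≈y (l , u) = <-respʳ x≈y l , <-respˡ x≈y u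

  abs-mono : ∀ {x ε δ} → ε ≤ δ → ∣ x ∣< ε → ∣ x ∣< δ
  abs-mono ε≤δ (l , u) = ≤-<-trans (neg-mono-≤ ε≤δ) l , <-≤-trans u ε≤δ

  abs-+ : ∀ {x y ε δ} → ∣ x ∣< ε → ∣ y ∣< δ → ∣ x + y ∣< (ε + δ)
  abs-+ (l , u) (l′ , u′) = <-respˡ (solve 2 (λ a b → :- a :+ :- b := :- (a :+ b)) refl _ _) (+-mono-< l l′) , +-mono-< u u′

  abs-neg : ∀ {x ε} → ∣ x ∣< ε → ∣ - x ∣< ε
  abs-neg (l , u) = neg-mono-< u , <-respʳ (solve 1 (λ e → :- (:- e) := e) refl _) (neg-mono-< l)

  abs-0 : ∀ {ε} → 0# < ε → ∣ 0# ∣< ε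
  abs-0 0<ε = <-respʳ (solve 0 (:- :0 := :0) refl) (neg-mono-< 0<ε) , 0<ε

  abs-pos : ∀ {x ε} → ∣ x ∣< ε → 0# < ε
  abs-pos {x} {ε} (l , u) = *-cancelˡ-< (0<+ 0<1 0<1)
    (x<y+z (solve 2 (λ e x → (:1 :+ :1) :* e := (:1 :+ :1) :* :0 :+ ((x :- (:- e)) :+ (e :- x))) refl ε x) (0<+ (x<y⇒0<y-x l) (x<y⇒0<y-x u)))

  -- 2 (a b ∓ x y) is a sum of two products of the positive numbers a ± x and b ± y.
  abs-* : ∀ {x y a b} → ∣ x ∣< a → ∣ y ∣< b → ∣ x * y ∣< (a * b)
  abs-* {x} {y} {a} {b} (l , u) (l′ , u′) = *-cancelˡ-< 0<2 (x<y+z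
      (solve 4 (λ x y a b → (:1 :+ :1) :* (x :* y) := (:1 :+ :1) :* (:- (a :* b)) :+ ((x :- (:- a)) :* (y :- (:- b)) :+ (a :- x) :* (b :- y))) refl x y a b)
      (0<+ (*-pos (x<y⇒0<y-x l) (x<y⇒0<y-x l′)) (*-pos (x<y⇒0<y-x u) (x<y⇒0<y-x u′))))
    , *-cancelˡ-< 0<2 (x<y+z
      (solve 4 (λ x y a b → (:1 :+ :1) :* (a :* b) := (:1 :+ :1) :* (x :* y) :+ ((a :- x) :* (y :- (:- b)) :+ (x :- (:- a)) :* (b :- y))) refl x y a b)
      (0<+ (*-pos (x<y⇒0<y-x u) (x<y⇒0<y-x l′)) (*-pos (x<y⇒0<y-x l) (x<y⇒0<y-x u′))))
    where
    0<2 : 0# < 1# + 1#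
    0<2 = 0<+ 0<1 0<1

  abs-bound : ∀ x → ∃[ B ] ∣ x ∣< B
  abs-bound x with archimedean x | archimedean (- x)
  -- The sum of the two Archimedean bounds takes the place of their maximum.
  ... | m , x<m | n , -x<n = fromℕ m + fromℕ n ,
    <-respʳ (solve 1 (λ x → :- (:- x) := x) refl x) (neg-mono-< (<-≤-trans -x<n (x≤y+z (+-comm _ _) (0≤fromℕ m)))) ,
    <-≤-trans x<m (x≤y+z refl (0≤fromℕ n))

  ⟶-cong : ∀ {s t a b} → (∀ n → s n ≈ t n) → a ≈ b → s ⟶ a → t ⟶ b
  ⟶-cong s≈t a≈b s⟶a ε 0<ε with s⟶a ε 0<ε
  ... | N , h = N , λ n N≤n → abs-resp (+-cong (s≈t n) (-‿cong a≈b)) (h n N≤n)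

  ⟶-const : ∀ a → (λ _ → a) ⟶ a
  ⟶-const a ε 0<ε = 0 , λ n _ → abs-resp (sym (-‿inverseʳ a)) (abs-0 0<ε)

  ⟶-subsequence : ∀ {s a} (f : ℕ → ℕ) → (∀ n → n ℕ.≤ f n) → s ⟶ a → (s ∘ f) ⟶ a
  ⟶-subsequence f n≤f s⟶a ε 0<ε with s⟶a ε 0<ε
  ... | N , h = N , λ n N≤n → h (f n) (ℕₚ.≤-trans N≤n (n≤f n))

  ⟶-unshift : ∀ {s a} k → (λ n → s (n ℕ.+ k)) ⟶ a → s ⟶ a
  ⟶-unshift {s} {a} k s⟶a ε 0<ε with s⟶a ε 0<ε
  ... | N , h = N ℕ.+ k , λ n N+k≤n → ≡.subst (λ i → ∣ s i - a ∣< ε) (ℕₚ.m∸n+n≡m (ℕₚ.≤-trans (ℕₚ.m≤n+m k N) N+k≤n))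
    (h (n ℕ.∸ k) (≡.subst (ℕ._≤ n ℕ.∸ k) (ℕₚ.m+n∸n≡m N k) (ℕₚ.∸-monoˡ-≤ k N+k≤n)))

  ⟶-+ : ∀ {s t a b} → s ⟶ a → t ⟶ b → (λ n → s n + t n) ⟶ (a + b)
  ⟶-+ {s} {t} {a} {b} s⟶a t⟶b ε 0<ε =
    let δ , 0<δ , δ+δ≈ε = half ε 0<ε
        M , h = s⟶a δ 0<δ
        N , k = t⟶b δ 0<δ
    in M ℕ.⊔ N , λ n le → abs-mono (≤-reflexive δ+δ≈ε) (abs-resp
      (solve 4 (λ s t a b → (s :- a) :+ (t :- b) := (s :+ t) :- (a :+ b)) refl (s n) (t n) a b)
      (abs-+ (h n (ℕₚ.≤-trans (ℕₚ.m≤m⊔n M N) le)) (k n (ℕₚ.≤-trans (ℕₚ.m≤n⊔m M N) le))))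

  ⟶-neg : ∀ {s a} → s ⟶ a → (λ n → - s n) ⟶ (- a)
  ⟶-neg {s} {a} s⟶a ε 0<ε with s⟶a ε 0<ε
  ... | N , h = N , λ n N≤n → abs-resp (solve 2 (λ s a → :- (s :- a) := :- s :- (:- a)) refl (s n) a) (abs-neg (h n N≤n))

  ⟶-null : ∀ {s a} → s ⟶ a → (λ n → s n - a) ⟶ 0#
  ⟶-null {a = a} s⟶a = ⟶-cong (λ _ → refl) (-‿inverseʳ a) (⟶-+ s⟶a (⟶-const (- a)))

  ⟶-unnull : ∀ {s a} → (λ n → s n - a) ⟶ 0# → s ⟶ a
  ⟶-unnull {s} {a} h = ⟶-cong (λ n → solve 2 (λ s a → s :- a :+ a := s) refl (s n) a) (+-identityˡ a) (⟶-+ h (⟶-const a))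

  ⟶-bounded : ∀ {s a} → s ⟶ a → ∃[ B ] ∃[ N ] (∀ n → N ℕ.≤ n → ∣ s n ∣< B)
  ⟶-bounded {s} {a} s⟶a with abs-bound a | s⟶a 1# 0<1
  ... | B , a<B | N , h = B + 1# , N , λ n N≤n → abs-resp (solve 2 (λ s a → a :+ (s :- a) := s) refl (s n) a) (abs-+ a<B (h n N≤n))

  bounded*null : ∀ {s t : ℕ → Carrier} {B M} → (∀ n → M ℕ.≤ n → ∣ s n ∣< B) → t ⟶ 0# → (λ n → s n * t n) ⟶ 0#
  bounded*null {s} {t} {B} {M} s<B t⟶0 ε 0<ε = M ℕ.⊔ N , λ n le →
      abs-resp (solve 2 (λ s t → s :* (t :- :0) := s :* t :- :0) refl (s n) (t n))
        (abs-mono (≤-reflexive (trans (solve 3 (λ b e r → b :* (e :* r) := e :* (r :* b)) refl B ε (recip B 0<B))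
            (trans (*-congˡ (recip-inverseˡ B 0<B)) (*-identityʳ ε))))
          (abs-* (s<B n (ℕₚ.≤-trans (ℕₚ.m≤m⊔n M N) le)) (proj₂ small n (ℕₚ.≤-trans (ℕₚ.m≤n⊔m M N) le))))
    where
    0<B : 0# < B
    0<B = abs-pos (s<B M ℕₚ.≤-refl)
    small = t⟶0 (ε * recip B 0<B) (*-pos 0<ε (0<recip B 0<B))
    N = proj₁ small

  ⟶-* : ∀ {s t a b} → s ⟶ a → t ⟶ b → (λ n → s n * t n) ⟶ (a * b)
  ⟶-* {s} {t} {a} {b} s⟶a t⟶b =
    let B , M , s<B = ⟶-bounded s⟶a
        C , b<C = abs-bound b
    in ⟶-unnull (⟶-cong
      (λ n → solve 4 (λ s t a b → s :* (t :- b) :+ b :* (s :- a) := s :* t :- a :* b) refl (s n) (t n) a b)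
      (+-identityˡ 0#)
      (⟶-+ (bounded*null s<B (⟶-null t⟶b)) (bounded*null {s = λ _ → b} {M = 0} (λ _ _ → b<C) (⟶-null s⟶a))))

  ⟶-scale : ∀ {s a} b → s ⟶ a → (λ n → b * s n) ⟶ (b * a)
  ⟶-scale b = ⟶-* (⟶-const b)

  ⟶-≤ : ∀ {s t a b} M → s ⟶ a → t ⟶ b → (∀ n → M ℕ.≤ n → s n ≤ t n) → a ≤ b
  ⟶-≤ {s} {t} {a} {b} M s⟶a t⟶b s≤t b<a =
    let δ , 0<δ , δ+δ≈ = half (a - b) (x<y⇒0<y-x b<a)
        N , h  = s⟶a δ 0<δ
        N′ , k = t⟶b δ 0<δ
        n = M ℕ.⊔ (N ℕ.⊔ N′)
        lo , _ = h n (ℕₚ.≤-trans (ℕₚ.m≤m⊔n N N′) (ℕₚ.m≤n⊔m M _))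
        _ , hi = k n (ℕₚ.≤-trans (ℕₚ.m≤n⊔m N N′) (ℕₚ.m≤n⊔m M _))
    in s≤t n (ℕₚ.m≤m⊔n M _) (x<y+z {d = (s n - a - - δ) + (δ - (t n - b))} (begin
      s n                                              ≈⟨ solve 4 (λ s t a b → s := t :+ ((s :- a) :+ :- (t :- b) :+ (a :- b))) refl (s n) (t n) a b ⟩
      t n + ((s n - a) + - (t n - b) + (a - b))        ≈⟨ +-congˡ (+-congˡ (sym δ+δ≈)) ⟩
      t n + ((s n - a) + - (t n - b) + (δ + δ))        ≈⟨ solve 4 (λ t x y d → t :+ (x :+ :- y :+ (d :+ d)) := t :+ ((x :- :- d) :+ (d :- y))) refl (t n) (s n - a) (t n - b) δ ⟩
      t n + ((s n - a - - δ) + (δ - (t n - b)))        ∎)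
      (0<+ (x<y⇒0<y-x lo) (x<y⇒0<y-x hi)))
    where open import Relation.Binary.Reasoning.Setoid setoid

  ⟶-unique : ∀ {s a b} → s ⟶ a → s ⟶ b → a ≈ b
  ⟶-unique s⟶a s⟶b = ≤-antisym (⟶-≤ 0 s⟶a s⟶b (λ _ _ → ≤-refl)) (⟶-≤ 0 s⟶b s⟶a (λ _ _ → ≤-refl))

  ⟶-squeeze-null : ∀ {s t : ℕ → Carrier} → (∀ n → - t n ≤ s n) → (∀ n → s n ≤ t n) → t ⟶ 0# → s ⟶ 0#
  ⟶-squeeze-null {s} {t} lo hi t⟶0 ε 0<ε with t⟶0 ε 0<ε
  ... | N , h = N , λ n N≤n → let u = <-respˡ (solve 1 (λ t → t :- :0 := t) refl (t n)) (proj₂ (h n N≤n)) in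
    <-respʳ (solve 1 (λ s → s := s :- :0) refl (s n)) (<-≤-trans (neg-mono-< u) (lo n)) ,
    <-respˡ (solve 1 (λ s → s := s :- :0) refl (s n)) (≤-<-trans (hi n) u)

  -- Division before the limit is taken: a positive lower bound for the approximations replaces an
  -- inverse of their limit.
  ⟶-cancel-null : ∀ {s t : ℕ → Carrier} {b} → 0# < b → (∀ n → b ≤ t n) → (λ n → s n * t n) ⟶ 0# → s ⟶ 0#
  ⟶-cancel-null {s} {t} {b} 0<b b≤t h ε 0<ε with h (ε * b) (*-pos 0<ε 0<b)
  ... | N , k = N , λ n N≤n → let l , u = k n N≤n; 0<t = <-≤-trans 0<b (b≤t n) in
    *-cancelˡ-< 0<t (begin-strict
      t n * - ε         ≈⟨ solve 2 (λ t e → t :* (:- e) := :- (e :* t)) refl _ _ ⟩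
      - (ε * t n)       ≤⟨ neg-mono-≤ (*-monoʳ-≤ (<⇒≤ 0<ε) (b≤t n)) ⟩
      - (ε * b)         <⟨ l ⟩
      s n * t n - 0#    ≈⟨ solve 2 (λ s t → s :* t :- :0 := t :* (s :- :0)) refl _ _ ⟩
      t n * (s n - 0#)  ∎) ,
    *-cancelˡ-< 0<t (begin-strict
      t n * (s n - 0#)  ≈⟨ solve 2 (λ s t → t :* (s :- :0) := s :* t :- :0) refl _ _ ⟩
      s n * t n - 0#    <⟨ u ⟩
      ε * b             ≤⟨ *-monoʳ-≤ (<⇒≤ 0<ε) (b≤t n) ⟩
      ε * t n           ≈⟨ *-comm _ _ ⟩
      t n * ε           ∎)
    where open ≤-Reasoning

  1/ℕ-null : (λ n → 1/ℕ (suc n)) ⟶ 0#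
  1/ℕ-null ε 0<ε with archimedean (recip ε 0<ε)
  ... | N , r<N = N , λ n N≤n → <-respʳ (sym (solve 1 (λ x → x :- :0 := x) refl _)) (<-trans
      (<-respʳ (solve 0 (:- :0 := :0) refl) (neg-mono-< 0<ε)) (0<1/ℕ (suc n))) ,
    *-cancelˡ-< (0<fromℕ (suc n)) (begin-strict
      fromℕ (suc n) * (1/ℕ (suc n) - 0#)  ≈⟨ solve 2 (λ x y → x :* (y :- :0) := x :* y) refl _ _ ⟩
      fromℕ (suc n) * 1/ℕ (suc n)         ≈⟨ recip-inverseʳ _ _ ⟩
      1#                                  ≈⟨ recip-inverseˡ ε 0<ε ⟨
      recip ε 0<ε * ε                     <⟨ *-monoˡ-< 0<ε (<-≤-trans r<N (fromℕ-mono-≤ (ℕₚ.m≤n⇒m≤1+n N≤n))) ⟩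
      fromℕ (suc n) * ε                   ∎)
    where open ≤-Reasoning

  small : ∀ ε → 0# < ε → ∃[ N ] (∀ n → N ℕ.≤ n → 1/ℕ (suc n) < ε)
  small ε 0<ε with 1/ℕ-null ε 0<ε
  ... | N , h = N , λ n N≤n → <-respˡ (solve 1 (λ x → x :- :0 := x) refl _) (proj₂ (h n N≤n))

-- The exponential series: functional equation and the tangent at zero.

module Exponentials {c ℓ₁ ℓ₂ : Level} (R : RealField c ℓ₁ ℓ₂) where
  open RealField R hiding (_^_; zero)
  open Analysis R using (0<1; 0<fromℕ; 1/ℕ; 1/_!; IsExp)
  open RealKit R
  open RingKit ℝ
  private module ≈ = SetoidReasoning setoid

  1/1≈1 : 1/ℕ 1 ≈ 1#
  1/1≈1 = sym (recip-unique _ (solve 0 ((:1 :+ :0) :* :1 := :1) refl))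

  1/!-suc : ∀ k → fromℕ (suc k) * 1/ (suc k) ! ≈ 1/ k !
  1/!-suc k = recip-unique _ (≈.begin
    fromℕ (k !) * (fromℕ (suc k) * 1/ (suc k) !)  ≈.≈⟨ solve 3 (λ x y z → x :* (y :* z) := (y :* x) :* z) refl _ _ _ ⟩
    (fromℕ (suc k) * fromℕ (k !)) * 1/ (suc k) !  ≈.≈⟨ *-congʳ (embed-* (suc k) (k !)) ⟨
    fromℕ (suc k !) * 1/ (suc k) !                ≈.≈⟨ recip-inverseʳ _ _ ⟩
    1#                                            ≈.∎)

  0≤∑ : ∀ n {f : ℕ → Carrier} → (∀ i → 0# ≤ f i) → 0# ≤ ∑ (upTo n) f
  0≤∑ zero    0≤f = ≤-reflexive (sym (∑-[] _))
  0≤∑ (suc n) 0≤f = ≤-trans (0≤+ (0≤∑ n 0≤f) (0≤f n)) (≤-reflexive (sym (∑-upTo-last n _)))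

  ∑-mono-≤ : ∀ n {f g : ℕ → Carrier} → (∀ i → f i ≤ g i) → ∑ (upTo n) f ≤ ∑ (upTo n) g
  ∑-mono-≤ zero    f≤g = ≤-reflexive (trans (∑-[] _) (sym (∑-[] _)))
  ∑-mono-≤ (suc n) f≤g = ≤-trans (≤-reflexive (∑-upTo-last n _))
    (≤-trans (+-mono-≤ (∑-mono-≤ n f≤g) (f≤g n)) (≤-reflexive (sym (∑-upTo-last n _))))

  infix 4 _⊑_
  -- This is `|x| ≤ y`, written without an absolute value.
  _⊑_ : Carrier → Carrier → Set ℓ₂
  x ⊑ y = (- y ≤ x) × (x ≤ y)

  ⊑-+ : ∀ {x y u v} → x ⊑ y → u ⊑ v → (x + u) ⊑ (y + v)
  ⊑-+ {x} {y} {u} {v} (l , h) (l′ , h′) =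
    ≤-trans (≤-reflexive (solve 2 (λ y v → :- (y :+ v) := :- y :+ :- v) refl y v)) (+-mono-≤ l l′) , +-mono-≤ h h′

  -- 2 (y v ∓ x u) is a sum of two products of the nonnegative numbers y ± x and v ± u.
  ⊑-* : ∀ {x y u v} → x ⊑ y → u ⊑ v → (x * u) ⊑ (y * v)
  ⊑-* {x} {y} {u} {v} (l , h) (l′ , h′) =
      *-cancelˡ-≤ (0<+ 0<1 0<1) (x≤y+z
        (solve 4 (λ x y a b → (:1 :+ :1) :* (x :* y) := (:1 :+ :1) :* (:- (a :* b)) :+ ((x :- (:- a)) :* (y :- (:- b)) :+ (a :- x) :* (b :- y))) refl x u y v)
        (0≤+ (0≤* (x≤y⇒0≤y-x l) (x≤y⇒0≤y-x l′)) (0≤* (x≤y⇒0≤y-x h) (x≤y⇒0≤y-x h′))))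
    , *-cancelˡ-≤ (0<+ 0<1 0<1) (x≤y+z
        (solve 4 (λ x y a b → (:1 :+ :1) :* (a :* b) := (:1 :+ :1) :* (x :* y) :+ ((a :- x) :* (y :- (:- b)) :+ (x :- (:- a)) :* (b :- y))) refl x u y v)
        (0≤+ (0≤* (x≤y⇒0≤y-x h) (x≤y⇒0≤y-x l′)) (0≤* (x≤y⇒0≤y-x l) (x≤y⇒0≤y-x h′))))

  ⊑-nonneg : ∀ {x} → 0# ≤ x → x ⊑ x
  ⊑-nonneg {x} 0≤x = x≤y+z (solve 1 (λ x → x := :- x :+ (x :+ x)) refl x) (0≤+ 0≤x 0≤x) , ≤-refl

  ⊑-^ : ∀ {x y} n → x ⊑ y → (x ^ n) ⊑ (y ^ n)
  ⊑-^ zero    x⊑y = ⊑-nonneg 0≤1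
  ⊑-^ (suc n) x⊑y = ⊑-* x⊑y (⊑-^ n x⊑y)

  ⊑-∑ : ∀ n {f g : ℕ → Carrier} → (∀ i → f i ⊑ g i) → ∑ (upTo n) f ⊑ ∑ (upTo n) g
  ⊑-∑ zero    f⊑g = ≤-trans (≤-reflexive (trans (-‿cong (∑-[] _)) (solve 0 (:- :0 := :0) refl))) (≤-reflexive (sym (∑-[] _))) ,
                    ≤-reflexive (trans (∑-[] _) (sym (∑-[] _)))
  ⊑-∑ (suc n) {f} {g} f⊑g = let l , h = ⊑-+ (⊑-∑ n f⊑g) (f⊑g n) in
    ≤-trans (≤-reflexive (-‿cong (∑-upTo-last n g))) (≤-trans l (≤-reflexive (sym (∑-upTo-last n f)))) ,
    ≤-trans (≤-reflexive (∑-upTo-last n f)) (≤-trans h (≤-reflexive (sym (∑-upTo-last n g))))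

  prefix : (ℕ → Carrier) → ℕ → Carrier
  prefix b k = ∑ (upTo (suc k)) b

  -- Taking partial sums is multiplication by `1 / (1 - t)`, which may be applied to the second
  -- factor alone.
  ∑-conv-prefix : ∀ a b N → ∑ (upTo (suc N)) (conv a b) ≈ conv a (prefix b) N
  ∑-conv-prefix a b zero    = trans (∑-upTo-last 0 _) (trans (+-congʳ (∑-[] _)) (trans (+-identityˡ _)
    (*-congˡ (sym (trans (∑-upTo-last 0 b) (trans (+-congʳ (∑-[] _)) (+-identityˡ _)))))))
  ∑-conv-prefix a b (suc N) = ≈.begin
    ∑ (upTo (suc (suc N))) (conv a b)
      ≈.≈⟨ ∑-upTo-head (suc N) (conv a b) ⟩
    a 0 * b 0 + ∑ (upTo (suc N)) (λ n → a 0 * b (suc n) + conv (a ∘ suc) b n)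
      ≈.≈⟨ +-congˡ (∑-distrib-+ (upTo (suc N)) _ _) ⟩
    a 0 * b 0 + (∑ (upTo (suc N)) (λ n → a 0 * b (suc n)) + ∑ (upTo (suc N)) (conv (a ∘ suc) b))
      ≈.≈⟨ +-assoc _ _ _ ⟨
    a 0 * b 0 + ∑ (upTo (suc N)) (λ n → a 0 * b (suc n)) + ∑ (upTo (suc N)) (conv (a ∘ suc) b)
      ≈.≈⟨ +-cong (trans (+-congˡ (sym (*-distribˡ-∑ (upTo (suc N)) (a 0) (b ∘ suc)))) (trans (sym (distribˡ _ _ _)) (*-congˡ (sym (∑-upTo-head (suc N) b)))))
             (∑-conv-prefix (a ∘ suc) b N) ⟩
    a 0 * prefix b (suc N) + conv (a ∘ suc) (prefix b) N ≈.∎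

  -- The part i + j > N of the product of two partial sums, with i ≤ N and j ≤ N + d.
  cross : (ℕ → Carrier) → (ℕ → Carrier) → ℕ → ℕ → Carrier
  cross a b zero    d = a 0 * ∑ (upTo d) (λ i → b (suc i))
  cross a b (suc N) d = a 0 * ∑ (upTo d) (λ i → b (suc (suc N) ℕ.+ i)) + cross (a ∘ suc) b N (suc d)

  prefix-+ : ∀ b N d → prefix b (N ℕ.+ d) ≈ prefix b N + ∑ (upTo d) (λ i → b (suc N ℕ.+ i))
  prefix-+ b N d = ∑-upTo-+ (suc N) d b

  prefix-0 : ∀ a → prefix a 0 ≈ a 0
  prefix-0 a = trans (∑-upTo-last 0 a) (trans (+-congʳ (∑-[] _)) (+-identityˡ _))

  -- The rectangle of index pairs splits into the triangle `i + j ≤ N` and the remaining corner. The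
  -- excess `d` is there for the induction, which shortens only the first factor.
  prefix-* : ∀ a b N d → prefix a N * prefix b (N ℕ.+ d) ≈ conv a (prefix b) N + cross a b N d
  prefix-* a b zero    d = trans (*-cong (prefix-0 a) (prefix-+ b 0 d)) (distribˡ _ _ _)
  prefix-* a b (suc N) d = ≈.begin
    prefix a (suc N) * prefix b (suc N ℕ.+ d)
      ≈.≈⟨ *-congʳ (∑-upTo-head (suc N) a) ⟩
    (a 0 + prefix (a ∘ suc) N) * prefix b (suc N ℕ.+ d)
      ≈.≈⟨ distribʳ _ _ _ ⟩
    a 0 * prefix b (suc N ℕ.+ d) + prefix (a ∘ suc) N * prefix b (suc N ℕ.+ d)
      ≈.≈⟨ +-cong (*-congˡ (prefix-+ b (suc N) d)) (trans (*-congˡ (reflexive (≡.cong (prefix b) (≡.sym (ℕₚ.+-suc N d))))) (prefix-* (a ∘ suc) b N (suc d))) ⟩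
    a 0 * (prefix b (suc N) + T) + (conv (a ∘ suc) (prefix b) N + cross (a ∘ suc) b N (suc d))
      ≈.≈⟨ solve 5 (λ a p t c x → a :* (p :+ t) :+ (c :+ x) := (a :* p :+ c) :+ (a :* t :+ x)) refl (a 0) (prefix b (suc N)) T _ _ ⟩
    conv a (prefix b) (suc N) + cross a b (suc N) d ≈.∎
    where T = ∑ (upTo d) (λ i → b (suc (suc N) ℕ.+ i))

  cross-⊑ : ∀ {a a′ b b′ : ℕ → Carrier} → (∀ i → a i ⊑ a′ i) → (∀ i → b i ⊑ b′ i) → ∀ N d → cross a b N d ⊑ cross a′ b′ N d
  cross-⊑ a⊑ b⊑ zero    d = ⊑-* (a⊑ 0) (⊑-∑ d (λ i → b⊑ (suc i)))
  cross-⊑ a⊑ b⊑ (suc N) d = ⊑-+ (⊑-* (a⊑ 0) (⊑-∑ d (λ i → b⊑ (suc (suc N) ℕ.+ i)))) (cross-⊑ (λ i → a⊑ (suc i)) b⊑ N (suc d))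

  0≤conv : ∀ {a b : ℕ → Carrier} → (∀ i → 0# ≤ a i) → (∀ i → 0# ≤ b i) → ∀ n → 0# ≤ conv a b n
  0≤conv 0≤a 0≤b zero    = 0≤* (0≤a 0) (0≤b 0)
  0≤conv 0≤a 0≤b (suc n) = 0≤+ (0≤* (0≤a 0) (0≤b (suc n))) (0≤conv (λ i → 0≤a (suc i)) 0≤b n)

  -- The rectangle is contained in the triangle `i + j ≤ N + K`.
  prefix-*-≤ : ∀ {a b : ℕ → Carrier} → (∀ i → 0# ≤ a i) → (∀ i → 0# ≤ b i) → ∀ N K →
    prefix a N * prefix b K ≤ conv a (prefix b) (N ℕ.+ K)
  prefix-*-≤ {a} {b} 0≤a 0≤b zero zero    = ≤-reflexive (*-congʳ (prefix-0 a))
  prefix-*-≤ {a} {b} 0≤a 0≤b zero (suc K) = ≤-trans (≤-reflexive (*-congʳ (prefix-0 a)))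
    (x≤y+z refl (0≤conv (λ i → 0≤a (suc i)) (λ i → 0≤∑ (suc i) 0≤b) K))
  prefix-*-≤ {a} {b} 0≤a 0≤b (suc N) K = ≤-trans
    (≤-reflexive (trans (*-congʳ (∑-upTo-head (suc N) a)) (distribʳ _ _ _)))
    (+-mono-≤ (*-monoʳ-≤ (0≤a 0) (≤-trans (x≤y+z (prefix-+ b K (suc N)) (0≤∑ (suc N) (λ i → 0≤b (suc K ℕ.+ i))))
                (≤-reflexive (reflexive (≡.cong (prefix b) (ℕₚ.+-comm K (suc N)))))))
      (prefix-*-≤ (λ i → 0≤a (suc i)) 0≤b N K))

  expTerm : Carrier → ℕ → Carrier
  expTerm x k = x ^ k * 1/ k !

  expTerm-0 : ∀ x → expTerm x 0 ≈ 1#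
  expTerm-0 x = trans (*-identityˡ _) 1/1≈1

  expTerm-suc : ∀ x k → fromℕ (suc k) * expTerm x (suc k) ≈ x * expTerm x k
  expTerm-suc x k = trans (solve 4 (λ n x y z → n :* (x :* y :* z) := x :* (y :* (n :* z))) refl (fromℕ (suc k)) x (x ^ k) (1/ (suc k) !))
    (*-congˡ (*-congˡ (1/!-suc k)))

  0≤expTerm : ∀ {x} → 0# ≤ x → ∀ k → 0# ≤ expTerm x k
  0≤expTerm 0≤x k = 0≤* (0≤^ k 0≤x) (<⇒≤ (0<1/ℕ (k !) {{k ℕₚ.!≢0}}))

  expTerm-⊑ : ∀ {x X} → x ⊑ X → ∀ k → expTerm x k ⊑ expTerm X k
  expTerm-⊑ x⊑X k = ⊑-* (⊑-^ k x⊑X) (⊑-nonneg (<⇒≤ (0<1/ℕ (k !) {{k ℕₚ.!≢0}})))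

  fromℕ-cancel : ∀ n {x y} → fromℕ (suc n) * x ≈ fromℕ (suc n) * y → x ≈ y
  fromℕ-cancel n eq = ≤-antisym (*-cancelˡ-≤ (0<fromℕ (suc n)) (≤-reflexive eq)) (*-cancelˡ-≤ (0<fromℕ (suc n)) (≤-reflexive (sym eq)))

  -- The binomial theorem divided by `n!`. By the product rule both sides satisfy
  -- `(n + 1) cₙ₊₁ = (x + y) cₙ`.
  conv-expTerm : ∀ x y n → conv (expTerm x) (expTerm y) n ≈ expTerm (x + y) n
  conv-expTerm x y zero    = trans (*-cong (expTerm-0 x) (expTerm-0 y)) (trans (*-identityˡ 1#) (sym (expTerm-0 (x + y))))
  conv-expTerm x y (suc n) = fromℕ-cancel n (≈.begin
    fromℕ (suc n) * conv (expTerm x) (expTerm y) (suc n)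
      ≈.≈⟨ conv-leibniz (expTerm x) (expTerm y) n ⟩
    conv (λ k → embed (suc k) * expTerm x (suc k)) (expTerm y) n + conv (expTerm x) (λ k → embed (suc k) * expTerm y (suc k)) n
      ≈.≈⟨ +-cong (trans (conv-cong n (λ k _ → expTerm-suc x k) (λ _ _ → refl)) (conv-*ˡ x (expTerm x) (expTerm y) n))
                  (trans (conv-cong n (λ _ _ → refl) (λ k _ → expTerm-suc y k)) (conv-*ʳ y (expTerm x) (expTerm y) n)) ⟩
    x * conv (expTerm x) (expTerm y) n + y * conv (expTerm x) (expTerm y) n
      ≈.≈⟨ distribʳ _ _ _ ⟨
    (x + y) * conv (expTerm x) (expTerm y) n
      ≈.≈⟨ *-congˡ (conv-expTerm x y n) ⟩
    (x + y) * expTerm (x + y) n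
      ≈.≈⟨ expTerm-suc (x + y) n ⟨
    fromℕ (suc n) * expTerm (x + y) (suc n) ≈.∎)

  E : Carrier → ℕ → Carrier
  E x = prefix (expTerm x)

  E-* : ∀ x y N → E x N * E y N ≈ E (x + y) N + cross (expTerm x) (expTerm y) N 0
  E-* x y N = ≈.begin
    E x N * E y N                                                          ≈.≡⟨ ≡.cong (λ k → E x N * E y k) (≡.sym (ℕₚ.+-identityʳ N)) ⟩
    E x N * E y (N ℕ.+ 0)                                                  ≈.≈⟨ prefix-* (expTerm x) (expTerm y) N 0 ⟩
    conv (expTerm x) (E y) N + cross (expTerm x) (expTerm y) N 0           ≈.≈⟨ +-congʳ (∑-conv-prefix (expTerm x) (expTerm y) N) ⟨
    ∑ (upTo (suc N)) (conv (expTerm x) (expTerm y)) + cross (expTerm x) (expTerm y) N 0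
      ≈.≈⟨ +-congʳ (∑-cong (upTo (suc N)) (conv-expTerm x y)) ⟩
    E (x + y) N + cross (expTerm x) (expTerm y) N 0                        ≈.∎

  E-*-≤ : ∀ {x y} → 0# ≤ x → 0# ≤ y → ∀ N → E x N * E y N ≤ E (x + y) (N ℕ.+ N)
  E-*-≤ {x} {y} 0≤x 0≤y N = ≤-trans (prefix-*-≤ (0≤expTerm 0≤x) (0≤expTerm 0≤y) N N)
    (≤-reflexive (trans (sym (∑-conv-prefix (expTerm x) (expTerm y) (N ℕ.+ N))) (∑-cong (upTo (suc (N ℕ.+ N))) (conv-expTerm x y))))

  module ExpProperties (exp : Carrier → Carrier) (isExp : IsExp exp) where

    E⟶exp : ∀ x → E x ⟶ exp x
    E⟶exp x = ⟶-subsequence suc ℕₚ.n≤1+n (⟶-cong (λ N → sym (reflexive (∑-def (upTo N) (expTerm x)))) refl (isExp x))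

    exp-cong : ∀ {x y} → x ≈ y → exp x ≈ exp y
    exp-cong {x} {y} x≈y = ⟶-unique (E⟶exp x) (⟶-cong (λ N → ∑-cong (upTo (suc N)) (λ k → *-congʳ (^-congˡ k (sym x≈y)))) refl (E⟶exp y))

    -- The corner is dominated by the one for bounds `X`, `Y` of `|x|`, `|y|`. That one is
    -- `E X N * E Y N - E (X + Y) N`, which is at most `E (X + Y) (2N) - E (X + Y) N`, a difference
    -- of two terms of one convergent sequence.
    cross-null : ∀ x y → (λ N → cross (expTerm x) (expTerm y) N 0) ⟶ 0#
    cross-null x y =
      let X , x<X = abs-bound x
          Y , y<Y = abs-bound y
          0≤X = <⇒≤ (abs-pos x<X)
          0≤Y = <⇒≤ (abs-pos y<Y)
          dominated : ∀ N → cross (expTerm x) (expTerm y) N 0 ⊑ cross (expTerm X) (expTerm Y) N 0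
          dominated N = cross-⊑ (expTerm-⊑ (<⇒≤ (proj₁ x<X) , <⇒≤ (proj₂ x<X))) (expTerm-⊑ (<⇒≤ (proj₁ y<Y) , <⇒≤ (proj₂ y<Y))) N 0
          bound : ∀ N → cross (expTerm X) (expTerm Y) N 0 ≤ E (X + Y) (N ℕ.+ N) - E (X + Y) N
          bound N = ≤-trans (≤-reflexive (trans (solve 2 (λ e c → c := e :+ c :- e) refl (E (X + Y) N) _) (+-congʳ (sym (E-* X Y N)))))
            (+-monoˡ-≤ _ (E-*-≤ 0≤X 0≤Y N))
      in ⟶-squeeze-null (λ N → ≤-trans (neg-mono-≤ (bound N)) (proj₁ (dominated N))) (λ N → ≤-trans (proj₂ (dominated N)) (bound N))
           (⟶-cong (λ _ → refl) (-‿inverseʳ _) (⟶-+ (⟶-subsequence (λ N → N ℕ.+ N) (λ N → ℕₚ.m≤m+n N N) (E⟶exp (X + Y))) (⟶-neg (E⟶exp (X + Y)))))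

    exp-+ : ∀ x y → exp (x + y) ≈ exp x * exp y
    exp-+ x y = ⟶-unique (⟶-cong (λ N → sym (E-* x y N)) (+-identityʳ _) (⟶-+ (E⟶exp (x + y)) (cross-null x y))) (⟶-* (E⟶exp x) (E⟶exp y))

    exp-0 : exp 0# ≈ 1#
    exp-0 = ⟶-unique (E⟶exp 0#) (⟶-cong (λ N → sym (eq N)) refl (⟶-const 1#))
      where
      eq : ∀ N → E 0# N ≈ 1#
      eq N = trans (∑-upTo-head N (expTerm 0#)) (trans (+-cong (expTerm-0 0#)
        (∑-zero (upTo N) (λ k → trans (*-congʳ (zeroˡ _)) (zeroˡ _)))) (+-identityʳ 1#))

    exp-inverse : ∀ x → exp x * exp (- x) ≈ 1#
    exp-inverse x = trans (sym (exp-+ x (- x))) (trans (exp-cong (-‿inverseʳ x)) exp-0)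

    1+x≤exp-nonneg : ∀ {x} → 0# ≤ x → 1# + x ≤ exp x
    1+x≤exp-nonneg {x} 0≤x = ⟶-≤ 0 (⟶-const (1# + x)) (⟶-subsequence suc ℕₚ.n≤1+n (E⟶exp x)) (λ N _ → x≤y+z (≈.begin
        E x (suc N)                                                     ≈.≈⟨ ∑-upTo-head (suc N) (expTerm x) ⟩
        expTerm x 0 + ∑ (upTo (suc N)) (expTerm x ∘ suc)                ≈.≈⟨ +-congˡ (∑-upTo-head N (expTerm x ∘ suc)) ⟩
        expTerm x 0 + (expTerm x 1 + ∑ (upTo N) (expTerm x ∘ suc ∘ suc)) ≈.≈⟨ +-assoc _ _ _ ⟨
        expTerm x 0 + expTerm x 1 + ∑ (upTo N) (expTerm x ∘ suc ∘ suc)  ≈.≈⟨ +-congʳ (+-cong (expTerm-0 x) (trans (*-congˡ 1/1≈1) (trans (*-identityʳ _) (*-identityʳ x)))) ⟩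
        1# + x + ∑ (upTo N) (expTerm x ∘ suc ∘ suc)                     ≈.∎)
      (0≤∑ N (λ k → 0≤expTerm 0≤x (suc (suc k)))))

    -- With `tₙ` for the terms, `x tₙ = (n + 1) tₙ₊₁`, so a step of the induction loses only
    -- `n tₙ₊₁ ≥ 0`. The last term is kept on the right because the next step consumes it.
    [1-x]E≤ : ∀ {x} → 0# ≤ x → ∀ N → (1# - x) * E x N ≤ 1# - x * expTerm x N
    [1-x]E≤ {x} 0≤x zero = ≤-reflexive (≈.begin
      (1# - x) * E x 0        ≈.≈⟨ *-congˡ (trans (prefix-0 (expTerm x)) (expTerm-0 x)) ⟩
      (1# - x) * 1#           ≈.≈⟨ solve 1 (λ x → (:1 :- x) :* :1 := :1 :- x :* :1) refl x ⟩
      1# - x * 1#             ≈.≈⟨ +-congˡ (-‿cong (*-congˡ (expTerm-0 x))) ⟨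
      1# - x * expTerm x 0    ≈.∎)
    [1-x]E≤ {x} 0≤x (suc N) = begin
      (1# - x) * E x (suc N)                                ≈⟨ *-congˡ (∑-upTo-last (suc N) (expTerm x)) ⟩
      (1# - x) * (E x N + t)                                ≈⟨ distribˡ _ _ _ ⟩
      (1# - x) * E x N + (1# - x) * t                       ≤⟨ +-monoˡ-≤ _ ([1-x]E≤ 0≤x N) ⟩
      1# - x * expTerm x N + (1# - x) * t                   ≈⟨ +-congʳ (+-congˡ (-‿cong (expTerm-suc x N))) ⟨
      1# - fromℕ (suc N) * t + (1# - x) * t                 ≤⟨ x≤y+z (solve 3 (λ x t n → :1 :- x :* t := :1 :- (:1 :+ n) :* t :+ (:1 :- x) :* t :+ n :* t) refl x t (fromℕ N))
                                                                 (0≤* (0≤fromℕ N) (0≤expTerm 0≤x (suc N))) ⟩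
      1# - x * t                                            ∎
      where
      open ≤-Reasoning
      t = expTerm x (suc N)

    -- Multiplied by `exp (- x)` this becomes `1 - x ≤ exp (- x)`: the tangent inequality at
    -- negative arguments, where the series alternates and cannot be bounded termwise.
    [1-x]exp≤1 : ∀ {x} → 0# ≤ x → (1# - x) * exp x ≤ 1#
    [1-x]exp≤1 {x} 0≤x = ⟶-≤ 0 (⟶-scale (1# - x) (E⟶exp x)) (⟶-const 1#) (λ N _ → ≤-trans ([1-x]E≤ 0≤x N)
      (x≤y+z (solve 1 (λ y → :1 := :1 :- y :+ y) refl _) (0≤* 0≤x (0≤expTerm 0≤x N))))

    1+x≤exp : ∀ x → 1# + x ≤ exp x
    1+x≤exp x = ≤-trichotomy 0# x
      (λ 0<x → 1+x≤exp-nonneg (<⇒≤ 0<x))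
      (λ 0≈x → 1+x≤exp-nonneg (≤-reflexive 0≈x))
      (λ x<0 → let 0<-x = <-respʳ (+-identityˡ (- x)) (x<y⇒0<y-x x<0) in
        *-cancelˡ-≤ (<-≤-trans (<-≤-trans 0<1 (x≤y+z refl (<⇒≤ 0<-x))) (1+x≤exp-nonneg (<⇒≤ 0<-x)))
          (≤-trans (≤-reflexive (solve 2 (λ e x → e :* (:1 :+ x) := (:1 :- (:- x)) :* e) refl (exp (- x)) x))
            (≤-trans ([1-x]exp≤1 (<⇒≤ 0<-x)) (≤-reflexive (trans (sym (exp-inverse x)) (*-comm _ _))))))

    0≤exp : ∀ x → 0# ≤ exp x
    -- The goal is absurdity itself, so the trichotomy is used with the true proposition `0# < 1#`
    -- as a dummy.
    0≤exp x expx<0 = ≤-trichotomy 0# x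
      (λ 0<x _ → 0<exp-nonneg (<⇒≤ 0<x) expx<0)
      (λ 0≈x _ → 0<exp-nonneg (≤-reflexive 0≈x) expx<0)
      (λ x<0 _ → <-irrefl (<-trans 0<1 (<-respˡ (exp-inverse x) (<-respʳ (zeroˡ _)
        (*-monoˡ-< (<-≤-trans 0<1 (≤-trans (x≤y+z refl (<⇒≤ (<-respʳ (+-identityˡ (- x)) (x<y⇒0<y-x x<0)))) (1+x≤exp (- x)))) expx<0)))))
      0<1
      where
      0<exp-nonneg : ∀ {x} → 0# ≤ x → 0# ≤ exp x
      0<exp-nonneg 0≤x = ≤-trans (≤-trans 0≤1 (x≤y+z refl 0≤x)) (1+x≤exp-nonneg 0≤x)

-- Convergence of tangent slopes of convex functions.

module ConvexLimits {c ℓ₁ ℓ₂ : Level} (R : RealField c ℓ₁ ℓ₂) where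
  open RealField R hiding (_^_; zero)
  open Analysis R using (recip; recip-inverseˡ; 0<recip; 1/ℕ; PosFun; IsDerivative)
  open RealKit R
  open RingKit ℝ
  private module ≈ = SetoidReasoning setoid

  IsDerivative-scale : ∀ a {f f′ : PosFun} → IsDerivative f f′ → IsDerivative (λ x 0<x → a * f x 0<x) (λ x 0<x → a * f′ x 0<x)
  IsDerivative-scale a {f} {f′} deriv x 0<x ε 0<ε =
    let B , a<B = abs-bound a
        0<B = abs-pos a<B
        δ , 0<δ , h = deriv x 0<x (ε * recip B 0<B) (*-pos 0<ε (0<recip B 0<B))
    in δ , 0<δ , λ y 0<y y#x y-x<δ → abs-resp
         (solve 5 (λ a u v i w → a :* ((u :- v) :* i :- w) := (a :* u :- a :* v) :* i :- a :* w) refl a (f y 0<y) (f x 0<x) _ (f′ x 0<x))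
         (abs-mono (≤-reflexive (trans (solve 3 (λ b e r → b :* (e :* r) := e :* (r :* b)) refl B ε (recip B 0<B))
             (trans (*-congˡ (recip-inverseˡ B 0<B)) (*-identityʳ ε))))
           (abs-* a<B (h y 0<y y#x y-x<δ)))

  -- A tangent line at x of a convex function is squeezed between the difference quotients to the left
  -- and to the right of x, so slopes pass to the limit together with the functions.
  module _ (f f′ : PosFun) (deriv : IsDerivative f f′) (fₙ : ℕ → PosFun) (x : Carrier) (0<x : 0# < x) (x<1 : x < 1#)
    (fₙ⟶f : ∀ y (0<y : 0# < y) → y < 1# → (λ n → fₙ n y 0<y) ⟶ f y 0<y)
    (g : ℕ → Carrier) (tangent : ∀ n y (0<y : 0# < y) → (y - x) * g n ≤ fₙ n y 0<y - fₙ n x 0<x) where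

    quotient : (y : Carrier) → 0# < y → Carrier → ℕ → Carrier
    quotient y 0<y i n = (fₙ n y 0<y - fₙ n x 0<x) * i

    -- First `y` is fixed, then `n` grows: one `η` is the error of the difference quotient of the
    -- limit function, the other that of the pointwise convergence at `x` and `y`.
    quotient-close : ∀ η → 0# < η → ∀ y 0<y → y < 1# → ∀ i → ∣ (f y 0<y - f x 0<x) * i - f′ x 0<x ∣< η →
      ∃[ N ] (∀ n → N ℕ.≤ n → ∣ quotient y 0<y i n - f′ x 0<x ∣< (η + η))
    quotient-close η 0<η y 0<y y<1 i close = proj₁ eventually , λ n N≤n →
      abs-resp (solve 3 (λ q p d → (q :- p) :+ (p :- d) := q :- d) refl (quotient y 0<y i n) ((f y 0<y - f x 0<x) * i) (f′ x 0<x))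
        (abs-+ (proj₂ eventually n N≤n) close)
      where
      limit : quotient y 0<y i ⟶ (f y 0<y - f x 0<x) * i
      limit = ⟶-* (⟶-+ (fₙ⟶f y 0<y y<1) (⟶-neg (fₙ⟶f x 0<x x<1))) (⟶-const i)
      eventually = limit η 0<η

    upper : ∀ η → 0# < η → ∀ y 0<y → y < 1# → x < y → (y#x : y # x) →
      ∣ (f y 0<y - f x 0<x) * proj₁ (#⇒invertible y#x) - f′ x 0<x ∣< η → ∃[ N ] (∀ n → N ℕ.≤ n → g n - f′ x 0<x < η + η)
    upper η 0<η y 0<y y<1 x<y y#x close with #⇒invertible y#x
    ... | i , id≈1 , di≈1 = proj₁ near , λ n N≤n → ≤-<-trans (+-monoˡ-≤ _ (g≤q n)) (proj₂ (proj₂ near n N≤n))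
      where
      near = quotient-close η 0<η y 0<y y<1 i close
      0<i : 0# < i
      0<i = <-respʳ (sym (recip-unique (x<y⇒0<y-x x<y) di≈1)) (0<recip _ _)
      g≤q : ∀ n → g n ≤ quotient y 0<y i n
      g≤q n = ≤-trans (≤-reflexive (trans (sym (*-identityˡ (g n))) (trans (*-congʳ (sym id≈1)) (*-assoc _ _ _))))
        (≤-trans (*-monoʳ-≤ (<⇒≤ 0<i) (tangent n y 0<y)) (≤-reflexive (*-comm _ _)))

    lower : ∀ η → 0# < η → ∀ y 0<y → y < 1# → y < x → (y#x : y # x) →
      ∣ (f y 0<y - f x 0<x) * proj₁ (#⇒invertible y#x) - f′ x 0<x ∣< η → ∃[ N ] (∀ n → N ℕ.≤ n → - (η + η) < g n - f′ x 0<x)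
    lower η 0<η y 0<y y<1 y<x y#x close with #⇒invertible y#x
    ... | i , id≈1 , di≈1 = proj₁ near , λ n N≤n → <-≤-trans (proj₁ (proj₂ near n N≤n)) (+-monoˡ-≤ _ (q≤g n))
      where
      near = quotient-close η 0<η y 0<y y<1 i close
      0<-i : 0# < - i
      0<-i = <-respʳ (sym (recip-unique (x<y⇒0<y-x y<x)
        (trans (solve 3 (λ x y i → (x :- y) :* (:- i) := (y :- x) :* i) refl x y i) di≈1))) (0<recip _ _)
      q≤g : ∀ n → quotient y 0<y i n ≤ g n
      q≤g n = ≤-trans (≤-reflexive (solve 2 (λ a i → a :* i := :- (:- i :* a)) refl (fₙ n y 0<y - fₙ n x 0<x) i))
        (≤-trans (neg-mono-≤ (*-monoʳ-≤ (<⇒≤ 0<-i) (tangent n y 0<y)))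
          (≤-reflexive (trans (solve 3 (λ i d g → :- (:- i :* (d :* g)) := i :* d :* g) refl i (y - x) (g n))
            (trans (*-congʳ id≈1) (*-identityˡ (g n))))))

    -- A step for which `x + h` and `x - h` stay in `(0 , 1)` and within `δ` of `x`; the reciprocal
    -- of a large integer takes the place of a minimum.
    nearby : ∀ δ → 0# < δ → ∃[ h ] (0# < h) × (h < δ) × (h < x) × (h < 1# - x)
    nearby δ 0<δ = 1/ℕ (suc M) , 0<1/ℕ (suc M) , proj₂ s₁ M (ℕₚ.m≤m⊔n (proj₁ s₁) _) ,
        proj₂ s₂ M (ℕₚ.≤-trans (ℕₚ.m≤m⊔n (proj₁ s₂) _) (ℕₚ.m≤n⊔m (proj₁ s₁) _)) ,
        proj₂ s₃ M (ℕₚ.≤-trans (ℕₚ.m≤n⊔m (proj₁ s₂) _) (ℕₚ.m≤n⊔m (proj₁ s₁) _))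
      where
      s₁ = small δ 0<δ
      s₂ = small x 0<x
      s₃ = small (1# - x) (x<y⇒0<y-x x<1)
      M = proj₁ s₁ ℕ.⊔ (proj₁ s₂ ℕ.⊔ proj₁ s₃)

    squeeze : ∀ {ε η δ h} → 0# < η → η + η ≈ ε → 0# < δ →
      (∀ y 0<y (y#x : y # x) → ∣ y - x ∣< δ → ∣ (f y 0<y - f x 0<x) * proj₁ (#⇒invertible y#x) - f′ x 0<x ∣< η) →
      0# < h → h < δ → h < x → h < 1# - x → ∃[ N ] (∀ n → N ℕ.≤ n → ∣ g n - f′ x 0<x ∣< ε)
    squeeze {ε} {η} {δ} {h} 0<η η+η≈ε 0<δ close 0<h h<δ h<x h<1-x = proj₁ up ℕ.⊔ proj₁ lo , λ n le →
        <-respˡ (-‿cong η+η≈ε) (proj₂ lo n (ℕₚ.≤-trans (ℕₚ.m≤n⊔m (proj₁ up) _) le)) ,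
        <-respʳ η+η≈ε (proj₂ up n (ℕₚ.≤-trans (ℕₚ.m≤m⊔n (proj₁ up) _) le))
      where
      -δ<0 : - δ < 0#
      -δ<0 = <-respʳ (solve 0 (:- :0 := :0) refl) (neg-mono-< 0<δ)
      x<y⁺ : x < x + h
      x<y⁺ = x<y+z refl 0<h
      y⁻<x : x - h < x
      y⁻<x = x<y+z (solve 2 (λ x h → x := x :- h :+ h) refl x h) 0<h
      y⁺<1 : x + h < 1#
      y⁺<1 = x<y+z (solve 2 (λ x h → :1 := x :+ h :+ (:1 :- x :- h)) refl x h) (x<y⇒0<y-x h<1-x)
      d⁺<δ : ∣ x + h - x ∣< δ
      d⁺<δ = abs-resp (solve 2 (λ x h → h := x :+ h :- x) refl x h) (<-trans -δ<0 0<h , h<δ)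
      d⁻<δ : ∣ x - h - x ∣< δ
      d⁻<δ = abs-resp (solve 2 (λ x h → :- h := x :- h :- x) refl x h) (abs-neg (<-trans -δ<0 0<h , h<δ))
      up : ∃[ N ] (∀ n → N ℕ.≤ n → g n - f′ x 0<x < η + η)
      up = upper η 0<η (x + h) (<-trans 0<x x<y⁺) y⁺<1 x<y⁺ (#-sym (<⇒# x<y⁺)) (close _ _ _ d⁺<δ)
      lo : ∃[ N ] (∀ n → N ℕ.≤ n → - (η + η) < g n - f′ x 0<x)
      lo = lower η 0<η (x - h) (x<y⇒0<y-x h<x) (<-trans y⁻<x x<1) y⁻<x (<⇒# y⁻<x) (close _ _ _ d⁻<δ)

    tangent⟶derivative : g ⟶ f′ x 0<x
    tangent⟶derivative ε 0<ε =
      let η , 0<η , η+η≈ε = half ε 0<ε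
          δ , 0<δ , close = deriv x 0<x η 0<η
          h , 0<h , h<δ , h<x , h<1-x = nearby δ 0<δ
      in squeeze 0<η η+η≈ε 0<δ close 0<h h<δ h<x h<1-x

-- Digamma and polygamma functions as limits of power sums.

module GammaLimits {c ℓ₁ ℓ₂ : Level} (R : RealField c ℓ₁ ℓ₂) where
  open RealField R hiding (_^_; zero)
  open Analysis R using (0<1; recip; recip-inverseˡ; 0<recip; 0<fromℕ; 0<+fromℕ; 1/ℕ; PosFun; IsExp; IsLog; IsGamma; IsPolygamma)
  open RealKit R
  open RingKit ℝ
  open Exponentials R
  open ConvexLimits R
  private module ≈ = SetoidReasoning setoid

  inv : ∀ x → 0# < x → ℕ → Carrier
  inv x 0<x i = recip (x + fromℕ i) (0<+fromℕ 0<x i)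

  inv-inverse : ∀ x 0<x i → inv x 0<x i * (x + fromℕ i) ≈ 1#
  inv-inverse x 0<x i = recip-inverseˡ _ _

  0≤inv : ∀ x 0<x i → 0# ≤ inv x 0<x i
  0≤inv x 0<x i = <⇒≤ (0<recip _ _)

  powerSum : ℕ → ℕ → PosFun
  powerSum k M x 0<x = ∑ (upTo M) (λ i → inv x 0<x i ^ k)

  0≤∏ : ∀ n {f : ℕ → Carrier} → (∀ i → 0# ≤ f i) → 0# ≤ ∏ (upTo n) f
  0≤∏ zero    0≤f = ≤-trans 0≤1 (≤-reflexive (sym (∏-[] _)))
  0≤∏ (suc n) 0≤f = ≤-trans (0≤* (0≤∏ n 0≤f) (0≤f n)) (≤-reflexive (sym (∏-upTo-last n _)))

  -- With b Y = 1 the difference of the two sides is, at each step of the induction, (k + 1) b aᵏ (1 - Y a)².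
  power-tangent : ∀ {a b Y} → 0# ≤ a → 0# ≤ b → b * Y ≈ 1# → ∀ k → a ^ k * (1# + fromℕ k * (1# - Y * a)) ≤ b ^ k
  power-tangent {a} {b} {Y} 0≤a 0≤b bY≈1 zero = ≤-reflexive (solve 2 (λ y a → :1 :* (:1 :+ :0 :* (:1 :- y :* a)) := :1) refl Y a)
  power-tangent {a} {b} {Y} 0≤a 0≤b bY≈1 (suc k) = begin
    a * a ^ k * (1# + (1# + fromℕ k) * (1# - Y * a))
      ≈⟨ *-congʳ (*-congʳ (trans (sym (*-identityˡ a)) (*-congʳ (sym bY≈1)))) ⟩
    b * Y * a * a ^ k * (1# + (1# + fromℕ k) * (1# - Y * a))
      ≤⟨ x≤y+z (solve 5 (λ a b Y p n → b :* (p :* (:1 :+ n :* (:1 :- Y :* a))) :=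
             b :* Y :* a :* p :* (:1 :+ (:1 :+ n) :* (:1 :- Y :* a)) :+ (:1 :+ n) :* (b :* p) :* ((:1 :- Y :* a) :* (:1 :- Y :* a))) refl a b Y (a ^ k) (fromℕ k))
           (0≤* (0≤* (0≤fromℕ (suc k)) (0≤* 0≤b (0≤^ k 0≤a))) (0≤x² _)) ⟩
    b * (a ^ k * (1# + fromℕ k * (1# - Y * a)))
      ≤⟨ *-monoʳ-≤ 0≤b (power-tangent 0≤a 0≤b bY≈1 k) ⟩
    b * b ^ k ∎
    where open ≤-Reasoning

  -- The tangent inequalities of the convex functions `(z + i)^(-k)`, added over `i`; the next power
  -- sum enters as their slope.
  powerSum-tangent : ∀ k M x 0<x y 0<y →
    (y - x) * - (fromℕ k * powerSum (suc k) M x 0<x) ≤ powerSum k M y 0<y - powerSum k M x 0<x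
  powerSum-tangent k M x 0<x y 0<y = begin
    (y - x) * - (fromℕ k * powerSum (suc k) M x 0<x)
      ≈⟨ solve 3 (λ d n s → d :* (:- (n :* s)) := (:- (d :* n)) :* s) refl (y - x) (fromℕ k) _ ⟩
    - ((y - x) * fromℕ k) * powerSum (suc k) M x 0<x
      ≈⟨ solve 2 (λ u v → v := u :+ v :- u) refl (powerSum k M x 0<x) _ ⟩
    powerSum k M x 0<x + - ((y - x) * fromℕ k) * powerSum (suc k) M x 0<x - powerSum k M x 0<x
      ≈⟨ +-congʳ (trans (+-congˡ (*-distribˡ-∑ (upTo M) _ _)) (sym (∑-distrib-+ (upTo M) _ _))) ⟩
    ∑ (upTo M) (λ i → inv x 0<x i ^ k + - ((y - x) * fromℕ k) * inv x 0<x i ^ suc k) - powerSum k M x 0<x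
      ≤⟨ +-monoˡ-≤ _ (∑-mono-≤ M term) ⟩
    powerSum k M y 0<y - powerSum k M x 0<x ∎
    where
    open ≤-Reasoning
    term : ∀ i → inv x 0<x i ^ k + - ((y - x) * fromℕ k) * inv x 0<x i ^ suc k ≤ inv y 0<y i ^ k
    term i = ≤-trans (≤-reflexive (≈.begin
        p + - ((y - x) * n) * (a * p)
          ≈.≈⟨ solve 6 (λ p y x n a z → p :+ (:- ((y :- x) :* n)) :* (a :* p) := p :* (:1 :+ n :* (a :* (x :+ z) :- (y :+ z) :* a))) refl p y x n a (fromℕ i) ⟩
        p * (1# + n * (a * (x + fromℕ i) - (y + fromℕ i) * a))
          ≈.≈⟨ *-congˡ (+-congˡ (*-congˡ (+-congʳ (inv-inverse x 0<x i)))) ⟩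
        p * (1# + n * (1# - (y + fromℕ i) * a)) ≈.∎))
      (power-tangent (0≤inv x 0<x i) (0≤inv y 0<y i) (inv-inverse y 0<y i) k)
      where
      a = inv x 0<x i
      p = a ^ k
      n = fromℕ k

  module _ (exp : Carrier → Carrier) (isExp : IsExp exp) (log : PosFun) (isLog : IsLog exp log) where
    open ExpProperties exp isExp

    logℕ : ℕ → Carrier
    logℕ n = log (fromℕ (suc n)) (0<fromℕ (suc n))

    eulerΓ : ℕ → PosFun
    eulerΓ n x 0<x = fromℕ (suc n !) * exp (x * logℕ n) * ∏ (upTo (suc (suc n))) (inv x 0<x)

    -- The logarithmic derivative of eulerΓ n.
    φ : ℕ → PosFun
    φ n x 0<x = logℕ n - ∑ (upTo (suc (suc n))) (inv x 0<x)

    0≤eulerΓ : ∀ n x 0<x → 0# ≤ eulerΓ n x 0<x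
    0≤eulerΓ n x 0<x = 0≤* (0≤* (0≤fromℕ (suc n !)) (0≤exp _)) (0≤∏ (suc (suc n)) (0≤inv x 0<x))

    -- Since `y + i = (x + i) (1 + h a) ≤ (x + i) exp (h a)` with `h = y - x` and `a = 1 / (x +
    -- i)`. It is the tangent inequality of `- log (z + i)`, exponentiated.
    inv-exp : ∀ x 0<x y 0<y i → inv x 0<x i * exp (- ((y - x) * inv x 0<x i)) ≤ inv y 0<y i
    inv-exp x 0<x y 0<y i = begin
      a * exp (- (h * a))
        ≈⟨ trans (*-congʳ (trans (sym (*-identityˡ a)) (*-congʳ (sym (inv-inverse y 0<y i))))) (*-assoc _ _ _) ⟩
      b * (y + fromℕ i) * (a * exp (- (h * a)))
        ≈⟨ solve 6 (λ b y z a e x → b :* (y :+ z) :* (a :* e) := b :* (a :* (x :+ z) :+ (y :- x) :* a) :* e) refl b y (fromℕ i) a _ x ⟩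
      b * (a * (x + fromℕ i) + h * a) * exp (- (h * a))
        ≈⟨ *-congʳ (*-congˡ (+-congʳ (inv-inverse x 0<x i))) ⟩
      b * (1# + h * a) * exp (- (h * a))
        ≤⟨ *-monoˡ-≤ (0≤exp _) (*-monoʳ-≤ (0≤inv y 0<y i) (1+x≤exp (h * a))) ⟩
      b * exp (h * a) * exp (- (h * a))
        ≈⟨ trans (*-assoc _ _ _) (trans (*-congˡ (exp-inverse (h * a))) (*-identityʳ b)) ⟩
      b ∎
      where
      open ≤-Reasoning
      h = y - x
      a = inv x 0<x i
      b = inv y 0<y i

    ∏-inv-exp : ∀ M x 0<x y 0<y →
      ∏ (upTo M) (inv x 0<x) * exp (- ((y - x) * ∑ (upTo M) (inv x 0<x))) ≤ ∏ (upTo M) (inv y 0<y)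
    ∏-inv-exp zero x 0<x y 0<y = ≤-reflexive (trans (*-cong (∏-[] _) (trans (exp-cong
      (trans (-‿cong (*-congˡ (∑-[] _))) (solve 1 (λ h → :- (h :* :0) := :0) refl (y - x)))) exp-0)) (trans (*-identityˡ 1#) (sym (∏-[] _))))
    ∏-inv-exp (suc M) x 0<x y 0<y = begin
      ∏ (upTo (suc M)) (inv x 0<x) * exp (- (h * ∑ (upTo (suc M)) (inv x 0<x)))
        ≈⟨ *-cong (∏-upTo-last M _) (trans (exp-cong (trans (-‿cong (*-congˡ (∑-upTo-last M _)))
             (solve 3 (λ h s a → :- (h :* (s :+ a)) := :- (h :* s) :+ :- (h :* a)) refl h S a))) (exp-+ _ _)) ⟩
      P * a * (exp (- (h * S)) * exp (- (h * a)))
        ≈⟨ solve 4 (λ p a u v → p :* a :* (u :* v) := p :* u :* (a :* v)) refl P a _ _ ⟩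
      P * exp (- (h * S)) * (a * exp (- (h * a)))
        ≤⟨ *-mono-≤ (0≤* (0≤inv x 0<x M) (0≤exp _)) (0≤∏ M (0≤inv y 0<y)) (∏-inv-exp M x 0<x y 0<y) (inv-exp x 0<x y 0<y M) ⟩
      ∏ (upTo M) (inv y 0<y) * inv y 0<y M
        ≈⟨ ∏-upTo-last M _ ⟨
      ∏ (upTo (suc M)) (inv y 0<y) ∎
      where
      open ≤-Reasoning
      h = y - x
      P = ∏ (upTo M) (inv x 0<x)
      S = ∑ (upTo M) (inv x 0<x)
      a = inv x 0<x M

    -- From `x` to `y = x + h` the exponential factor is multiplied by exactly `exp (h L)` and the
    -- product by at least `exp (- (h S))`, together `exp (h φ)`, to which `1 + z ≤ exp z` applies.
    -- This is the log-convexity of Euler's products.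
    eulerΓ-tangent : ∀ n x 0<x y 0<y → eulerΓ n x 0<x * (1# + (y - x) * φ n x 0<x) ≤ eulerΓ n y 0<y
    eulerΓ-tangent n x 0<x y 0<y = begin
      eulerΓ n x 0<x * (1# + h * φ n x 0<x)
        ≤⟨ *-monoʳ-≤ (0≤eulerΓ n x 0<x) (1+x≤exp (h * φ n x 0<x)) ⟩
      F * exp (x * L) * P * exp (h * (L - S))
        ≈⟨ *-congˡ (trans (exp-cong (solve 3 (λ h l s → h :* (l :- s) := h :* l :+ :- (h :* s)) refl h L S)) (exp-+ _ _)) ⟩
      F * exp (x * L) * P * (exp (h * L) * exp (- (h * S)))
        ≈⟨ solve 5 (λ f e p u v → f :* e :* p :* (u :* v) := f :* (e :* u) :* (p :* v)) refl F _ P _ _ ⟩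
      F * (exp (x * L) * exp (h * L)) * (P * exp (- (h * S)))
        ≈⟨ *-congʳ (*-congˡ (trans (sym (exp-+ _ _)) (exp-cong (solve 3 (λ x y l → x :* l :+ (y :- x) :* l := y :* l) refl x y L)))) ⟩
      F * exp (y * L) * (P * exp (- (h * S)))
        ≤⟨ *-monoʳ-≤ (0≤* (0≤fromℕ (suc n !)) (0≤exp _)) (∏-inv-exp (suc (suc n)) x 0<x y 0<y) ⟩
      eulerΓ n y 0<y ∎
      where
      open ≤-Reasoning
      h = y - x
      L = logℕ n
      F = fromℕ (suc n !)
      P = ∏ (upTo (suc (suc n))) (inv x 0<x)
      S = ∑ (upTo (suc (suc n))) (inv x 0<x)

    inv1 : ∀ i → inv 1# 0<1 i ≈ 1/ℕ (suc i)
    inv1 i = recip-cong _ _ refl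

    -- The comparison of harmonic sums with the logarithm, in exponential form; the step is
    -- `M + 2 = (M + 1) (1 + 1 / (M + 1))`.
    fromℕ≤exp-harmonic : ∀ M → fromℕ (suc M) ≤ exp (∑ (upTo M) (inv 1# 0<1))
    fromℕ≤exp-harmonic zero    = ≤-reflexive (trans (+-identityʳ 1#) (sym (trans (exp-cong (∑-[] _)) exp-0)))
    fromℕ≤exp-harmonic (suc M) = begin
      1# + fromℕ (suc M)                                ≈⟨ +-congʳ (recip-inverseʳ _ _) ⟨
      fromℕ (suc M) * 1/ℕ (suc M) + fromℕ (suc M)       ≈⟨ +-congʳ (*-congˡ (inv1 M)) ⟨
      fromℕ (suc M) * a + fromℕ (suc M)                 ≈⟨ solve 2 (λ n a → n :* a :+ n := n :* (:1 :+ a)) refl _ a ⟩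
      fromℕ (suc M) * (1# + a)                          ≤⟨ *-mono-≤ (0≤+ 0≤1 (0≤inv 1# 0<1 M)) (0≤exp _) (fromℕ≤exp-harmonic M) (1+x≤exp a) ⟩
      exp H * exp a                                     ≈⟨ exp-+ H a ⟨
      exp (H + a)                                       ≈⟨ exp-cong (∑-upTo-last M _) ⟨
      exp (∑ (upTo (suc M)) (inv 1# 0<1))               ∎
      where
      open ≤-Reasoning
      a = inv 1# 0<1 M
      H = ∑ (upTo M) (inv 1# 0<1)

    -- Otherwise, with `H` the harmonic sum of `n + 2` terms, `n + 1 = exp (log (n + 1)) ≥ exp H ≥ n
    -- + 3`. The detour through `exp` is forced, as the logarithm is given only as its right
    -- inverse.
    φ1≤0 : ∀ n → φ n 1# 0<1 ≤ 0#
    φ1≤0 n 0<φ = <-irrefl (begin-strict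
      fromℕ (suc n)                 ≈⟨ +-identityˡ _ ⟨
      0# + fromℕ (suc n)            <⟨ +-monoˡ-< _ 0<1 ⟩
      1# + fromℕ (suc n)            ≤⟨ fromℕ-mono-≤ (ℕₚ.n≤1+n (suc (suc n))) ⟩
      fromℕ (suc (suc (suc n)))     ≤⟨ fromℕ≤exp-harmonic (suc (suc n)) ⟩
      exp H                         ≈⟨ *-identityʳ _ ⟨
      exp H * 1#                    ≤⟨ *-monoʳ-≤ (0≤exp H) (≤-trans (x≤y+z refl (<⇒≤ 0<φ)) (1+x≤exp (φ n 1# 0<1))) ⟩
      exp H * exp (logℕ n - H)      ≈⟨ exp-+ H _ ⟨
      exp (H + (logℕ n - H))        ≈⟨ exp-cong (solve 2 (λ h l → h :+ (l :- h) := l) refl H (logℕ n)) ⟩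
      exp (logℕ n)                  ≈⟨ isLog _ _ ⟩
      fromℕ (suc n)                 ∎)
      where
      open ≤-Reasoning
      H = ∑ (upTo (suc (suc n))) (inv 1# 0<1)

    factorial*∏ : ∀ M → fromℕ (M !) * ∏ (upTo M) (inv 1# 0<1) ≈ 1#
    factorial*∏ zero    = trans (*-cong (+-identityʳ 1#) (∏-[] _)) (*-identityˡ 1#)
    factorial*∏ (suc M) = ≈.begin
      fromℕ (suc M ℕ.* M !) * ∏ (upTo (suc M)) (inv 1# 0<1)
        ≈.≈⟨ *-cong (embed-* (suc M) (M !)) (trans (∏-upTo-last M _) (*-congˡ (inv1 M))) ⟩
      (fromℕ (suc M) * fromℕ (M !)) * (∏ (upTo M) (inv 1# 0<1) * 1/ℕ (suc M))
        ≈.≈⟨ solve 4 (λ a b c d → (a :* b) :* (c :* d) := (a :* d) :* (b :* c)) refl _ _ _ _ ⟩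
      (fromℕ (suc M) * 1/ℕ (suc M)) * (fromℕ (M !) * ∏ (upTo M) (inv 1# 0<1))
        ≈.≈⟨ *-cong (recip-inverseʳ _ _) (factorial*∏ M) ⟩
      1# * 1#
        ≈.≈⟨ *-identityˡ 1# ⟩
      1# ≈.∎

    eulerΓ-1 : ∀ n → fromℕ (suc (suc n)) * eulerΓ n 1# 0<1 ≈ fromℕ (suc n)
    eulerΓ-1 n = ≈.begin
      fromℕ (suc (suc n)) * (fromℕ (suc n !) * exp (1# * logℕ n) * P)
        ≈.≈⟨ solve 4 (λ a b c d → a :* (b :* c :* d) := c :* (a :* b :* d)) refl _ _ _ _ ⟩
      exp (1# * logℕ n) * (fromℕ (suc (suc n)) * fromℕ (suc n !) * P)
        ≈.≈⟨ *-cong (trans (exp-cong (*-identityˡ _)) (isLog _ _)) (*-congʳ (sym (embed-* (suc (suc n)) (suc n !)))) ⟩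
      fromℕ (suc n) * (fromℕ (suc (suc n) !) * P)
        ≈.≈⟨ trans (*-congˡ (factorial*∏ (suc (suc n)))) (*-identityʳ _) ⟩
      fromℕ (suc n) ≈.∎
      where P = ∏ (upTo (suc (suc n))) (inv 1# 0<1)

    -- The tangent at 1 has slope φ n 1 ≤ 0 (relative to the value there), so on (0 , 1] it lies above the value at 1.
    1≤2*eulerΓ : ∀ n x 0<x → x < 1# → 1# ≤ (1# + 1#) * eulerΓ n x 0<x
    1≤2*eulerΓ n x 0<x x<1 = *-cancelˡ-≤ (0<fromℕ (suc (suc n))) (begin
      N₂ * 1#                                              ≤⟨ x≤y+z (solve 1 (λ n → (:1 :+ :1) :* (:1 :+ n) := (:1 :+ (:1 :+ n)) :* :1 :+ n) refl (fromℕ n)) (0≤fromℕ n) ⟩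
      (1# + 1#) * fromℕ (suc n)                            ≈⟨ *-congˡ (eulerΓ-1 n) ⟨
      (1# + 1#) * (N₂ * G₁)                                ≈⟨ solve 3 (λ t n g → t :* (n :* g) := n :* (t :* g)) refl _ N₂ G₁ ⟩
      N₂ * ((1# + 1#) * G₁)                                ≤⟨ *-monoʳ-≤ (0≤fromℕ (suc (suc n))) (*-monoʳ-≤ (0≤+ 0≤1 0≤1) G₁≤) ⟩
      N₂ * ((1# + 1#) * eulerΓ n x 0<x)                    ∎)
      where
      open ≤-Reasoning
      N₂ = fromℕ (suc (suc n))
      G₁ = eulerΓ n 1# 0<1
      G₁≤ : G₁ ≤ eulerΓ n x 0<x
      G₁≤ = ≤-trans (x≤y+z (solve 3 (λ g x f → g :* (:1 :+ (x :- :1) :* f) := g :+ g :* ((:1 :- x) :* (:0 :- f))) refl G₁ x (φ n 1# 0<1))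
          (0≤* (0≤eulerΓ n 1# 0<1) (0≤* (<⇒≤ (x<y⇒0<y-x x<1)) (x≤y⇒0≤y-x (φ1≤0 n)))))
        (eulerΓ-tangent n 1# 0<1 x 0<x)

    module _ (Γ : PosFun) (isGamma : IsGamma exp log Γ) (ψ : ℕ → PosFun) (isPolygamma : IsPolygamma Γ ψ) where

      eulerΓ⟶Γ : ∀ x 0<x → (λ n → eulerΓ n x 0<x) ⟶ Γ x 0<x
      eulerΓ⟶Γ x 0<x = ⟶-cong (λ n → *-congˡ (reflexive (≡.sym (∏-def (upTo (suc (suc n))) (inv x 0<x))))) refl (isGamma x 0<x)

      -- The slopes `φ n * eulerΓ n` tend to `Γ′ = ψ Γ`, and so does `ψ * eulerΓ n`. Hence
      -- `(φ n - ψ) * eulerΓ n` is null, and the lower bound 1/2 removes the second factor.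
      φ⟶ψ : ∀ x 0<x → x < 1# → (λ n → φ n x 0<x) ⟶ ψ 0 x 0<x
      φ⟶ψ x 0<x x<1 =
        let (Γ′ , derivΓ , ψΓ≈Γ′) , _ = isPolygamma
            φΓ⟶Γ′ = tangent⟶derivative Γ Γ′ derivΓ eulerΓ x 0<x x<1 (λ y 0<y _ → eulerΓ⟶Γ y 0<y)
              (λ n → φ n x 0<x * eulerΓ n x 0<x)
              (λ n y 0<y → ≤-trans (≤-reflexive (solve 3 (λ h f g → h :* (f :* g) := g :* (:1 :+ h :* f) :- g) refl (y - x) (φ n x 0<x) (eulerΓ n x 0<x)))
                (+-monoˡ-≤ _ (eulerΓ-tangent n x 0<x y 0<y)))
            2# = 1# + 1#
            0<2 : 0# < 2#
            0<2 = 0<+ 0<1 0<1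
        in ⟶-unnull (⟶-cancel-null {t = λ n → eulerΓ n x 0<x} (0<recip 2# 0<2)
             (λ n → *-cancelˡ-≤ 0<2 (≤-trans (≤-reflexive (recip-inverseʳ 2# 0<2)) (1≤2*eulerΓ n x 0<x x<1)))
             (⟶-cong (λ n → solve 3 (λ f g p → f :* g :- p :* g := (f :- p) :* g) refl (φ n x 0<x) (eulerΓ n x 0<x) (ψ 0 x 0<x))
               (trans (+-congˡ (-‿cong (ψΓ≈Γ′ x 0<x))) (-‿inverseʳ _))
               (⟶-+ φΓ⟶Γ′ (⟶-neg (⟶-scale (ψ 0 x 0<x) (eulerΓ⟶Γ x 0<x))))))

      -- Only the sum of the first powers diverges.
      divergence : ℕ → ℕ → Carrier
      divergence zero    n = logℕ n
      divergence (suc _) n = 0#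

      -- The series `(-1)^(l + 1) ψₗ(x) = l! ∑ᵢ (x + i)^(-l -
      -- 1)`, regularised by a logarithm when `l = 0`. The sign makes the approximations convex, so
      -- their slopes converge; multiplying these by `- 1` gives the case `l + 1`. The count `n + 2`
      -- is the number of factors of `eulerΓ n`.
      powerSum⟶ψ : ∀ l x 0<x → x < 1# →
        (λ n → fromℕ (l !) * powerSum (suc l) (suc (suc n)) x 0<x - divergence l n) ⟶ (- 1#) ^ suc l * ψ l x 0<x
      powerSum⟶ψ zero x 0<x x<1 = ⟶-cong
        (λ n → trans (solve 2 (λ l s → :- (l :- s) := (:1 :+ :0) :* s :- l) refl (logℕ n) _)
          (+-congʳ (*-congˡ (∑-cong (upTo (suc (suc n))) (λ i → sym (*-identityʳ _))))))
        (solve 1 (λ p → :- p := (:- :1) :* :1 :* p) refl _)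
        (⟶-neg (φ⟶ψ x 0<x x<1))
      powerSum⟶ψ (suc l) x 0<x x<1 = ⟶-cong
          (λ n → trans (solve 3 (λ a b s → :- :1 :* (a :* (:- (b :* s))) := b :* a :* s :- :0) refl (fromℕ (l !)) (fromℕ (suc l)) _)
            (+-congʳ (*-congʳ (sym (embed-* (suc l) (l !))))))
          (sym (*-assoc _ _ _))
          (⟶-scale (- 1#) slopes)
        where
        fₙ : ℕ → PosFun
        fₙ n y 0<y = fromℕ (l !) * powerSum (suc l) (suc (suc n)) y 0<y - divergence l n
        slope : ℕ → Carrier
        slope n = fromℕ (l !) * - (fromℕ (suc l) * powerSum (suc (suc l)) (suc (suc n)) x 0<x)
        slopes : slope ⟶ (- 1#) ^ suc l * ψ (suc l) x 0<x
        slopes = tangent⟶derivative _ _ (IsDerivative-scale ((- 1#) ^ suc l) (proj₂ isPolygamma l)) fₙ x 0<x x<1 (powerSum⟶ψ l) slope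
          (λ n y 0<y → ≤-trans
            (≤-reflexive (solve 3 (λ h a s → h :* (a :* s) := a :* (h :* s)) refl (y - x) (fromℕ (l !)) _))
            (≤-trans (*-monoʳ-≤ (0≤fromℕ (l !)) (powerSum-tangent (suc l) (suc (suc n)) x 0<x y 0<y))
              (≤-reflexive (solve 4 (λ a u v d → a :* (u :- v) := a :* u :- d :- (a :* v :- d)) refl (fromℕ (l !)) _ _ (divergence l n)))))

-- Complex numbers: ring structure and limits.

module ComplexKit {c ℓ₁ ℓ₂ : Level} (R : RealField c ℓ₁ ℓ₂) where
  open RealField R hiding (_^_; zero)
  open Analysis R using (ℂ; re; im; _≈ᶜ_; _+ᶜ_; _*ᶜ_; -ᶜ_; ofℝ; 0ᶜ; 1ᶜ; normSq; _⟶ᶜ_)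
  open RealKit R
  open RingKit ℝ using (solve; _:=_; _:+_; _:*_; _:-_; :-_; :0; :1)

  ℂring : CommutativeRing c ℓ₁
  ℂring = record
    { Carrier = ℂ ; _≈_ = _≈ᶜ_ ; _+_ = _+ᶜ_ ; _*_ = _*ᶜ_ ; -_ = -ᶜ_ ; 0# = 0ᶜ ; 1# = 1ᶜ
    ; isCommutativeRing = record
      { isRing = record
        { +-isAbelianGroup = record
          { isGroup = record
            { isMonoid = record
              { isSemigroup = record
                { isMagma = record
                  { isEquivalence = record
                    { refl  = refl , refl
                    ; sym   = λ (p , q) → sym p , sym q
                    ; trans = λ (p , q) (p′ , q′) → trans p p′ , trans q q′ }
                  ; ∙-cong = λ (p , q) (p′ , q′) → +-cong p p′ , +-cong q q′ }
                ; assoc = λ _ _ _ → +-assoc _ _ _ , +-assoc _ _ _ }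
              ; identity = (λ _ → +-identityˡ _ , +-identityˡ _) , (λ _ → +-identityʳ _ , +-identityʳ _) }
            ; inverse = (λ _ → -‿inverseˡ _ , -‿inverseˡ _) , (λ _ → -‿inverseʳ _ , -‿inverseʳ _)
            ; ⁻¹-cong = λ (p , q) → -‿cong p , -‿cong q }
          ; comm = λ _ _ → +-comm _ _ , +-comm _ _ }
        ; *-cong = λ (p , q) (p′ , q′) → +-cong (*-cong p p′) (-‿cong (*-cong q q′)) , +-cong (*-cong p q′) (*-cong q p′)
        ; *-assoc = λ z w v →
            solve 6 (λ a b a′ b′ x y → (a :* a′ :- b :* b′) :* x :- (a :* b′ :+ b :* a′) :* y := a :* (a′ :* x :- b′ :* y) :- b :* (a′ :* y :+ b′ :* x))
              refl (re z) (im z) (re w) (im w) (re v) (im v) ,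
            solve 6 (λ a b a′ b′ x y → (a :* a′ :- b :* b′) :* y :+ (a :* b′ :+ b :* a′) :* x := a :* (a′ :* y :+ b′ :* x) :+ b :* (a′ :* x :- b′ :* y))
              refl (re z) (im z) (re w) (im w) (re v) (im v)
        ; *-identity =
            (λ z → solve 2 (λ a b → :1 :* a :- :0 :* b := a) refl (re z) (im z) , solve 2 (λ a b → :1 :* b :+ :0 :* a := b) refl (re z) (im z)) ,
            (λ z → solve 2 (λ a b → a :* :1 :- b :* :0 := a) refl (re z) (im z) , solve 2 (λ a b → a :* :0 :+ b :* :1 := b) refl (re z) (im z))
        ; distrib =
            (λ z w v → solve 6 (λ a b a′ b′ x y → a :* (a′ :+ x) :- b :* (b′ :+ y) := (a :* a′ :- b :* b′) :+ (a :* x :- b :* y))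
                 refl (re z) (im z) (re w) (im w) (re v) (im v) ,
               solve 6 (λ a b a′ b′ x y → a :* (b′ :+ y) :+ b :* (a′ :+ x) := (a :* b′ :+ b :* a′) :+ (a :* y :+ b :* x))
                 refl (re z) (im z) (re w) (im w) (re v) (im v)) ,
            (λ z w v → solve 6 (λ a b a′ b′ x y → (a′ :+ x) :* a :- (b′ :+ y) :* b := (a′ :* a :- b′ :* b) :+ (x :* a :- y :* b))
                 refl (re z) (im z) (re w) (im w) (re v) (im v) ,
               solve 6 (λ a b a′ b′ x y → (a′ :+ x) :* b :+ (b′ :+ y) :* a := (a′ :* b :+ b′ :* a) :+ (x :* b :+ y :* a))
                 refl (re z) (im z) (re w) (im w) (re v) (im v)) }
      ; *-comm = λ z w →
          solve 4 (λ a b a′ b′ → a :* a′ :- b :* b′ := a′ :* a :- b′ :* b) refl (re z) (im z) (re w) (im w) ,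
          solve 4 (λ a b a′ b′ → a :* b′ :+ b :* a′ := a′ :* b :+ b′ :* a) refl (re z) (im z) (re w) (im w) } }

  module 𝕂 = RingKit ℂring
  module 𝔽 = RingKit ℝ
  private module C = CommutativeRing ℂring

  ofℝ-cong : ∀ {x y} → x ≈ y → ofℝ x ≈ᶜ ofℝ y
  ofℝ-cong x≈y = x≈y , refl

  ofℝ-+ : ∀ x y → ofℝ (x + y) ≈ᶜ ofℝ x +ᶜ ofℝ y
  ofℝ-+ x y = refl , sym (+-identityˡ 0#)

  ofℝ-* : ∀ x y → ofℝ (x * y) ≈ᶜ ofℝ x *ᶜ ofℝ y
  ofℝ-* x y = solve 2 (λ x y → x :* y := x :* y :- :0 :* :0) refl x y , solve 2 (λ x y → :0 := x :* :0 :+ :0 :* y) refl x y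

  ofℝ-^ : ∀ x n → ofℝ (x 𝔽.^ n) ≈ᶜ ofℝ x 𝕂.^ n
  ofℝ-^ x zero    = C.refl
  ofℝ-^ x (suc n) = C.trans (ofℝ-* x (x 𝔽.^ n)) (C.*-congˡ (ofℝ-^ x n))

  ofℝ-embed : ∀ n → ofℝ (fromℕ n) ≈ᶜ 𝕂.embed n
  ofℝ-embed zero    = C.refl
  ofℝ-embed (suc n) = C.trans (ofℝ-+ 1# (fromℕ n)) (C.+-congˡ (ofℝ-embed n))

  ofℝ-∑ : ∀ n (f : ℕ → Carrier) → ofℝ (𝔽.∑ (upTo n) f) ≈ᶜ 𝕂.∑ (upTo n) (ofℝ ∘ f)
  ofℝ-∑ zero    f = C.trans (ofℝ-cong (𝔽.∑-[] f)) (C.sym (𝕂.∑-[] _))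
  ofℝ-∑ (suc n) f = C.trans (ofℝ-cong (𝔽.∑-upTo-last n f)) (C.trans (ofℝ-+ _ _)
    (C.trans (C.+-congʳ (ofℝ-∑ n f)) (C.sym (𝕂.∑-upTo-last n _))))

  ofℝ-conv : ∀ a b n → ofℝ (𝔽.conv a b n) ≈ᶜ 𝕂.conv (ofℝ ∘ a) (ofℝ ∘ b) n
  ofℝ-conv a b zero    = ofℝ-* _ _
  ofℝ-conv a b (suc n) = C.trans (ofℝ-+ _ _) (C.+-cong (ofℝ-* _ _) (ofℝ-conv (a ∘ suc) b n))

  infix 4 _⟶²_
  -- Componentwise convergence, whose limit laws reduce to the real ones; the conversion to `⟶ᶜ`
  -- takes place only at the very end.
  _⟶²_ : (ℕ → ℂ) → ℂ → Set (c Level.⊔ ℓ₂)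
  s ⟶² l = ((λ n → re (s n)) ⟶ re l) × ((λ n → im (s n)) ⟶ im l)

  ⟶²⇒⟶ᶜ : ∀ {s l} → s ⟶² l → s ⟶ᶜ l
  ⟶²⇒⟶ᶜ {s} {l} (h , k) ε 0<ε =
    let η , 0<η , η+η≈ε = half ε 0<ε
        M , h′ = h η 0<η
        N , k′ = k η 0<η
    in M ℕ.⊔ N , λ n le → bound 0<η η+η≈ε (h′ n (ℕₚ.≤-trans (ℕₚ.m≤m⊔n M N) le)) (k′ n (ℕₚ.≤-trans (ℕₚ.m≤n⊔m M N) le))
    where
    bound : ∀ {x y η ε} → 0# < η → η + η ≈ ε → ∣ x ∣< η → ∣ y ∣< η → x * x + y * y < ε * ε
    bound {η = η} {ε} 0<η eq x<η y<η = <-≤-trans (+-mono-< (proj₂ (abs-* x<η x<η)) (proj₂ (abs-* y<η y<η)))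
      (≤-trans (x≤y+z (solve 1 (λ e → (e :+ e) :* (e :+ e) := e :* e :+ e :* e :+ (e :* e :+ e :* e)) refl η)
        (0≤+ (0≤x² η) (0≤x² η))) (≤-reflexive (*-cong eq eq)))

  ⟶²-cong : ∀ {s t : ℕ → ℂ} {a b} → (∀ n → s n ≈ᶜ t n) → a ≈ᶜ b → s ⟶² a → t ⟶² b
  ⟶²-cong s≈t a≈b (h , k) = ⟶-cong (λ n → proj₁ (s≈t n)) (proj₁ a≈b) h , ⟶-cong (λ n → proj₂ (s≈t n)) (proj₂ a≈b) k

  ⟶²-const : ∀ a → (λ _ → a) ⟶² a
  ⟶²-const a = ⟶-const (re a) , ⟶-const (im a)

  ⟶²-ofℝ : ∀ {s : ℕ → Carrier} {a} → s ⟶ a → (λ n → ofℝ (s n)) ⟶² ofℝ a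
  ⟶²-ofℝ s⟶a = s⟶a , ⟶-const 0#

  ⟶²-+ : ∀ {s t : ℕ → ℂ} {a b} → s ⟶² a → t ⟶² b → (λ n → s n +ᶜ t n) ⟶² a +ᶜ b
  ⟶²-+ (h , k) (h′ , k′) = ⟶-+ h h′ , ⟶-+ k k′

  ⟶²-* : ∀ {s t : ℕ → ℂ} {a b} → s ⟶² a → t ⟶² b → (λ n → s n *ᶜ t n) ⟶² a *ᶜ b
  ⟶²-* (h , k) (h′ , k′) = ⟶-+ (⟶-* h h′) (⟶-neg (⟶-* k k′)) , ⟶-+ (⟶-* h k′) (⟶-* k h′)

  ⟶²-^ : ∀ {s : ℕ → ℂ} {a} k → s ⟶² a → (λ n → s n 𝕂.^ k) ⟶² a 𝕂.^ k
  ⟶²-^ zero    h = ⟶²-const 1ᶜ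
  ⟶²-^ (suc k) h = ⟶²-* h (⟶²-^ k h)

  ⟶²-conv : ∀ {s t : ℕ → ℕ → ℂ} {a b : ℕ → ℂ} n → (∀ l → l ℕ.≤ n → (λ N → s N l) ⟶² a l) → (∀ l → l ℕ.≤ n → (λ N → t N l) ⟶² b l) →
    (λ N → 𝕂.conv (s N) (t N) n) ⟶² 𝕂.conv a b n
  ⟶²-conv zero    h k = ⟶²-* (h 0 z≤n) (k 0 z≤n)
  ⟶²-conv (suc n) h k = ⟶²-+ (⟶²-* (h 0 z≤n) (k (suc n) ℕₚ.≤-refl))
    (⟶²-conv n (λ l l≤n → h (suc l) (s≤s l≤n)) (λ l l≤n → k l (ℕₚ.m≤n⇒m≤1+n l≤n)))

  module _ {i} {I : Set i} where
    opaque
      unfolding 𝕂.∑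

      ⟶²-∑ : ∀ (xs : List I) {s : ℕ → I → ℂ} {a : I → ℂ} → (∀ x → (λ n → s n x) ⟶² a x) →
        (λ n → 𝕂.∑ xs (s n)) ⟶² 𝕂.∑ xs a
      ⟶²-∑ []       h = ⟶²-const 0ᶜ
      ⟶²-∑ (x ∷ xs) h = ⟶²-+ (h x) (⟶²-∑ xs h)

  ⟶²-unshift : ∀ {s : ℕ → ℂ} {a} k → (λ n → s (n ℕ.+ k)) ⟶² a → s ⟶² a
  ⟶²-unshift k (h , h′) = ⟶-unshift k h , ⟶-unshift k h′

  eventually-all : ∀ {p} (P : ℕ → ℕ → Set p) n → (∀ r → ∃[ N ] (∀ M → N ℕ.≤ M → P r M)) →
    ∃[ N ] (∀ r → r ℕ.< n → ∀ M → N ℕ.≤ M → P r M)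
  eventually-all P zero    h = 0 , λ r ()
  eventually-all P (suc n) h = proj₁ (eventually-all P n h) ℕ.⊔ proj₁ (h n) , go
    where
    go : ∀ r → r ℕ.< suc n → ∀ M → _ → P r M
    go r r<n M le with r ℕₚ.≟ n
    ... | yes ≡.refl = proj₂ (h r) M (ℕₚ.≤-trans (ℕₚ.m≤n⊔m _ _) le)
    ... | no  r≢n    = proj₂ (eventually-all P n h) r (ℕₚ.≤∧≢⇒< (ℕₚ.≤-pred r<n) r≢n) M (ℕₚ.≤-trans (ℕₚ.m≤m⊔n _ _) le)

  -- Write `n = (n / q) q + n % q`. The finitely many remainders have a common threshold `N`, which
  -- becomes `N q` for the whole sequence.
  ⟶-residues : ∀ q .{{_ : NonZero q}} {s : ℕ → Carrier} {a} → (∀ r → (λ M → s (M ℕ.* q ℕ.+ r)) ⟶ a) → s ⟶ a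
  ⟶-residues q {s} {a} h ε 0<ε =
    let N , k = eventually-all (λ r M → ∣ s (M ℕ.* q ℕ.+ r) - a ∣< ε) q (λ r → h r ε 0<ε)
    in N ℕ.* q , λ n le → ≡.subst (λ i → ∣ s i - a ∣< ε) (≡.trans (ℕₚ.+-comm _ (n DivMod.% q)) (≡.sym (DivMod.m≡m%n+[m/n]*n n q)))
         (k (n DivMod.% q) (DivMod.m%n<n n q) (n DivMod./ q)
           (≡.subst (ℕ._≤ n DivMod./ q) (DivMod.m*n/n≡m N q) (DivMod./-monoˡ-≤ q le)))

  ⟶²-residues : ∀ q .{{_ : NonZero q}} {s : ℕ → ℂ} {a} → (∀ r → (λ M → s (M ℕ.* q ℕ.+ r)) ⟶² a) → s ⟶² a
  ⟶²-residues q h = ⟶-residues q (λ r → proj₁ (h r)) , ⟶-residues q (λ r → proj₂ (h r))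

  -- Multiplication by the conjugate of `w` leaves `z` times the invertible real number `normSq w`.
  normSq-cancel : ∀ z w → 0# < normSq w → z *ᶜ w ≈ᶜ 0ᶜ → z ≈ᶜ 0ᶜ
  normSq-cancel z w 0<N (p , q) =
      cancel (trans (solve 4 (λ a b x y → a :* (x :* x :+ y :* y) := (a :* x :- b :* y) :* x :+ (a :* y :+ b :* x) :* y) refl (re z) (im z) (re w) (im w)) (vanish (re w) (im w))) ,
      cancel (trans (solve 4 (λ a b x y → b :* (x :* x :+ y :* y) := (a :* x :- b :* y) :* (:- y) :+ (a :* y :+ b :* x) :* x) refl (re z) (im z) (re w) (im w)) (vanish (- im w) (re w)))
    where
    vanish : ∀ x y → (re z * re w - im z * im w) * x + (re z * im w + im z * re w) * y ≈ 0#
    vanish x y = trans (+-cong (*-congʳ p) (*-congʳ q)) (solve 2 (λ x y → :0 :* x :+ :0 :* y := :0) refl x y)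
    cancel : ∀ {x} → x * normSq w ≈ 0# → x ≈ 0#
    cancel {x} xN≈0 = trans (sym (*-identityʳ x)) (trans (*-congˡ (sym (proj₂ (proj₂ inv)))) (trans (*-congˡ (*-congʳ N-0))
      (trans (sym (*-assoc _ _ _)) (trans (*-congʳ xN≈0) (zeroˡ _)))))
      where
      inv = #⇒invertible (#-sym (<⇒# 0<N))
      N-0 : normSq w - 0# ≈ normSq w
      N-0 = solve 1 (λ x → x :- :0 := x) refl (normSq w)

  -- With `normSq-cancel` this replaces the undecidable question whether a complex number vanishes:
  -- refuting `0# < normSq z` is enough.
  normSq-nonpos : ∀ z → normSq z ≤ 0# → z ≈ᶜ 0ᶜ
  normSq-nonpos z N≤0 = square-nonpos (≤-trans (x≤y+z refl (0≤x² (im z))) N≤0) , square-nonpos (≤-trans (x≤y+z (+-comm _ _) (0≤x² (re z))) N≤0)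
    where
    square-nonpos : ∀ {x} → x * x ≤ 0# → x ≈ 0#
    square-nonpos {x} x²≤0 = ≤-antisym
      (λ 0<x → x²≤0 (*-pos 0<x 0<x))
      (λ x<0 → x²≤0 (<-respʳ (solve 1 (λ x → (:0 :- x) :* (:0 :- x) := x :* x) refl x) (*-pos (x<y⇒0<y-x x<0) (x<y⇒0<y-x x<0))))

-- Units modulo `q` act on the residues by permutations.

module ModularInverse (q : ℕ) .{{_ : NonZero q}} where
  open DivMod

  %-*-inner : ∀ a m → (a ℕ.* (m % q)) % q ≡ (a ℕ.* m) % q
  %-*-inner a m = ≡.trans (%-distribˡ-* a (m % q) q)
    (≡.trans (≡.cong (λ k → ((a % q) ℕ.* k) % q) (m%n%n≡m%n m q)) (≡.sym (%-distribˡ-* a m q)))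

  -- If x a ≡ -1 then x (x a) is an inverse of a.
  inverse : ∀ a → gcd a q ≡ 1 → ∃[ b ] (a ℕ.* b) % q ≡ 1 % q
  inverse a gcd≡1 with coprime-Bézout (gcd≡1⇒coprime gcd≡1)
  ... | Bézout.+- x y eq = x , ≡.trans (≡.cong (_% q) (≡.trans (ℕₚ.*-comm a x) (≡.sym eq))) ([m+kn]%n≡m%n 1 y q)
  ... | Bézout.-+ x y eq = x ℕ.* (x ℕ.* a) , (begin
    (a ℕ.* (x ℕ.* (x ℕ.* a))) % q              ≡⟨ [m+kn]%n≡m%n _ y q ⟨
    (a ℕ.* (x ℕ.* (x ℕ.* a)) ℕ.+ y ℕ.* q) % q  ≡⟨ ≡.cong (_% q) identity ⟩
    (1 ℕ.+ x ℕ.* a ℕ.* y ℕ.* q) % q            ≡⟨ [m+kn]%n≡m%n 1 (x ℕ.* a ℕ.* y) q ⟩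
    1 % q                                      ∎)
    where
    open ≡.≡-Reasoning
    s = x ℕ.* a
    identity : a ℕ.* (x ℕ.* (x ℕ.* a)) ℕ.+ y ℕ.* q ≡ 1 ℕ.+ x ℕ.* a ℕ.* y ℕ.* q
    identity = begin
      a ℕ.* (x ℕ.* s) ℕ.+ y ℕ.* q    ≡⟨ ≡.cong₂ ℕ._+_ (≡.trans (≡.sym (ℕₚ.*-assoc a x s)) (≡.cong (ℕ._* s) (ℕₚ.*-comm a x))) (≡.sym eq) ⟩
      s ℕ.* s ℕ.+ suc s              ≡⟨ ℕₚ.+-suc (s ℕ.* s) s ⟩
      suc (s ℕ.* s ℕ.+ s)            ≡⟨ ≡.cong suc (≡.trans (ℕₚ.+-comm _ s) (≡.sym (ℕₚ.*-suc s s))) ⟩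
      suc (s ℕ.* suc s)              ≡⟨ ≡.cong (λ k → suc (s ℕ.* k)) eq ⟩
      suc (s ℕ.* (y ℕ.* q))          ≡⟨ ≡.cong suc (ℕₚ.*-assoc s y q) ⟨
      suc (s ℕ.* y ℕ.* q)            ∎

  scale : ℕ → Fin q → Fin q
  scale a r = fromℕ< (m%n<n (a ℕ.* toℕ r) q)

  toℕ-scale : ∀ a r → toℕ (scale a r) ≡ (a ℕ.* toℕ r) % q
  toℕ-scale a r = Finₚ.toℕ-fromℕ< _

  scale-inverse : ∀ a b → (a ℕ.* b) % q ≡ 1 % q → ∀ r → scale a (scale b r) ≡ r
  scale-inverse a b ab≡1 r = Finₚ.toℕ-injective (begin
    toℕ (scale a (scale b r))                   ≡⟨ toℕ-scale a (scale b r) ⟩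
    (a ℕ.* toℕ (scale b r)) % q                 ≡⟨ ≡.cong (λ k → (a ℕ.* k) % q) (toℕ-scale b r) ⟩
    (a ℕ.* ((b ℕ.* toℕ r) % q)) % q             ≡⟨ %-*-inner a (b ℕ.* toℕ r) ⟩
    (a ℕ.* (b ℕ.* toℕ r)) % q                   ≡⟨ ≡.cong (_% q) (ℕₚ.*-assoc a b (toℕ r)) ⟨
    (a ℕ.* b ℕ.* toℕ r) % q                     ≡⟨ %-distribˡ-* (a ℕ.* b) (toℕ r) q ⟩
    ((a ℕ.* b) % q ℕ.* (toℕ r % q)) % q         ≡⟨ ≡.cong (λ k → (k ℕ.* (toℕ r % q)) % q) ab≡1 ⟩
    (1 % q ℕ.* (toℕ r % q)) % q                 ≡⟨ %-distribˡ-* 1 (toℕ r) q ⟨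
    (1 ℕ.* toℕ r) % q                           ≡⟨ ≡.cong (_% q) (ℕₚ.*-identityˡ (toℕ r)) ⟩
    toℕ r % q                                   ≡⟨ m<n⇒m%n≡m (Finₚ.toℕ<n r) ⟩
    toℕ r                                       ∎)
    where open ≡.≡-Reasoning

  scaling : ∀ a → gcd a q ≡ 1 → Permutation′ q
  scaling a gcd≡1 = let b , ab≡1 = inverse a gcd≡1 in
    permutation (scale a) (scale b) (scale-inverse a b ab≡1) (scale-inverse b a (≡.trans (≡.cong (_% q) (ℕₚ.*-comm b a)) ab≡1))

-- Vanishing of the complete character sum.

module CharacterSums {c ℓ₁ ℓ₂ : Level} (R : RealField c ℓ₁ ℓ₂) where
  open Analysis R using (ℂ; _≈ᶜ_; _+ᶜ_; _*ᶜ_; -ᶜ_; 0ᶜ; 1ᶜ; normSq; IsDirichletCharacter; IsPrincipal)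
  open RealField R using (0#; _<_)
  
  open ComplexKit R
  open 𝕂
  private module C = CommutativeRing ℂring
  open SetoidReasoning C.setoid
  private module Σ = Algebra.Properties.CommutativeMonoid.Sum C.+-commutativeMonoid

  ∑-sum : ∀ n (f : Fin n → ℂ) → ∑ (allFin n) f ≈ᶜ Σ.sum f
  ∑-sum zero    f = ∑-[] f
  ∑-sum (suc n) f = C.trans (∑-allFin-head n f) (C.+-congˡ (∑-sum n (f ∘ fsuc)))

  ∑-allFin-permute : ∀ {n} (f : Fin n → ℂ) (π : Permutation′ n) → ∑ (allFin n) f ≈ᶜ ∑ (allFin n) (λ i → f (π ⟨$⟩ʳ i))
  ∑-allFin-permute {n} f π = C.trans (∑-sum n f) (C.trans (Σ.sum-permute f π) (C.sym (∑-sum n _)))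

  module _ (q : ℕ) .{{_ : NonZero q}} (χ : ℕ → ℂ) (isχ : IsDirichletCharacter q χ) where
    open IsDirichletCharacter isχ
    open ModularInverse q

    periodic-* : ∀ a k → χ (a ℕ.+ k ℕ.* q) ≈ᶜ χ a
    periodic-* a zero    = C.reflexive (≡.cong χ (ℕₚ.+-identityʳ a))
    periodic-* a (suc k) = C.trans (C.reflexive (≡.cong χ (≡.trans (≡.cong (a ℕ.+_) (ℕₚ.+-comm q (k ℕ.* q))) (≡.sym (ℕₚ.+-assoc a (k ℕ.* q) q)))))
      (C.trans (periodic (a ℕ.+ k ℕ.* q)) (periodic-* a k))

    χ-% : ∀ a → χ (a DivMod.% q) ≈ᶜ χ a
    χ-% a = C.trans (C.sym (periodic-* (a DivMod.% q) (a DivMod./ q))) (C.reflexive (≡.cong χ (≡.sym (DivMod.m≡m%n+[m/n]*n a q))))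

    total : ℂ
    total = ∑ (upTo q) χ

    -- Multiplication by `a` only permutes the residues.
    χ*total : ∀ a → gcd a q ≡ 1 → χ a *ᶜ total ≈ᶜ total
    χ*total a gcd≡1 = begin
      χ a *ᶜ total                                    ≈⟨ C.*-congˡ (∑-allFin-toℕ q χ) ⟨
      χ a *ᶜ ∑ (allFin q) (χ ∘ toℕ)                   ≈⟨ *-distribˡ-∑ (allFin q) (χ a) (χ ∘ toℕ) ⟩
      ∑ (allFin q) (λ r → χ a *ᶜ χ (toℕ r))           ≈⟨ ∑-cong (allFin q) (λ r → C.trans (C.sym (multiplicative a (toℕ r)))
                                                           (C.trans (C.sym (χ-% (a ℕ.* toℕ r))) (C.reflexive (≡.cong χ (≡.sym (toℕ-scale a r)))))) ⟩
      ∑ (allFin q) (λ r → χ (toℕ (scale a r)))        ≈⟨ ∑-allFin-permute (χ ∘ toℕ) (scaling a gcd≡1) ⟨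
      ∑ (allFin q) (χ ∘ toℕ)                          ≈⟨ ∑-allFin-toℕ q χ ⟩
      total                                           ∎

    -- Classically one picks `a` with `χ a` different from 1. Here the contrapositive is taken: if
    -- the sum had positive norm, it could be cancelled from `χ a * total = total` for every unit
    -- `a`, and `χ` would be principal.
    total≈0 : ¬ IsPrincipal q χ → total ≈ᶜ 0ᶜ
    total≈0 nonprincipal = normSq-nonpos total (λ 0<N → nonprincipal (λ a gcd≡1 → χ≈1 0<N a gcd≡1))
      where
      χ≈1 : 0# < normSq total → ∀ a → gcd a q ≡ 1 → χ a ≈ᶜ 1ᶜ
      χ≈1 0<N a gcd≡1 = begin
        χ a                       ≈⟨ solve 1 (λ x → x := (x :- :1) :+ :1) C.refl (χ a) ⟩
        (χ a +ᶜ (-ᶜ 1ᶜ)) +ᶜ 1ᶜ    ≈⟨ C.+-congʳ (normSq-cancel (χ a +ᶜ (-ᶜ 1ᶜ)) total 0<N (begin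
          (χ a +ᶜ (-ᶜ 1ᶜ)) *ᶜ total       ≈⟨ solve 2 (λ x s → (x :- :1) :* s := x :* s :- s) C.refl (χ a) total ⟩
          χ a *ᶜ total +ᶜ (-ᶜ total)      ≈⟨ C.+-congʳ (χ*total a gcd≡1) ⟩
          total +ᶜ (-ᶜ total)             ≈⟨ C.-‿inverseʳ total ⟩
          0ᶜ                              ∎)) ⟩
        0ᶜ +ᶜ 1ᶜ                  ≈⟨ C.+-identityˡ 1ᶜ ⟩
        1ᶜ                        ∎

    -- The residues of the theorem run from 1 to `q`, those of the permutation argument from 0 to
    -- `q - 1`; the two ends agree by periodicity.
    total-shift : ∑ (upTo q) (χ ∘ suc) ≈ᶜ total
    total-shift = begin
      S                        ≈⟨ solve 2 (λ s x → s := (x :+ s) :- x) C.refl S (χ 0) ⟩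
      χ 0 +ᶜ S +ᶜ (-ᶜ χ 0)     ≈⟨ C.+-cong (C.trans (C.sym (∑-upTo-head q χ)) (∑-upTo-last q χ)) (C.-‿cong (C.sym (periodic 0))) ⟩
      total +ᶜ χ q +ᶜ (-ᶜ χ q) ≈⟨ solve 2 (λ s x → s :+ x :- x := s) C.refl total (χ q) ⟩
      total                    ∎
      where S = ∑ (upTo q) (χ ∘ suc)

    -- Excludes the one modulus for which the residue `q` is coprime to `q`, so that `Φ q`, then
    -- empty, would miss it.
    modulus-1 : q ≡ 1 → IsPrincipal q χ
    modulus-1 ≡.refl a _ = C.trans (C.reflexive (≡.cong χ (≡.sym (ℕₚ.*-identityʳ a)))) (C.trans (periodic-* 0 a) (C.trans (C.sym (periodic 0)) one))

    -- The residue q itself, absent from Φ q, carries the value χ q = 0.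
    ∑-residues : ¬ q ≡ 1 → (f : ℕ → ℂ) → (∀ j → χ j ≈ᶜ 0ᶜ → f j ≈ᶜ 0ᶜ) →
      ∑ (upTo q) (f ∘ suc) ≈ᶜ ∑ (Φ q) (λ i → f (residue {q} i))
    ∑-residues q≢1 f f≈0 = begin
      ∑ (upTo q) (f ∘ suc)
        ≡⟨ ≡.cong (λ k → ∑ (upTo k) (f ∘ suc)) (≡.sym (ℕₚ.suc-pred q)) ⟩
      ∑ (upTo (suc (q ℕ.∸ 1))) (f ∘ suc)
        ≈⟨ ∑-upTo-last (q ℕ.∸ 1) (f ∘ suc) ⟩
      ∑ (upTo (q ℕ.∸ 1)) (f ∘ suc) +ᶜ f (suc (q ℕ.∸ 1))
        ≈⟨ C.+-congˡ (f≈0 _ (vanishes _ (λ eq → q≢1 (gcd≡1⇒coprime (≡.trans (≡.cong (λ k → gcd k q) (≡.sym (ℕₚ.suc-pred q))) eq) (∣-refl , ∣-refl))))) ⟩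
      ∑ (upTo (q ℕ.∸ 1)) (f ∘ suc) +ᶜ 0ᶜ
        ≈⟨ C.+-identityʳ _ ⟩
      ∑ (upTo (q ℕ.∸ 1)) (f ∘ suc)
        ≈⟨ ∑-allFin-toℕ (q ℕ.∸ 1) (f ∘ suc) ⟨
      ∑ (allFin (q ℕ.∸ 1)) (λ i → f (residue {q} i))
        ≈⟨ ∑-cong (allFin (q ℕ.∸ 1)) coprime-only ⟩
      ∑ (allFin (q ℕ.∸ 1)) (λ i → iverson (gcd (residue {q} i) q ℕₚ.≟ 1) *ᶜ f (residue {q} i))
        ≈⟨ ∑-filter (λ i → gcd (residue {q} i) q ℕₚ.≟ 1) (allFin (q ℕ.∸ 1)) _ ⟨
      ∑ (Φ q) (λ i → f (residue {q} i)) ∎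
      where
      coprime-only : ∀ i → f (residue {q} i) ≈ᶜ iverson (gcd (residue {q} i) q ℕₚ.≟ 1) *ᶜ f (residue {q} i)
      coprime-only i with gcd (residue {q} i) q ℕₚ.≟ 1
      ... | yes gcd≡1 = C.sym (C.trans (C.*-congʳ (iverson-yes (gcd (residue {q} i) q ℕₚ.≟ 1) gcd≡1)) (C.*-identityˡ _))
      ... | no  gcd≢1 = C.trans (f≈0 _ (vanishes _ gcd≢1)) (C.sym (C.trans (C.*-congʳ (iverson-no (gcd (residue {q} i) q ℕₚ.≟ 1) gcd≢1)) (C.zeroˡ _)))

    ∑χ≈0 : ¬ IsPrincipal q χ → ∑ (Φ q) (λ i → χ (residue {q} i)) ≈ᶜ 0ᶜ
    ∑χ≈0 nonprincipal = C.trans (C.sym (∑-residues (λ q≡1 → nonprincipal (modulus-1 q≡1)) χ (λ _ eq → eq)))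
      (C.trans total-shift (total≈0 nonprincipal))

-- Newton's identity for the truncated nested sums.

module NewtonIdentity {c ℓ₁ ℓ₂ : Level} (R : RealField c ℓ₁ ℓ₂) (χ : ℕ → Analysis.ℂ R) where
  open Analysis R using (ℂ; _≈ᶜ_; _+ᶜ_; _*ᶜ_; ofℝ; 1/ℕ; L*-partial)
  open ComplexKit R
  open 𝕂
  private module C = CommutativeRing ℂring
  open SetoidReasoning C.setoid

  term : ℕ → ℂ
  term i = χ (suc i) *ᶜ ofℝ (1/ℕ (suc i))

  -- The second index is the degree minus one, in step with logarithmic derivatives, which have no
  -- constant term.
  P : ℕ → ℕ → ℂ
  P N l = ∑ (upTo N) (λ i → term i ^ suc l)

  -- When the largest index is `N + 1`, the others may equal it as well; hence `suc N` in the last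
  -- factor.
  L*-partial-suc : ∀ k N → L*-partial χ (suc k) (suc N) ≈ᶜ L*-partial χ (suc k) N +ᶜ term N *ᶜ L*-partial χ k (suc N)
  L*-partial-suc k N = begin
    L*-partial χ (suc k) (suc N)   ≡⟨ ∑-def (upTo (suc N)) _ ⟨
    ∑ (upTo (suc N)) f             ≈⟨ ∑-upTo-last N f ⟩
    ∑ (upTo N) f +ᶜ f N            ≡⟨ ≡.cong (_+ᶜ f N) (∑-def (upTo N) f) ⟩
    L*-partial χ (suc k) N +ᶜ f N  ∎
    where
    f : ℕ → ℂ
    f i = term i *ᶜ L*-partial χ k (suc i)

  -- `L*-partial χ n N` is the complete homogeneous symmetric polynomial of degree `n` in the first
  -- `N` values of `term`, and the variables are added one at a time.
  newton : ∀ N n → embed (suc n) *ᶜ L*-partial χ (suc n) N ≈ᶜ conv (P N) (λ k → L*-partial χ k N) n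
  newton zero    n = C.trans (C.zeroʳ _) (C.sym (conv-zeroˡ (P 0) _ n (λ l → ∑-[] _)))
  newton (suc N) n = C.trans
    (newton-step (term N) (P N) (λ k → L*-partial χ k N) (λ k → L*-partial χ k (suc N)) C.refl (λ k → L*-partial-suc k N) (newton N) n)
    (conv-cong n (λ l _ → C.sym (∑-upTo-last N _)) (λ _ _ → C.refl))

-- Limits of the power sums, by residue classes.

module PowerSumLimits {c ℓ₁ ℓ₂ : Level} (R : RealField c ℓ₁ ℓ₂) where
  open RealField R hiding (_^_; zero)
  open Analysis R
  open RealKit R
  open ComplexKit R
  open GammaLimits R
  private
    module C = CommutativeRing ℂring
    module ≈ = SetoidReasoning setoid
    module ≈ᶜ = SetoidReasoning C.setoid

  module _ (exp : Carrier → Carrier) (isExp : IsExp exp) (log : PosFun) (isLog : IsLog exp log)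
    (Γ : PosFun) (isGamma : IsGamma exp log Γ) (ψ : ℕ → PosFun) (isPolygamma : IsPolygamma Γ ψ)
    (q : ℕ) .{{_ : NonZero q}} (χ : ℕ → ℂ) (isχ : IsDirichletCharacter q χ) (nonprincipal : ¬ IsPrincipal q χ) where

    open NewtonIdentity R χ
    open CharacterSums R using (periodic-*; modulus-1; ∑-residues; ∑χ≈0)

    Q : Carrier
    Q = 1/ℕ q

    point : ℕ → Carrier
    point r = suc r /ℕ q

    0<point : ∀ r → 0# < point r
    0<point r = 0</ℕ (suc r) q

    point<1 : ∀ r → suc r ℕ.< q → point r < 1#
    point<1 r r<q = <-respʳ (recip-inverseʳ (fromℕ q) (0<fromℕ q))
      (*-monoˡ-< (0<1/ℕ q) (<-≤-trans (x<y+z (+-comm 1# (fromℕ (suc r))) 0<1) (fromℕ-mono-≤ r<q)))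

    -- From `m q + r + 1 = q (m + (r + 1) / q)`; this is where the arguments `j / q` come from.
    1/ℕ-residue : ∀ m r → 1/ℕ (suc (m ℕ.* q ℕ.+ r)) ≈ Q * inv (point r) (0<point r) m
    1/ℕ-residue m r = sym (recip-unique _ (≈.begin
      fromℕ (suc (m ℕ.* q ℕ.+ r)) * (Q * v)
        ≈.≈⟨ *-congʳ (trans (reflexive (≡.cong fromℕ (≡.sym (ℕₚ.+-suc (m ℕ.* q) r)))) (trans (𝔽.embed-+ (m ℕ.* q) (suc r)) (+-congʳ (𝔽.embed-* m q)))) ⟩
      (fromℕ m * fromℕ q + fromℕ (suc r)) * (Q * v)
        ≈.≈⟨ 𝔽.solve 5 (λ m q j Q v → (m 𝔽.:* q 𝔽.:+ j) 𝔽.:* (Q 𝔽.:* v) 𝔽.:= v 𝔽.:* (j 𝔽.:* Q 𝔽.:+ m 𝔽.:* (q 𝔽.:* Q))) refl (fromℕ m) (fromℕ q) (fromℕ (suc r)) Q v ⟩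
      v * (point r + fromℕ m * (fromℕ q * Q))
        ≈.≈⟨ *-congˡ (+-congˡ (trans (*-congˡ (recip-inverseʳ (fromℕ q) (0<fromℕ q))) (*-identityʳ _))) ⟩
      v * (point r + fromℕ m)
        ≈.≈⟨ inv-inverse (point r) (0<point r) m ⟩
      1# ≈.∎))
      where v = inv (point r) (0<point r) m

    χ-residue : ∀ m r → χ (suc (m ℕ.* q ℕ.+ r)) ≈ᶜ χ (suc r)
    χ-residue m r = C.trans (C.reflexive (≡.cong χ (≡.cong suc (ℕₚ.+-comm (m ℕ.* q) r)))) (periodic-* q χ isχ (suc r) m)

    term-residue : ∀ l m r → term (m ℕ.* q ℕ.+ r) 𝕂.^ suc l ≈ᶜ
      χ (suc r) 𝕂.^ suc l *ᶜ ofℝ (Q 𝔽.^ suc l * inv (point r) (0<point r) m 𝔽.^ suc l)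
    term-residue l m r = C.trans
      (𝕂.^-congˡ (suc l) (C.*-cong (χ-residue m r) (ofℝ-cong (1/ℕ-residue m r))))
      (C.trans (𝕂.^-distrib-* (χ (suc r)) _ (suc l)) (C.*-congˡ (C.trans (C.sym (ofℝ-^ _ (suc l))) (ofℝ-cong (𝔽.^-distrib-* Q _ (suc l))))))

    -- The share of the residue `j` in the power sum of degree `l + 1`. The clause at 0 is a default
    -- that gives `block` the shape required by `∑-residues`, whose residues start at 1.
    block : ℕ → ℕ → ℕ → ℂ
    block l M zero    = 0ᶜ
    block l M (suc r) = χ (suc r) 𝕂.^ suc l *ᶜ ofℝ (Q 𝔽.^ suc l * powerSum (suc l) M (point r) (0<point r))

    P-blocks : ∀ l M → P (M ℕ.* q) l ≈ᶜ 𝕂.∑ (Φ q) (λ i → block l M (residue {q} i))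
    P-blocks l M = ≈ᶜ.begin
      P (M ℕ.* q) l
        ≈ᶜ.≈⟨ 𝕂.∑-upTo-* q M _ ⟩
      𝕂.∑ (upTo M) (λ m → 𝕂.∑ (upTo q) (λ r → term (m ℕ.* q ℕ.+ r) 𝕂.^ suc l))
        ≈ᶜ.≈⟨ 𝕂.∑-comm (upTo M) (upTo q) _ ⟩
      𝕂.∑ (upTo q) (λ r → 𝕂.∑ (upTo M) (λ m → term (m ℕ.* q ℕ.+ r) 𝕂.^ suc l))
        ≈ᶜ.≈⟨ 𝕂.∑-cong (upTo q) column ⟩
      𝕂.∑ (upTo q) (λ r → block l M (suc r))
        ≈ᶜ.≈⟨ ∑-residues q χ isχ (λ q≡1 → nonprincipal (modulus-1 q χ isχ q≡1)) (block l M) block≈0 ⟩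
      𝕂.∑ (Φ q) (λ i → block l M (residue {q} i)) ≈ᶜ.∎
      where
      block≈0 : ∀ j → χ j ≈ᶜ 0ᶜ → block l M j ≈ᶜ 0ᶜ
      block≈0 zero    _   = C.refl
      block≈0 (suc r) χ≈0 = C.trans (C.*-congʳ (C.trans (C.*-congʳ χ≈0) (C.zeroˡ _))) (C.zeroˡ _)
      column : ∀ r → 𝕂.∑ (upTo M) (λ m → term (m ℕ.* q ℕ.+ r) 𝕂.^ suc l) ≈ᶜ block l M (suc r)
      column r = ≈ᶜ.begin
        𝕂.∑ (upTo M) (λ m → term (m ℕ.* q ℕ.+ r) 𝕂.^ suc l)
          ≈ᶜ.≈⟨ 𝕂.∑-cong (upTo M) (λ m → term-residue l m r) ⟩
        𝕂.∑ (upTo M) (λ m → χ (suc r) 𝕂.^ suc l *ᶜ ofℝ (Q 𝔽.^ suc l * inv (point r) (0<point r) m 𝔽.^ suc l))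
          ≈ᶜ.≈⟨ 𝕂.*-distribˡ-∑ (upTo M) _ _ ⟨
        χ (suc r) 𝕂.^ suc l *ᶜ 𝕂.∑ (upTo M) (λ m → ofℝ (Q 𝔽.^ suc l * inv (point r) (0<point r) m 𝔽.^ suc l))
          ≈ᶜ.≈⟨ C.*-congˡ (C.trans (C.sym (ofℝ-∑ M _)) (ofℝ-cong (sym (𝔽.*-distribˡ-∑ (upTo M) _ _)))) ⟩
        block l M (suc r) ≈ᶜ.∎

    limitTerm : ℕ → ℕ → ℂ
    limitTerm l r = χ (suc r) 𝕂.^ suc l *ᶜ ofℝ (Q 𝔽.^ suc l * 1/ l ! * ((- 1#) 𝔽.^ suc l * ψ l (point r) (0<point r)))

    A : ℕ → ℂ
    A l = 𝕂.∑ (Φ q) (λ i → limitTerm l (toℕ i))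

    diverging : ℕ → ℕ → Carrier
    diverging = divergence exp isExp log isLog Γ isGamma ψ isPolygamma

    -- The divergent parts of the blocks cancel because the values of χ add up to 0.
    diverging-cancels : ∀ l n → 𝕂.∑ (Φ q) (λ i → χ (residue {q} i) 𝕂.^ suc l) *ᶜ ofℝ (Q 𝔽.^ suc l * 1/ l ! * diverging l n) ≈ᶜ 0ᶜ
    diverging-cancels zero    n = C.trans (C.*-congʳ (C.trans (𝕂.∑-cong (Φ q) (λ i → C.*-identityʳ _)) (∑χ≈0 q χ isχ nonprincipal))) (C.zeroˡ _)
    diverging-cancels (suc l) n = C.trans (C.*-congˡ (ofℝ-cong (zeroʳ _))) (C.zeroʳ _)

    -- Up to a multiple of `q`, every residue class contributes equally many terms, so the divergent
    -- part is common to all classes and appears multiplied by the sum of the `χ j`.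
    P⟶A-multiples : ∀ l → (λ n → P (suc (suc n) ℕ.* q) l) ⟶² A l
    P⟶A-multiples l = ⟶²-cong sum-eq C.refl (⟶²-∑ (Φ q) (λ i → summand⟶ i))
      where
      κ = Q 𝔽.^ suc l * 1/ l !
      regularised : ℕ → ℕ → Carrier
      regularised n r = fromℕ (l !) * powerSum (suc l) (suc (suc n)) (point r) (0<point r) - diverging l n
      summand : ℕ → ℕ → ℂ
      summand n r = χ (suc r) 𝕂.^ suc l *ᶜ ofℝ (κ * regularised n r)
      summand⟶ : ∀ (i : Fin (q ℕ.∸ 1)) → (λ n → summand n (toℕ i)) ⟶² limitTerm l (toℕ i)
      summand⟶ i = ⟶²-* (⟶²-const _) (⟶²-ofℝ (⟶-scale κ
        (powerSum⟶ψ exp isExp log isLog Γ isGamma ψ isPolygamma l (point (toℕ i)) (0<point (toℕ i)) (point<1 (toℕ i) residue<q))))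
        where
        residue<q : suc (toℕ i) ℕ.< q
        residue<q = ℕₚ.≤-trans (s≤s (Finₚ.toℕ<n i)) (ℕₚ.≤-reflexive (ℕₚ.suc-pred q))
      split : ∀ n r → summand n r +ᶜ χ (suc r) 𝕂.^ suc l *ᶜ ofℝ (κ * diverging l n) ≈ᶜ block l (suc (suc n)) (suc r)
      split n r = C.trans (C.sym (C.distribˡ _ _ _)) (C.*-congˡ (C.trans (C.sym (ofℝ-+ _ _)) (ofℝ-cong (≈.begin
        κ * (fromℕ (l !) * S - diverging l n) + κ * diverging l n
          ≈.≈⟨ 𝔽.solve 5 (λ Q f F S d → (Q 𝔽.:* f) 𝔽.:* (F 𝔽.:* S 𝔽.:- d) 𝔽.:+ (Q 𝔽.:* f) 𝔽.:* d 𝔽.:= Q 𝔽.:* ((f 𝔽.:* F) 𝔽.:* S))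
                 refl (Q 𝔽.^ suc l) (1/ l !) (fromℕ (l !)) S (diverging l n) ⟩
        Q 𝔽.^ suc l * ((1/ l ! * fromℕ (l !)) * S)
          ≈.≈⟨ *-congˡ (trans (*-congʳ (recip-inverseˡ _ _)) (*-identityˡ S)) ⟩
        Q 𝔽.^ suc l * S ≈.∎))))
        where S = powerSum (suc l) (suc (suc n)) (point r) (0<point r)
      sum-eq : ∀ n → 𝕂.∑ (Φ q) (λ i → summand n (toℕ i)) ≈ᶜ P (suc (suc n) ℕ.* q) l
      sum-eq n = ≈ᶜ.begin
        𝕂.∑ (Φ q) (λ i → summand n (toℕ i))
          ≈ᶜ.≈⟨ C.+-identityʳ _ ⟨
        𝕂.∑ (Φ q) (λ i → summand n (toℕ i)) +ᶜ 0ᶜ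
          ≈ᶜ.≈⟨ C.+-congˡ (diverging-cancels l n) ⟨
        𝕂.∑ (Φ q) (λ i → summand n (toℕ i)) +ᶜ 𝕂.∑ (Φ q) (λ i → χ (residue {q} i) 𝕂.^ suc l) *ᶜ ofℝ (κ * diverging l n)
          ≈ᶜ.≈⟨ C.+-congˡ (𝕂.*-distribʳ-∑ (Φ q) _ _) ⟩
        𝕂.∑ (Φ q) (λ i → summand n (toℕ i)) +ᶜ 𝕂.∑ (Φ q) (λ i → χ (residue {q} i) 𝕂.^ suc l *ᶜ ofℝ (κ * diverging l n))
          ≈ᶜ.≈⟨ 𝕂.∑-distrib-+ (Φ q) _ _ ⟨
        𝕂.∑ (Φ q) (λ i → summand n (toℕ i) +ᶜ χ (residue {q} i) 𝕂.^ suc l *ᶜ ofℝ (κ * diverging l n))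
          ≈ᶜ.≈⟨ 𝕂.∑-cong (Φ q) (λ i → split n (toℕ i)) ⟩
        𝕂.∑ (Φ q) (λ i → block l (suc (suc n)) (residue {q} i))
          ≈ᶜ.≈⟨ P-blocks l (suc (suc n)) ⟨
        P (suc (suc n) ℕ.* q) l ≈ᶜ.∎

    term-null : ∀ r → (λ M → term (M ℕ.* q ℕ.+ r)) ⟶² 0ᶜ
    term-null r = ⟶²-cong (λ M → C.*-congʳ (C.sym (χ-residue M r))) (C.zeroʳ (χ (suc r)))
      (⟶²-* (⟶²-const (χ (suc r))) (⟶²-ofℝ (⟶-subsequence (λ M → M ℕ.* q ℕ.+ r)
        (λ M → ℕₚ.≤-trans (ℕₚ.m≤m*n M q) (ℕₚ.m≤m+n _ r)) 1/ℕ-null)))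

    -- Beyond a multiple of `q` only `r` more terms are added, and each of them tends to zero.
    P⟶A-residue : ∀ l r → (λ M → P (M ℕ.* q ℕ.+ r) l) ⟶² A l
    -- The limit along multiples is known for `(n + 2) q`, hence the shift by 2.
    P⟶A-residue l zero = ⟶²-unshift 2 (⟶²-cong
      (λ n → C.reflexive (≡.cong (λ k → P k l) (≡.trans (≡.cong (ℕ._* q) (ℕₚ.+-comm 2 n)) (≡.sym (ℕₚ.+-identityʳ _))))) C.refl (P⟶A-multiples l))
    P⟶A-residue l (suc r) = ⟶²-cong
      (λ M → C.sym (C.trans (C.reflexive (≡.cong (λ k → P k l) (ℕₚ.+-suc (M ℕ.* q) r))) (𝕂.∑-upTo-last (M ℕ.* q ℕ.+ r) _)))
      (C.trans (C.+-congˡ (C.zeroˡ _)) (C.+-identityʳ _))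
      (⟶²-+ (P⟶A-residue l r) (⟶²-^ (suc l) (term-null r)))

    P⟶A : ∀ l → (λ N → P N l) ⟶² A l
    P⟶A l = ⟶²-residues q (P⟶A-residue l)

-- The recursion for the polygamma sums, and passage to the limit.

module BellFactors {c ℓ₁ ℓ₂ : Level} (R : RealField c ℓ₁ ℓ₂) where
  open RealField R hiding (_^_; zero)
  open Analysis R
  open RealKit R
  open Exponentials R
  open ComplexKit R
  private
    module C = CommutativeRing ℂring
    module ≈ = SetoidReasoning setoid
    module ≈ᶜ = SetoidReasoning C.setoid
    module B = BoxSeries ℝ

  module _ (ψ : ℕ → PosFun) (q : ℕ) .{{_ : NonZero q}} (χ : ℕ → ℂ) where

    x : ∀ j .{{_ : NonZero j}} → ℕ → Carrier
    x j p = ψ p (j /ℕ q) (0</ℕ j q)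

    -- Formally, `∑ₚ u j p s^(p + 1)` is the Taylor series of `log Γ (j/q + s) - log Γ (j/q)`.
    u : ∀ j .{{_ : NonZero j}} → ℕ → Carrier
    u j p = x j p * 1/ suc p !

    e : ∀ j .{{_ : NonZero j}} → ℕ → ℕ → Carrier
    e j p k = 1/ k ! * u j p 𝔽.^ k

    e-0 : ∀ j .{{_ : NonZero j}} p → e j p 0 ≈ 1#
    e-0 j p = trans (*-identityʳ _) 1/1≈1

    e-suc : ∀ j .{{_ : NonZero j}} p k → 𝔽.embed (suc k) * e j p (suc k) ≈ u j p * e j p k
    e-suc j p k = trans (𝔽.solve 4 (λ n f u v → n 𝔽.:* (f 𝔽.:* (u 𝔽.:* v)) 𝔽.:= u 𝔽.:* ((n 𝔽.:* f) 𝔽.:* v)) refl (fromℕ (suc k)) (1/ suc k !) (u j p) (u j p 𝔽.^ k))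
      (*-congˡ (*-congʳ (1/!-suc k)))

    module Exp (j : ℕ) .{{_ : NonZero j}} = B.Exponential (u j) (e j) (e-0 j) (e-suc j)

    bell-term : ∀ j .{{_ : NonZero j}} n k → bell n k (x j ∘ toℕ) ≈ fromℕ (n !) * Exp.bellTerm j n k
    bell-term j n k = trans (reflexive (≡.sym (𝔽.∑-def (bellIndices n k) _)))
      (trans (𝔽.∑-cong (bellIndices n k) (λ js → *-congˡ (reflexive (≡.sym (𝔽.∏-def (allFin (suc (n ℕ.∸ k))) _)))))
        (sym (𝔽.*-distribˡ-∑ (bellIndices n k) _ _)))

    -- The prefactor `1 / k!` cancels the `k!` in each Bell polynomial, and summation over the
    -- number of parts completes the coefficient of the exponential. The convention for `k = 0`
    -- agrees with its constant term 1.
    factor-Y : ∀ j .{{_ : NonZero j}} k → factor q χ ψ j k ≈ᶜ χ j 𝕂.^ k *ᶜ ofℝ (Exp.Y j k)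
    factor-Y j zero    = C.sym (C.trans (C.*-identityˡ _) (ofℝ-cong (Exp.Y-0 j)))
    factor-Y j (suc k) = C.*-congˡ (ofℝ-cong (≈.begin
      _
        ≈.≈⟨ *-congˡ (reflexive (≡.sym (𝔽.∑-def ks _))) ⟩
      1/ suc k ! * 𝔽.∑ ks (λ i → bell (suc k) i (x j ∘ toℕ))
        ≈.≈⟨ *-congˡ (trans (𝔽.∑-cong ks (bell-term j (suc k))) (sym (𝔽.*-distribˡ-∑ ks _ _))) ⟩
      1/ suc k ! * (fromℕ (suc k !) * 𝔽.∑ ks (Exp.bellTerm j (suc k)))
        ≈.≈⟨ trans (sym (*-assoc _ _ _)) (trans (*-congʳ (recip-inverseˡ _ _)) (*-identityˡ _)) ⟩
      𝔽.∑ ks (Exp.bellTerm j (suc k))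
        ≈.≈⟨ Exp.∑-bellTerm j k ⟩
      Exp.Y j (suc k) ≈.∎))
      where ks = List.map suc (upTo (suc k))

    a : ∀ j .{{_ : NonZero j}} → ℕ → ℂ
    a j l = χ j 𝕂.^ suc l *ᶜ ofℝ (x j l * 1/ l !)

    factor-suc : ∀ j .{{_ : NonZero j}} k → 𝕂.embed (suc k) *ᶜ factor q χ ψ j (suc k) ≈ᶜ 𝕂.conv (a j) (factor q χ ψ j) k
    factor-suc j k = ≈ᶜ.begin
      𝕂.embed (suc k) *ᶜ factor q χ ψ j (suc k)
        ≈ᶜ.≈⟨ C.*-cong (C.sym (ofℝ-embed (suc k))) (factor-Y j (suc k)) ⟩
      ofℝ (fromℕ (suc k)) *ᶜ (χ j 𝕂.^ suc k *ᶜ ofℝ (Exp.Y j (suc k)))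
        ≈ᶜ.≈⟨ 𝕂.solve 3 (λ n z y → n 𝕂.:* (z 𝕂.:* y) 𝕂.:= z 𝕂.:* (n 𝕂.:* y)) C.refl _ _ _ ⟩
      χ j 𝕂.^ suc k *ᶜ (ofℝ (fromℕ (suc k)) *ᶜ ofℝ (Exp.Y j (suc k)))
        ≈ᶜ.≈⟨ C.*-congˡ (C.trans (C.sym (ofℝ-* _ _)) (C.trans (ofℝ-cong (Exp.Y-suc j k)) (ofℝ-conv _ (Exp.Y j) k))) ⟩
      χ j 𝕂.^ suc k *ᶜ 𝕂.conv (λ l → ofℝ (fromℕ (suc l) * u j l)) (λ m → ofℝ (Exp.Y j m)) k
        ≈ᶜ.≈⟨ 𝕂.conv-geometric (χ j) _ _ k ⟨
      𝕂.conv (λ l → χ j 𝕂.^ suc l *ᶜ ofℝ (fromℕ (suc l) * u j l)) (λ m → χ j 𝕂.^ m *ᶜ ofℝ (Exp.Y j m)) k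
        ≈ᶜ.≈⟨ 𝕂.conv-cong k (λ l _ → C.*-congˡ (ofℝ-cong (weight-u l))) (λ m _ → C.sym (factor-Y j m)) ⟩
      𝕂.conv (a j) (factor q χ ψ j) k ≈ᶜ.∎
      where
      weight-u : ∀ l → fromℕ (suc l) * u j l ≈ x j l * 1/ l !
      weight-u l = trans (𝔽.solve 3 (λ n x f → n 𝔽.:* (x 𝔽.:* f) 𝔽.:= x 𝔽.:* (n 𝔽.:* f)) refl _ _ _) (*-congˡ (1/!-suc l))

    private
      m : ℕ
      m = length (Φ q)
      F : Fin m → ℕ → ℂ
      F i = factor q χ ψ (residue {q} (List.lookup (Φ q) i))

    module Prod = BoxSeries.Product ℂring F (λ i → a (residue {q} (List.lookup (Φ q) i)))
      (λ _ → C.refl) (λ i → factor-suc (residue {q} (List.lookup (Φ q) i)))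

    -- The prefactor `(-1)^n / q^n` amounts to substituting `ρ t` for `t` in the generating
    -- function.
    ρ : Carrier
    ρ = - 1# * 1/ℕ q

    1/ℕ-^ : ∀ n → 1/ℕ (q ℕ.^ n) {{ℕₚ.m^n≢0 q n}} ≈ 1/ℕ q 𝔽.^ n
    1/ℕ-^ n = sym (recip-unique _ (≈.begin
      fromℕ (q ℕ.^ n) * 1/ℕ q 𝔽.^ n       ≈.≈⟨ *-congʳ (𝔽.embed-^ q n) ⟩
      fromℕ q 𝔽.^ n * 1/ℕ q 𝔽.^ n         ≈.≈⟨ 𝔽.^-distrib-* (fromℕ q) (1/ℕ q) n ⟨
      (fromℕ q * 1/ℕ q) 𝔽.^ n             ≈.≈⟨ 𝔽.^-congˡ n (recip-inverseʳ _ _) ⟩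
      1# 𝔽.^ n                            ≈.≈⟨ 𝔽.1^n≈1 n ⟩
      1#                                  ≈.∎))

    polygammaSum-G : ∀ n → polygammaSum q χ ψ n ≈ᶜ ofℝ ρ 𝕂.^ n *ᶜ Prod.G n
    polygammaSum-G n = C.*-cong
      (C.trans (ofℝ-cong (trans (*-congˡ (1/ℕ-^ n)) (sym (𝔽.^-distrib-* (- 1#) (1/ℕ q) n)))) (ofℝ-^ ρ n))
      (C.trans (C.reflexive (≡.sym (𝕂.∑-def (families m n) _)))
        (𝕂.∑-cong (families m n) (λ κ → C.reflexive (≡.sym (𝕂.∏-def (allFin m) _)))))

    polygammaSum-0 : polygammaSum q χ ψ 0 ≈ᶜ 1ᶜ
    polygammaSum-0 = C.trans (polygammaSum-G 0) (C.trans (C.*-identityˡ _) Prod.G-0)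

    -- Written in the exact form of the limit `A` of the power sums, so that the two recursions have
    -- equal coefficients by definition.
    coefficient : ℕ → ℂ
    coefficient l = 𝕂.∑ (Φ q) (λ i → χ (residue {q} i) 𝕂.^ suc l *ᶜ
      ofℝ (1/ℕ q 𝔽.^ suc l * 1/ l ! * ((- 1#) 𝔽.^ suc l * x (residue {q} i) l)))

    coefficient-a : ∀ l → ofℝ ρ 𝕂.^ suc l *ᶜ 𝕂.∑ (allFin m) (λ i → a (residue {q} (List.lookup (Φ q) i)) l) ≈ᶜ coefficient l
    coefficient-a l = ≈ᶜ.begin
      ofℝ ρ 𝕂.^ suc l *ᶜ 𝕂.∑ (allFin m) (λ i → a (residue {q} (List.lookup (Φ q) i)) l)
        ≈ᶜ.≈⟨ C.*-congˡ (𝕂.∑-lookup (Φ q) (λ i → a (residue {q} i) l)) ⟩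
      ofℝ ρ 𝕂.^ suc l *ᶜ 𝕂.∑ (Φ q) (λ i → a (residue {q} i) l)
        ≈ᶜ.≈⟨ 𝕂.*-distribˡ-∑ (Φ q) _ _ ⟩
      𝕂.∑ (Φ q) (λ i → ofℝ ρ 𝕂.^ suc l *ᶜ a (residue {q} i) l)
        ≈ᶜ.≈⟨ 𝕂.∑-cong (Φ q) (λ i → summand (residue {q} i)) ⟩
      coefficient l ≈ᶜ.∎
      where
      summand : ∀ j .{{_ : NonZero j}} → ofℝ ρ 𝕂.^ suc l *ᶜ a j l ≈ᶜ
        χ j 𝕂.^ suc l *ᶜ ofℝ (1/ℕ q 𝔽.^ suc l * 1/ l ! * ((- 1#) 𝔽.^ suc l * x j l))
      summand j = C.trans (𝕂.solve 3 (λ r z y → r 𝕂.:* (z 𝕂.:* y) 𝕂.:= z 𝕂.:* (r 𝕂.:* y)) C.refl (ofℝ ρ 𝕂.^ suc l) _ _)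
        (C.*-congˡ (C.trans (C.*-congʳ (C.sym (ofℝ-^ ρ (suc l)))) (C.trans (C.sym (ofℝ-* _ _)) (ofℝ-cong
          (trans (*-congʳ (𝔽.^-distrib-* (- 1#) (1/ℕ q) (suc l)))
            (𝔽.solve 4 (λ s Q x f → (s 𝔽.:* Q) 𝔽.:* (x 𝔽.:* f) 𝔽.:= Q 𝔽.:* f 𝔽.:* (s 𝔽.:* x)) refl _ _ _ _))))))

    polygammaSum-suc : ∀ n → 𝕂.embed (suc n) *ᶜ polygammaSum q χ ψ (suc n) ≈ᶜ 𝕂.conv coefficient (polygammaSum q χ ψ) n
    polygammaSum-suc n = ≈ᶜ.begin
      𝕂.embed (suc n) *ᶜ polygammaSum q χ ψ (suc n)
        ≈ᶜ.≈⟨ C.*-congˡ (polygammaSum-G (suc n)) ⟩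
      𝕂.embed (suc n) *ᶜ (ofℝ ρ 𝕂.^ suc n *ᶜ Prod.G (suc n))
        ≈ᶜ.≈⟨ 𝕂.solve 3 (λ n z y → n 𝕂.:* (z 𝕂.:* y) 𝕂.:= z 𝕂.:* (n 𝕂.:* y)) C.refl (𝕂.embed (suc n)) (ofℝ ρ 𝕂.^ suc n) (Prod.G (suc n)) ⟩
      ofℝ ρ 𝕂.^ suc n *ᶜ (𝕂.embed (suc n) *ᶜ Prod.G (suc n))
        ≈ᶜ.≈⟨ C.*-congˡ (Prod.G-suc n) ⟩
      ofℝ ρ 𝕂.^ suc n *ᶜ 𝕂.conv S Prod.G n
        ≈ᶜ.≈⟨ 𝕂.conv-geometric (ofℝ ρ) S Prod.G n ⟨
      𝕂.conv (λ l → ofℝ ρ 𝕂.^ suc l *ᶜ S l) (λ k → ofℝ ρ 𝕂.^ k *ᶜ Prod.G k) n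
        ≈ᶜ.≈⟨ 𝕂.conv-cong n (λ l _ → coefficient-a l) (λ k _ → C.sym (polygammaSum-G k)) ⟩
      𝕂.conv coefficient (polygammaSum q χ ψ) n ≈ᶜ.∎
      where
      S : ℕ → ℂ
      S l = 𝕂.∑ (allFin m) (λ i → a (residue {q} (List.lookup (Φ q) i)) l)

  -- After division by `k + 1` the recursion expresses each term as a polynomial in power sums and
  -- earlier terms, and finite sums and products are continuous. The bound `n` makes the induction
  -- course-of-values.
  newton-limit : ∀ (s : ℕ → ℕ → ℂ) (p : ℕ → ℕ → ℂ) (A l : ℕ → ℂ) →
    (∀ N n → 𝕂.embed (suc n) *ᶜ s (suc n) N ≈ᶜ 𝕂.conv (p N) (λ k → s k N) n) →
    (∀ n → 𝕂.embed (suc n) *ᶜ l (suc n) ≈ᶜ 𝕂.conv A l n) →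
    (∀ k → (λ N → p N k) ⟶² A k) → s 0 ⟶² l 0 → ∀ n k → k ℕ.≤ n → s k ⟶² l k
  newton-limit s p A l s-suc l-suc p⟶A s0 n       zero    _ = s0
  newton-limit s p A l s-suc l-suc p⟶A s0 (suc n) (suc k) (s≤s k≤n) = ⟶²-cong
    (λ N → divide _ _ (s-suc N k)) (divide _ _ (l-suc k))
    (⟶²-* (⟶²-const (ofℝ (1/ℕ (suc k)))) (⟶²-conv k (λ i _ → p⟶A i)
      (λ i i≤k → newton-limit s p A l s-suc l-suc p⟶A s0 n i (ℕₚ.≤-trans i≤k k≤n))))
    where
    divide : ∀ z w → 𝕂.embed (suc k) *ᶜ z ≈ᶜ w → ofℝ (1/ℕ (suc k)) *ᶜ w ≈ᶜ z
    divide z w eq = C.trans (C.*-congˡ (C.sym eq)) (C.trans (C.sym (C.*-assoc _ _ _)) (C.trans (C.*-congʳ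
      (C.trans (C.*-congˡ (C.sym (ofℝ-embed (suc k)))) (C.trans (C.sym (ofℝ-* _ _)) (ofℝ-cong (recip-inverseˡ _ _))))) (C.*-identityˡ z)))

open import Data.Nat.Base using (_≤_)

theorem5 :
    {c ℓ₁ ℓ₂ : Level} (R : RealField c ℓ₁ ℓ₂) →
    let open RealField R using (Carrier)
        open Analysis R
    in
    (exp : Carrier → Carrier) → IsExp exp →
    (log : PosFun) → IsLog exp log →
    (Γ : PosFun) → IsGamma exp log Γ →
    (ψ : ℕ → PosFun) → IsPolygamma Γ ψ →
    (q : ℕ) .{{_ : NonZero q}} (χ : ℕ → ℂ) →
    IsPrimitiveCharacter q χ →
    ¬ IsPrincipal q χ →
    (n : ℕ) → 1 ≤ n →
    L*-partial χ n ⟶ᶜ polygammaSum q χ ψ n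
theorem5 R exp isExp log isLog Γ isGamma ψ isPolygamma q χ isPrimitive nonprincipal n _ =
  ⟶²⇒⟶ᶜ (newton-limit (L*-partial χ) P (coefficient ψ q χ) (polygammaSum q χ ψ) newton (polygammaSum-suc ψ q χ)
    (P⟶A exp isExp log isLog Γ isGamma ψ isPolygamma q χ (IsPrimitiveCharacter.isDirichletCharacter isPrimitive) nonprincipal)
    -- In degree zero both sides are 1: the empty nested sum on the left, the single zero family on
    -- the right.
    (⟶²-cong (λ _ → refl , refl) (let (p , r) = polygammaSum-0 ψ q χ in sym p , sym r) (⟶²-const 1ᶜ)) n n ℕₚ.≤-refl)
  where
  open RealField R using (refl; sym)
  open Analysis R
  open ComplexKit R using (⟶²⇒⟶ᶜ; ⟶²-cong; ⟶²-const)
  open NewtonIdentity R χ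
  open PowerSumLimits R
  open BellFactors R
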